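{- For any $\beta\ge 1$, any composable core-set of size at most $k^\beta$ for the $k$-determinant maximization problem must incur an approximation factor of at least $\left(\frac{k}{\beta}\right)^{k(1-o(1))}$, where $o(1)\to0$ as $k\to\infty$ (with $\beta$ constant). That is: for every constant $\beta\ge1$ there is a function $\delta(k)\to0$ as $k\to\infty$ such that for all $d\ge k$, if a function $c(\cdot)$ is an $\alpha$-composable core-set of size at most $k^\beta$ for the $k$-determinant maximization objective on $\mathbb{R}^d$, then $\alpha\ge\left(\frac{k}{\beta}\right)^{k(1-\delta(k))}$.
   Context: For $A\in\mathbb{R}^{d\times d}$, $\det_k(A)=\sum_{S\in\binom{[d]}{k}}\det A_{S,S}$. The $k$-determinant maximization objective of a finite set $V\subset\mathbb{R}^d$ is $f_k(V)=\max_{S\subseteq V,\,|S|=k}\det_k\big(\sum_{v\in S}vv^\intercal\big)$, with $f_k(V)=0$ if $|V|<k$. A function $c(\cdot)$ mapping each finite $V\subset\mathbb{R}^d$ to a subset of $V$ is an $\alpha$-composable core-set of size $t$ for $f_k$ if $|c(V)|\le t$ for all $V$ and $f_k(c(V_1)\cup\dots\cup c(V_p))\ge\frac1\alpha f_k(V_1\cup\dots\cup V_p)$ for every finite collection of finite sets $V_1,\dots,V_p\subset\mathbb{R}^d$. -}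

module Defs where

open import Algebra.Bundles using (CommutativeRing)
open import Algebra.Structures using (IsCommutativeRing)
import Algebra.Properties.Ring as RingProperties
import Algebra.Properties.Semiring.Exp as SemiringExp
import Algebra.Properties.Semiring.Mult as SemiringMult
import Algebra.Properties.Semiring.Sum as SemiringSum
open import Data.Bool.Base using (if_then_else_)
open import Data.Empty using (⊥-elim)
open import Data.Fin.Base using (Fin; zero; suc; toℕ; punchIn)
open import Data.Integer.Base using (ℤ; +_; -[1+_])
open import Data.List.Base using (List; []; _∷_; _++_; map; foldr; concat; length; allFin; deduplicate)
import Data.List.Extrema as Extrema
open import Data.List.Relation.Binary.BagAndSetEquality using (_∼[_]_; set)
open import Data.List.Relation.Binary.Subset.Propositional using (_⊆_)
open import Data.Nat.Base as ℕ using (ℕ; zero; suc)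
open import Data.Product.Base using (∃; ∃-syntax; _×_; _,_; proj₁)
open import Data.Rational.Unnormalised.Base using (ℚᵘ; ↥_; ↧ₙ_)
open import Data.Sum.Base using (_⊎_; inj₁; inj₂)
open import Data.Vec.Base as Vec using (Vec; []; _∷_)
open import Data.Vec.Properties using (≡-dec)
open import Level using (0ℓ)
open import Relation.Binary.Bundles using (DecTotalOrder)
open import Relation.Binary.Definitions using (DecidableEquality)
open import Relation.Binary.PropositionalEquality.Core using (_≡_; _≢_; refl; sym; trans; subst; subst₂)
open import Relation.Binary.Structures using (IsDecTotalOrder)
open import Relation.Nullary.Decidable.Core using (Dec; yes; no; does)

-- The library has no real numbers, so ℝ is taken axiomatically, as a
-- Dedekind-complete ordered field; such a field is unique up to isomorphism.
--
-- IsSup is the ε-form of the supremum, classically equivalent to "least upper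
-- bound".  With it the axioms imply excluded middle for Set (em below), so
-- reasoning about ℝ is classical.
record Reals : Set₁ where
  infix  8 _⁻¹
  infixl 7 _*_ _/_
  infixl 6 _+_ _-_
  infix  4 _≤_ _<_
  field
    ℝ       : Set
    _+_ _*_ : ℝ → ℝ → ℝ
    -_      : ℝ → ℝ
    0# 1#   : ℝ
    _≤_     : ℝ → ℝ → Set
    isCommutativeRing : IsCommutativeRing _≡_ _+_ _*_ -_ 0# 1#
    0≢1     : 0# ≢ 1#
    inverse : ∀ x → x ≢ 0# → ∃[ y ] x * y ≡ 1#
    isDecTotalOrder : IsDecTotalOrder _≡_ _≤_
    +-monoˡ-≤ : ∀ z {x y} → x ≤ y → x + z ≤ y + z
    *-nonNeg  : ∀ {x y} → 0# ≤ x → 0# ≤ y → 0# ≤ x * y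

  _<_ : ℝ → ℝ → Set
  x < y = x ≤ y × x ≢ y

  IsUpperBound : (ℝ → Set) → ℝ → Set
  IsUpperBound P b = ∀ x → P x → x ≤ b

  IsSup : (ℝ → Set) → ℝ → Set
  IsSup P s = IsUpperBound P s × (∀ y → y < s → ∃[ x ] P x × y < x)

  field
    complete : ∀ P → ∃ P → ∃ (IsUpperBound P) → ∃ (IsSup P)

  commutativeRing : CommutativeRing 0ℓ 0ℓ
  commutativeRing = record { isCommutativeRing = isCommutativeRing }

  decTotalOrder : DecTotalOrder 0ℓ 0ℓ 0ℓ
  decTotalOrder = record { isDecTotalOrder = isDecTotalOrder }

  open CommutativeRing commutativeRing public using (ring; semiring)
  open IsDecTotalOrder isDecTotalOrder public using (_≟_; _≤?_)

  open SemiringExp semiring public using (_^_)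
  open SemiringMult semiring public using () renaming (_×_ to _·_)
  open SemiringSum semiring public using (sum)

  _-_ : ℝ → ℝ → ℝ
  x - y = x + (- y)

  -- 0# ⁻¹ is the junk value 0#.
  _⁻¹ : ℝ → ℝ
  x ⁻¹ with x ≟ 0#
  ... | yes _   = 0#
  ... | no x≢0  = proj₁ (inverse x x≢0)

  _/_ : ℝ → ℝ → ℝ
  x / y = x * y ⁻¹

  fromℕ : ℕ → ℝ
  fromℕ n = n · 1#

  fromℤ : ℤ → ℝ
  fromℤ (+ n)    = fromℕ n
  fromℤ -[1+ n ] = - fromℕ (suc n)

  fromℚ : ℚᵘ → ℝ
  fromℚ q = fromℤ (↥ q) / fromℕ (↧ₙ q)

  0≤1 : 0# ≤ 1#
  0≤1 with IsDecTotalOrder.total isDecTotalOrder 0# 1#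
  ... | inj₁ 0≤1 = 0≤1
  ... | inj₂ 1≤0 = subst (0# ≤_) -1*-1≡1 (*-nonNeg 0≤-1 0≤-1)
    where
    open CommutativeRing commutativeRing using (-‿inverseʳ; +-identityˡ)
    open RingProperties ring using (-1*x≈-x; -‿involutive)
    0≤-1 : 0# ≤ - 1#
    0≤-1 = subst₂ _≤_ (-‿inverseʳ 1#) (+-identityˡ (- 1#)) (+-monoˡ-≤ (- 1#) 1≤0)
    -1*-1≡1 : (- 1#) * (- 1#) ≡ 1#
    -1*-1≡1 = trans (-1*x≈-x (- 1#)) (-‿involutive 1#)

  em : (A : Set) → Dec A
  em A with complete P (0# , inj₁ refl) (1# , P≤1)
    where
    P : ℝ → Set
    P x = (x ≡ 0#) ⊎ (x ≡ 1# × A)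
    P≤1 : IsUpperBound P 1#
    P≤1 x (inj₁ refl)       = 0≤1
    P≤1 x (inj₂ (refl , _)) = IsDecTotalOrder.refl isDecTotalOrder
  ... | s , ub , approx with 1# ≤? s
  ...   | no 1≰s  = no (λ a → 1≰s (ub 1# (inj₂ (refl , a))))
  ...   | yes 1≤s with approx 0# (IsDecTotalOrder.trans isDecTotalOrder 0≤1 1≤s , 0≢s)
    where
    0≢s : 0# ≢ s
    0≢s 0≡s = 0≢1 (IsDecTotalOrder.antisym isDecTotalOrder 0≤1 (subst (1# ≤_) (sym 0≡s) 1≤s))
  ...     | x , inj₁ x≡0 , _ , 0≢x = ⊥-elim (0≢x (sym x≡0))
  ...     | x , inj₂ (_ , a) , _   = yes a

  -- Junk value 0# for predicates that are empty or unbounded above.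
  sup : (ℝ → Set) → ℝ
  sup P with em (∃ P × ∃ (IsUpperBound P))
  ... | yes (inhabited , bounded) = proj₁ (complete P inhabited bounded)
  ... | no _                      = 0#

  root : ℕ → ℝ → ℝ
  root n x = sup (λ z → 0# ≤ z × z ^ n ≤ x)

  _^ℤ_ : ℝ → ℤ → ℝ
  x ^ℤ (+ n)    = x ^ n
  x ^ℤ -[1+ n ] = (x ^ suc n) ⁻¹

  _^ℚ_ : ℝ → ℚᵘ → ℝ
  x ^ℚ q = root (↧ₙ q) (x ^ℤ (↥ q))

  -- Real powers of a base b > 0: for b ≥ 1 the supremum of the rational powers
  -- with exponent at most y, and b ^ y = 1 / (1/b) ^ y for b < 1.  The values for
  -- b ≤ 0 are junk.
  infixr 8 _^ʳ_
  _^ʳ_ : ℝ → ℝ → ℝ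
  b ^ʳ y = if does (1# ≤? b) then power b else (power (b ⁻¹)) ⁻¹
    where
    power : ℝ → ℝ
    power a = sup (λ z → ∃[ q ] fromℚ q ≤ y × z ≡ a ^ℚ q)

  TendsToZero : (ℕ → ℝ) → Set
  TendsToZero u = ∀ ε → 0# < ε → ∃[ N ] (∀ n → N ℕ.≤ n → - ε < u n × u n < ε)

choose : {A : Set} (k : ℕ) → List A → List (Vec A k)
choose zero    xs       = [] ∷ []
choose (suc k) []       = []
choose (suc k) (x ∷ xs) = map (x ∷_) (choose k xs) ++ choose (suc k) xs

module DeterminantMaximization (R : Reals) where
  open Reals R

  Matrix : ℕ → Set
  Matrix n = Fin n → Fin n → ℝ

  det : ∀ {n} → Matrix n → ℝ
  det {zero}  A = 1#
  det {suc n} A =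
    sum (λ j → (- 1#) ^ toℕ j * A zero j * det (λ a b → A (suc a) (punchIn j b)))

  sumList : List ℝ → ℝ
  sumList = foldr _+_ 0#

  -- The subsets S of [d] are listed as increasing index vectors.
  detₖ : ∀ {d} → ℕ → Matrix d → ℝ
  detₖ {d} k A =
    sumList (map (λ S → det (λ a b → A (Vec.lookup S a) (Vec.lookup S b))) (choose k (allFin d)))

  Point : ℕ → Set
  Point d = Vec ℝ d

  -- A list stands for the finite set of its members: order and repetitions are
  -- to be disregarded.
  FinSet : ℕ → Set
  FinSet d = List (Point d)

  _≟ₚ_ : ∀ {d} → DecidableEquality (Point d)
  _≟ₚ_ = ≡-dec _≟_

  distinct : ∀ {d} → FinSet d → FinSet d
  distinct = deduplicate _≟ₚ_

  card : ∀ {d} → FinSet d → ℕ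
  card V = length (distinct V)

  sumOuter : ∀ {d k} → Vec (Point d) k → Matrix d
  sumOuter S i j = sum (λ a → Vec.lookup (Vec.lookup S a) i * Vec.lookup (Vec.lookup S a) j)

  maximum : List ℝ → ℝ
  maximum []       = 0#
  maximum (x ∷ xs) = Extrema.max (DecTotalOrder.totalOrder decTotalOrder) x xs

  -- choose k (distinct V) is empty exactly when V has fewer than k elements.
  objective : ∀ {d} → ℕ → FinSet d → ℝ
  objective k V = maximum (map (λ S → detₖ k (sumOuter S)) (choose k (distinct V)))

  record IsComposableCoreSet {d : ℕ} (k : ℕ) (α : ℝ) (t : ℕ) (c : FinSet d → FinSet d) : Set where
    field
      -- c is a function of sets, not of the lists representing them.
      respects    : ∀ {V W} → V ∼[ set ] W → c V ∼[ set ] c W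
      subset      : ∀ V → c V ⊆ V
      size        : ∀ V → card (c V) ℕ.≤ t
      α-positive  : 0# < α
      approximate : ∀ (Vs : List (FinSet d)) →
        (1# / α) * objective k (concat Vs) ≤ objective k (concat (map c Vs))

-- Let q = 2n, and let a code of t + 1 words of length n over q letters have pairwise
-- agreements less than a; encoded as 0/1-vectors of length s = nq they have inner products
-- less than a, while each has square length n.  Put m = k − s.  Party j < m holds, at scale
-- M^j with M huge, the vectors (x, z) in ℝ^m × ℝ^s where z encodes a word and
-- x_l = − ⟨v_l, z⟩ for l < j, x_l = 0 for l ≥ j; here v_l is a word that the core-set
-- dropped from party l.  The other s parties span, at still larger scales, the common kernel
-- of the functionals y_l = x_l + ⟨v_l, z⟩.  In the coordinates (y, z) every vector of party j
-- vanishes in the rows before j and has entry M^j ⟨v_j, z⟩ in row j.  Hence, up to lower powers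
-- of M, a determinant needs exactly one column per party, used in its own row, and is
-- M^(0 + 1 + ⋯ + (k−1)) times the product of these inner products: n^m if all dropped words are
-- available, but at most (a − 1)^m on the core-sets.  So α ≥ (n / a)^(2m); for a of order log k
-- and n = √k / polylog k this is k^(k (1 − o(1))).
module Submission where

open import Algebra.Bundles using (CommutativeRing; Monoid; Semiring)
import Algebra.Properties.CommutativeSemiring.Exp as CommutativeSemiringExp
import Algebra.Properties.Monoid.Sum as MonoidSum
import Algebra.Properties.Ring as RingProperties
import Algebra.Properties.Semiring.Exp as SemiringExp
import Algebra.Properties.Semiring.Mult as SemiringMult
import Algebra.Properties.Semiring.Sum as SemiringSum
open import Data.Bool.Base using (if_then_else_)
open import Data.Empty using (⊥-elim)
open import Data.Fin.Base using (Fin; zero; suc; toℕ; _↑ˡ_; _↑ʳ_; splitAt; punchIn; punchOut)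
open import Data.Fin.Properties using (any?; punchIn-injective; punchIn-punchOut; punchInᵢ≢i; toℕ-injective; toℕ-↑ˡ; toℕ-↑ʳ; toℕ<n)
  renaming (_≟_ to _≟ᶠ_)
import Data.Integer.Base as ℤ
open import Data.List.Base as List using (List; []; _∷_; _++_; map; length; allFin; concat)
import Data.List.Extrema as Extrema
open import Data.List.Membership.Propositional using (_∈_; _∉_)
open import Data.List.Membership.Propositional.Properties using
  (∈-∃++; ∈-map⁺; ∈-map⁻; ∈-++⁺ˡ; ∈-++⁺ʳ; ∈-++⁻; ∈-concat⁺′; ∈-concat⁻′; ∈-deduplicate⁺; ∈-deduplicate⁻; ∈-tabulate⁺; ∈-tabulate⁻)
import Data.List.Membership.DecPropositional as DecMembership
open import Data.List.Properties using (length-map; length-tabulate; map-cong; map-++; map-∘; ++-identityʳ)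
open import Data.List.Relation.Binary.Permutation.Propositional using (_↭_; ↭-refl; ↭-sym; ↭-trans; prep; ↭⇒↭ₛ)
import Data.List.Relation.Binary.Permutation.Propositional.Properties as ↭
import Data.List.Relation.Binary.Permutation.Setoid.Properties as ↭ₛ
open import Data.List.Relation.Binary.Subset.Propositional using (_⊆_)
open import Data.List.Relation.Unary.All as All using ([]; _∷_)
open import Data.List.Relation.Unary.AllPairs as AllPairs using ([]; _∷_)
open import Data.List.Relation.Unary.Any using (here; there)
open import Data.List.Relation.Unary.Unique.DecPropositional.Properties using (deduplicate-!)
open import Data.List.Relation.Unary.Unique.Propositional using (Unique)
open import Data.List.Relation.Unary.Unique.Propositional.Properties using (Unique[x∷xs]⇒x∉xs; tabulate⁺)
open import Data.Nat.Base as ℕ using (ℕ; zero; suc; z≤n; s≤s)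
open import Data.Nat.DivMod using (m≡m%n+[m/n]*n; m%n<n; m/n*n≤m)
import Data.Nat.Properties as ℕ
open import Data.Nat.Tactic.RingSolver using (solve-∀)
open import Data.Product.Base using (∃; ∃-syntax; _×_; _,_; proj₁; proj₂)
open import Data.Rational.Unnormalised.Base using (mkℚᵘ)
open import Data.Sum.Base using (_⊎_; inj₁; inj₂)
open import Data.Vec.Base as Vec using (Vec; []; _∷_; toList; lookup)
open import Data.Vec.Functional using (tail) renaming (_∷_ to _◂_; _++_ to _⊕_)
open import Data.Vec.Functional.Properties using (lookup-++ˡ; lookup-++ʳ)
open import Data.Vec.Properties using (lookup∘tabulate; length-toList; tabulate-cong)
open import Defs
open import Function.Base using (_∘_; id)
open import Relation.Binary.Bundles using (DecTotalOrder)
open import Relation.Binary.Definitions using (DecidableEquality; tri<; tri≈; tri>)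
import Relation.Binary.Properties.DecTotalOrder as DecTotalOrderProperties
open import Relation.Binary.PropositionalEquality
import Relation.Binary.Reasoning.PartialOrder as PartialOrderReasoning
open import Relation.Nullary using (Dec; yes; no; contradiction; does; ¬_)
open import Relation.Nullary.Decidable using (¬?; _×-dec_; dec-true; dec-false)

-- The points of party j must be fixed before it is known which words the core-set will drop from
-- later parties. Hence x_l = 0 for l ≥ j: party j refers only to v_l with l < j, and v_j is
-- whatever the core-set then drops from it (t + 1 distinct points cannot all survive), so no
-- circularity arises. The coordinates (y, z) refer to all v_l, but belong to the analysis alone. In
-- them all entries are natural numbers, and the change of coordinates is unit triangular, so signs
-- appear only in the Laplace expansion. The scale M is k! n^k, a bound on the whole expansion with
-- its powers of M removed. All lower-order terms together therefore add at most 1 to (a - 1)^m, and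
-- (a - 1)^m + 1 ≤ a^m. The objective is a squared determinant, whence the exponent 2m. Real
-- logarithms are avoided: β gives way to a natural number b ≥ β, n/a is an exact power of 2, and k
-- ≤ 2^(log k) for an integer log k. The outcome is k^exponent ≤ α^(log k), so 1 - δ(k) is a
-- quotient of natural numbers. This bounds α by a power of k; the base k/β ≤ k only weakens it.

module ℕΣ = SemiringSum ℕ.+-*-semiring

-- Selections of k elements from a list

module _ {A : Set} where

  ∈-choose : ∀ k {S : Vec A k} xs → S ∈ choose k xs → toList S ⊆ xs
  ∈-choose zero    xs       (here refl) ()
  ∈-choose (suc k) (x ∷ xs) S∈ y∈ with ∈-++⁻ (map (x ∷_) (choose k xs)) S∈
  ... | inj₂ S∈ʳ = there (∈-choose (suc k) xs S∈ʳ y∈)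
  ... | inj₁ S∈ˡ with _ , S′∈ , refl ← ∈-map⁻ (x ∷_) S∈ˡ with y∈
  ...   | here refl = here refl
  ...   | there y∈′ = there (∈-choose k xs S′∈ y∈′)

  choose-unique : ∀ k {S : Vec A k} {xs} → Unique xs → S ∈ choose k xs → Unique (toList S)
  choose-unique zero    _ (here refl) = []
  choose-unique (suc k) {xs = x ∷ xs} (x∉ ∷ uxs) S∈ with ∈-++⁻ (map (x ∷_) (choose k xs)) S∈
  ... | inj₂ S∈ʳ = choose-unique (suc k) uxs S∈ʳ
  ... | inj₁ S∈ˡ with _ , S′∈ , refl ← ∈-map⁻ (x ∷_) S∈ˡ =
    All.tabulate (All.lookup x∉ ∘ ∈-choose k xs S′∈) ∷ choose-unique k uxs S′∈

  Unique-resp-↭ : {xs ys : List A} → xs ↭ ys → Unique xs → Unique ys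
  Unique-resp-↭ = ↭ₛ.Unique-resp-↭ (setoid A) ∘ ↭⇒↭ₛ

  ∈⇒↭∷ : ∀ {x : A} {xs} → x ∈ xs → ∃[ ys ] xs ↭ x ∷ ys
  ∈⇒↭∷ x∈ with ys , zs , refl ← ∈-∃++ x∈ = ys ++ zs , ↭.shift _ ys zs

  ⊆-tail : ∀ {y : A} {ys zs} → Unique (y ∷ ys) → y ∷ ys ⊆ y ∷ zs → ys ⊆ zs
  ⊆-tail uys ys⊆ x∈ with ys⊆ (there x∈)
  ... | here refl = contradiction x∈ (Unique[x∷xs]⇒x∉xs uys)
  ... | there x∈zs = x∈zs

  ⊆-drop : ∀ {z : A} {ys zs} → z ∉ ys → ys ⊆ z ∷ zs → ys ⊆ zs
  ⊆-drop z∉ ys⊆ x∈ with ys⊆ x∈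
  ... | here refl = contradiction x∈ z∉
  ... | there x∈zs = x∈zs

module _ {A : Set} (_≟_ : DecidableEquality A) where

  open DecMembership _≟_ using (_∈?_)

  -- `choose` lists a subset only in the order of the ambient list, so a given selection is
  -- recovered up to permutation; `sumOuter` does not see the difference.
  choose-complete : ∀ k {ys : List A} zs → length ys ≡ k → Unique ys → ys ⊆ zs →
                    ∃[ S ] S ∈ choose k zs × toList S ↭ ys
  choose-complete zero    {[]} zs _ _ _ = [] , here refl , ↭-refl
  choose-complete (suc k) {y ∷ ys} [] _ _ ys⊆ with () ← ys⊆ (here refl)
  choose-complete (suc k) {ys} (z ∷ zs) len uys ys⊆ with z ∈? ys
  ... | no z∉
    with S , S∈ , S↭ ← choose-complete (suc k) zs len uys (⊆-drop z∉ ys⊆)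
    = S , ∈-++⁺ʳ (map (z ∷_) (choose k zs)) S∈ , S↭
  ... | yes z∈
    with ys′ , ys↭ ← ∈⇒↭∷ z∈
    with S , S∈ , S↭ ← choose-complete k zs
           (ℕ.suc-injective (trans (sym (↭.↭-length ys↭)) len))
           (AllPairs.tail (Unique-resp-↭ ys↭ uys))
           (⊆-tail (Unique-resp-↭ ys↭ uys) (ys⊆ ∘ ↭.∈-resp-↭ (↭-sym ys↭)))
    = z ∷ S , ∈-++⁺ˡ (∈-map⁺ (z ∷_) S∈) , ↭-trans (prep z S↭) (↭-sym ys↭)

  unique-⊆⇒length≤ : ∀ {xs : List A} ys → Unique xs → xs ⊆ ys → length xs ℕ.≤ length ys
  unique-⊆⇒length≤ {[]}     ys _          _   = z≤n
  unique-⊆⇒length≤ {x ∷ xs} ys u@(_ ∷ uxs) xs⊆ with ys′ , ys↭ ← ∈⇒↭∷ (xs⊆ (here refl)) =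
    subst (suc (length xs) ℕ.≤_) (sym (↭.↭-length ys↭))
      (s≤s (unique-⊆⇒length≤ ys′ uxs (⊆-tail u (↭.∈-resp-↭ ys↭ ∘ xs⊆))))

lookup∈ : ∀ {A : Set} {k} (S : Vec A k) i → lookup S i ∈ toList S
lookup∈ (x ∷ S) zero    = here refl
lookup∈ (x ∷ S) (suc i) = there (lookup∈ S i)

-- Pigeonhole: fewer than k elements of `xs` cannot fill k places. It shows that index sets other
-- than the first k coordinates reach into the padding.
choose-meets : ∀ {A : Set} k {T : Vec A k} xs {ys} → length xs ℕ.< k → T ∈ choose k (xs ++ ys) →
               ∃[ i ] lookup T i ∈ ys
choose-meets (suc k) {T} [] {ys} _ T∈ = zero , ∈-choose (suc k) ys T∈ (lookup∈ T zero)
choose-meets (suc k) (x ∷ xs) {ys} (s≤s lt) T∈ with ∈-++⁻ (map (x ∷_) (choose k (xs ++ ys))) T∈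
... | inj₂ T∈ʳ = choose-meets (suc k) xs (ℕ.m<n⇒m<1+n lt) T∈ʳ
... | inj₁ T∈ˡ with _ , T′∈ , refl ← ∈-map⁻ (x ∷_) T∈ˡ with i , p ← choose-meets k xs lt T′∈ = suc i , p

tabulate-++ : ∀ {A : Set} k {e} (f : Fin (k ℕ.+ e) → A) →
              List.tabulate f ≡ List.tabulate (f ∘ (_↑ˡ e)) ++ List.tabulate (f ∘ (k ↑ʳ_))
tabulate-++ zero    f = refl
tabulate-++ (suc k) f = cong (f zero ∷_) (tabulate-++ k (f ∘ suc))

unique-map : ∀ {A B : Set} {f : A → B} {xs} → (∀ {x y} → x ∈ xs → y ∈ xs → f x ≡ f y → x ≡ y) →
             Unique xs → Unique (map f xs)
unique-map inj []         = []
unique-map {f = f} {x ∷ xs} inj (x∉ ∷ uxs) = All.tabulate fresh ∷ unique-map (λ p q → inj (there p) (there q)) uxs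
  where
  fresh : ∀ {y} → y ∈ map f xs → f x ≢ y
  fresh y∈ with z , z∈ , refl ← ∈-map⁻ f y∈ = All.lookup x∉ z∈ ∘ inj (here refl) (there z∈)

toList-tabulate : ∀ {A : Set} {k} (f : Fin k → A) → toList (Vec.tabulate f) ≡ List.tabulate f
toList-tabulate {k = zero}  f = refl
toList-tabulate {k = suc k} f = cong (f zero ∷_) (toList-tabulate (f ∘ suc))

-- Index blocks, adaptive choices and products over ranges

data Split (m : ℕ) {s : ℕ} : Fin (m ℕ.+ s) → Set where
  left  : ∀ l → Split m (l ↑ˡ s)
  right : ∀ r → Split m (m ↑ʳ r)

split : ∀ m {s} (i : Fin (m ℕ.+ s)) → Split m i
split zero    i       = right i
split (suc m) zero    = left zero
split (suc m) (suc i) with split m i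
... | left l  = left (suc l)
... | right r = right r

select : ∀ {A : Set} → ℕ → ℕ → A → A → A
select l j x y = if does (l ℕ.<? j) then x else y

select-< : ∀ {A : Set} {l j} {x y : A} → l ℕ.< j → select l j x y ≡ x
select-< {l = l} {j} {x} {y} l<j = cong (λ b → if b then x else y) (dec-true (l ℕ.<? j) l<j)

select-≥ : ∀ {A : Set} {l j} {x y : A} → j ℕ.≤ l → select l j x y ≡ y
select-≥ {l = l} {j} {x} {y} j≤l = cong (λ b → if b then x else y) (dec-false (l ℕ.<? j) (ℕ.≤⇒≯ j≤l))

-- Requirement j looks only at the values before j, so a value appended at m disturbs neither the
-- stages below m nor stage m itself, for which it was found.
adaptive-choice : ∀ {W : Set} (Φ : (ℕ → W) → ℕ → W → Set) →
  (∀ {v v′ j w} → (∀ l → l ℕ.< j → v l ≡ v′ l) → Φ v j w → Φ v′ j w) →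
  (∀ v j → ∃ (Φ v j)) → W → ∀ m → ∃[ v ] (∀ j → j ℕ.< m → Φ v j (v j))
adaptive-choice Φ local step w₀ zero = (λ _ → w₀) , λ _ ()
adaptive-choice {W} Φ local step w₀ (suc m)
  with v , Φv ← adaptive-choice Φ local step w₀ m
  with w , Φw ← step v m
  = v′ , Φv′
  where
  v′ : ℕ → W
  v′ l = select l m (v l) w
  agree : ∀ {j} → j ℕ.≤ m → ∀ l → l ℕ.< j → v l ≡ v′ l
  agree j≤m l l<j = sym (select-< (ℕ.<-≤-trans l<j j≤m))
  Φv′ : ∀ j → j ℕ.< suc m → Φ v′ j (v′ j)
  Φv′ j (s≤s j≤m) with j ℕ.<? m
  ... | yes j<m = subst (Φ v′ j) (sym (select-< j<m)) (local (agree j≤m) (Φv j j<m))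
  ... | no j≮m with refl ← ℕ.≤-antisym j≤m (ℕ.≮⇒≥ j≮m) =
    subst (Φ v′ m) (sym (select-≥ {l = m} ℕ.≤-refl)) (local (agree ℕ.≤-refl) Φw)

-- The range l ≤ j < l + r carries its start as a parameter because deleting the first row in a
-- Laplace expansion shifts it.
∏ℕ : (ℕ → ℕ) → ℕ → ℕ → ℕ
∏ℕ f l zero    = 1
∏ℕ f l (suc r) = f l ℕ.* ∏ℕ f (suc l) r

∏ℕ-* : ∀ (f g : ℕ → ℕ) l r → ∏ℕ (λ j → f j ℕ.* g j) l r ≡ ∏ℕ f l r ℕ.* ∏ℕ g l r
∏ℕ-* f g l zero    = refl
∏ℕ-* f g l (suc r) = trans (cong (f l ℕ.* g l ℕ.*_) (∏ℕ-* f g (suc l) r)) (ℕ.[m*n]*[o*p]≡[m*o]*[n*p] (f l) (g l) _ _)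

∏ℕ-select : ∀ m b l s → ∏ℕ (λ j → select j (l ℕ.+ m) b 1) l (m ℕ.+ s) ≡ b ℕ.^ m
∏ℕ-select (suc m) b l s = cong₂ ℕ._*_ (select-< (ℕ.m<m+n l (s≤s z≤n)))
  (trans (cong (λ t → ∏ℕ (λ j → select j t b 1) (suc l) (m ℕ.+ s)) (ℕ.+-suc l m)) (∏ℕ-select m b (suc l) s))
∏ℕ-select zero b l s = ones l s (ℕ.≤-reflexive (ℕ.+-identityʳ l))
  where
  ones : ∀ i r → l ℕ.+ 0 ℕ.≤ i → ∏ℕ (λ j → select j (l ℕ.+ 0) b 1) i r ≡ 1
  ones i zero    _  = refl
  ones i (suc r) le = cong₂ ℕ._*_ (select-≥ {l = i} le) (ones (suc i) r (ℕ.m≤n⇒m≤1+n le))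

-- The unit on the left stands for the lower-order terms of a determinant; absorbing it turns a - 1
-- into a in the final bound.
1+[a-1]^m≤a^m : ∀ {a m} → 1 ℕ.≤ a → 1 ℕ.≤ m → suc ((a ℕ.∸ 1) ℕ.^ m) ℕ.≤ a ℕ.^ m
1+[a-1]^m≤a^m {suc a} {suc m} _ _ = ℕ.+-mono-≤ (ℕ.m^n>0 (suc a) m) (ℕ.*-monoʳ-≤ a (ℕ.^-monoˡ-≤ m (ℕ.n≤1+n a)))

-- r! n^r, the Leibniz bound for a determinant of size r with entries at most n.
crudeBound : ℕ → ℕ → ℕ
crudeBound n zero    = 1
crudeBound n (suc r) = suc r ℕ.* (n ℕ.* crudeBound n r)

module _ {c ℓ} (S : Monoid c ℓ) where
  open Monoid S renaming (trans to ≈-trans; sym to ≈-sym)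
  open MonoidSum S using () renaming (sum to ∑)

  sum-↑ : ∀ m {n} (f : Fin (m ℕ.+ n) → Carrier) → ∑ f ≈ ∑ (f ∘ (_↑ˡ n)) ∙ ∑ (f ∘ (m ↑ʳ_))
  sum-↑ zero    f = ≈-sym (identityˡ _)
  sum-↑ (suc m) f = ≈-trans (∙-congˡ (sum-↑ m (f ∘ suc))) (≈-sym (assoc _ _ _))

sumℕ-↑ : ∀ m {n} (f : Fin (m ℕ.+ n) → ℕ) → ℕΣ.sum f ≡ ℕΣ.sum (f ∘ (_↑ˡ n)) ℕ.+ ℕΣ.sum (f ∘ (m ↑ʳ_))
sumℕ-↑ = sum-↑ ℕ.+-0-monoid

-- Words and codes with small pairwise agreement

module Words where

  open import Data.Nat.Base
  open import Data.Nat.ListAction using (sum)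
  open import Data.Nat.Properties

  -- The Kronecker delta, by recursion so that sums over `Fin` unfold along with it.
  κ : ∀ {q} → Fin q → Fin q → ℕ
  κ zero    zero    = 1
  κ zero    (suc _) = 0
  κ (suc _) zero    = 0
  κ (suc i) (suc j) = κ i j

  κ-refl : ∀ {q} (i : Fin q) → κ i i ≡ 1
  κ-refl zero    = refl
  κ-refl (suc i) = κ-refl i

  κ-≢ : ∀ {q} {i j : Fin q} → i ≢ j → κ i j ≡ 0
  κ-≢ {i = zero}  {zero}  i≢j = contradiction refl i≢j
  κ-≢ {i = zero}  {suc _} _   = refl
  κ-≢ {i = suc _} {zero}  _   = refl
  κ-≢ {i = suc i} {suc j} i≢j = κ-≢ (i≢j ∘ cong suc)

  κ≤1 : ∀ {q} (i j : Fin q) → κ i j ≤ 1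
  κ≤1 zero    zero    = ≤-refl
  κ≤1 zero    (suc _) = z≤n
  κ≤1 (suc _) zero    = z≤n
  κ≤1 (suc i) (suc j) = κ≤1 i j

  κ-sym : ∀ {q} (i j : Fin q) → κ i j ≡ κ j i
  κ-sym zero    zero    = refl
  κ-sym zero    (suc _) = refl
  κ-sym (suc _) zero    = refl
  κ-sym (suc i) (suc j) = κ-sym i j

  Word : ℕ → ℕ → Set
  Word q n = Vec (Fin q) n

  agreement : ∀ {q n} → Word q n → Word q n → ℕ
  agreement []      []      = 0
  agreement (x ∷ v) (y ∷ w) = κ x y + agreement v w

  agreement-refl : ∀ {q n} (w : Word q n) → agreement w w ≡ n
  agreement-refl []      = refl
  agreement-refl (x ∷ w) = cong₂ _+_ (κ-refl x) (agreement-refl w)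

  agreement-sym : ∀ {q n} (v w : Word q n) → agreement v w ≡ agreement w v
  agreement-sym []      []      = refl
  agreement-sym (x ∷ v) (y ∷ w) = cong₂ _+_ (κ-sym x y) (agreement-sym v w)

  agreement≤n : ∀ {q n} (v w : Word q n) → agreement v w ≤ n
  agreement≤n []      []      = z≤n
  agreement≤n (x ∷ v) (y ∷ w) = +-mono-≤ (κ≤1 x y) (agreement≤n v w)

  ∑words : ∀ {q} n → (Word q n → ℕ) → ℕ
  ∑words zero    f = f []
  ∑words (suc n) f = ℕΣ.sum (λ x → ∑words n (f ∘ (x ∷_)))

  ∑words-cong : ∀ {q} n {f g : Word q n → ℕ} → (∀ w → f w ≡ g w) → ∑words n f ≡ ∑words n g
  ∑words-cong zero    f≗g = f≗g []
  ∑words-cong (suc n) f≗g = ℕΣ.sum-cong-≗ (λ x → ∑words-cong n (f≗g ∘ (x ∷_)))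

  ∑words-* : ∀ {q} n c (f : Word q n → ℕ) → ∑words n (λ w → c * f w) ≡ c * ∑words n f
  ∑words-* zero    c f = refl
  ∑words-* (suc n) c f = trans
    (ℕΣ.sum-cong-≗ (λ x → ∑words-* n c (f ∘ (x ∷_))))
    (sym (ℕΣ.*-distribˡ-sum c (λ x → ∑words n (f ∘ (x ∷_)))))

  ∑words-+ : ∀ {q} n (f g : Word q n → ℕ) → ∑words n (λ w → f w + g w) ≡ ∑words n f + ∑words n g
  ∑words-+ zero    f g = refl
  ∑words-+ (suc n) f g = trans
    (ℕΣ.sum-cong-≗ (λ x → ∑words-+ n (f ∘ (x ∷_)) (g ∘ (x ∷_))))
    (ℕΣ.∑-distrib-+ (λ x → ∑words n (f ∘ (x ∷_))) (λ x → ∑words n (g ∘ (x ∷_))))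

  ∑-const : ∀ q c → ℕΣ.sum {q} (λ _ → c) ≡ q * c
  ∑-const zero    c = refl
  ∑-const (suc q) c = cong (c +_) (∑-const q c)

  ∑-2^κ : ∀ {q} (y : Fin q) → ℕΣ.sum (λ x → 2 ^ κ x y) ≡ suc q
  ∑-2^κ {suc q} zero    = cong (2 +_) (trans (∑-const q 1) (*-identityʳ q))
  ∑-2^κ {suc q} (suc y) = cong suc (∑-2^κ y)

  -- The exponential moment factorises over the positions: in each, the letter of `c` has weight 2
  -- and the other q - 1 letters have weight 1.
  ∑-2^agreement : ∀ {q n} (c : Word q n) → ∑words n (λ w → 2 ^ agreement w c) ≡ suc q ^ n
  ∑-2^agreement []              = refl
  ∑-2^agreement {q} {suc n} (y ∷ c) = begin
    ℕΣ.sum (λ x → ∑words n (λ w → 2 ^ (κ x y + agreement w c)))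
      ≡⟨ ℕΣ.sum-cong-≗ (λ x → trans
           (∑words-cong n (λ w → ^-distribˡ-+-* 2 (κ x y) (agreement w c)))
           (∑words-* n (2 ^ κ x y) (λ w → 2 ^ agreement w c))) ⟩
    ℕΣ.sum (λ x → 2 ^ κ x y * ∑words n (λ w → 2 ^ agreement w c))
      ≡⟨ ℕΣ.*-distribʳ-sum (∑words n (λ w → 2 ^ agreement w c)) (λ x → 2 ^ κ x y) ⟨
    ℕΣ.sum (λ x → 2 ^ κ x y) * ∑words n (λ w → 2 ^ agreement w c)
      ≡⟨ cong₂ _*_ (∑-2^κ y) (∑-2^agreement c) ⟩
    suc q * suc q ^ n ∎
    where open ≡-Reasoning

  weight : ∀ {q n} → List (Word q n) → Word q n → ℕ
  weight cs w = sum (map (λ c → 2 ^ agreement w c) cs)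

  ∑-weight : ∀ {q} n (cs : List (Word q n)) → ∑words n (weight cs) ≡ length cs * suc q ^ n
  ∑-weight {q} n []       = trans (∑words-* n 0 (λ _ → 0)) refl
  ∑-weight n (c ∷ cs) = trans (∑words-+ n (λ w → 2 ^ agreement w c) (weight cs))
    (cong₂ _+_ (∑-2^agreement c) (∑-weight n cs))

  ∑<⇒∃< : ∀ {q} {K} (f : Fin q → ℕ) → ℕΣ.sum f < q * K → ∃[ x ] f x < K
  ∑<⇒∃< {suc q} {K} f ∑<  with f zero <? K
  ... | yes f0<K = zero , f0<K
  ... | no  f0≮K with ∑<⇒∃< (f ∘ suc) (+-cancelˡ-< K _ _ (≤-<-trans (+-monoˡ-≤ _ (≮⇒≥ f0≮K)) ∑<))
  ...   | x , fx<K = suc x , fx<K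

  ∑words<⇒∃< : ∀ {q} n {B} (f : Word q n → ℕ) → ∑words n f < q ^ n * B → ∃[ w ] f w < B
  ∑words<⇒∃< zero    {B} f lt = [] , subst (f [] <_) (+-identityʳ B) lt
  ∑words<⇒∃< {q} (suc n) {B} f lt
    with x , ltₓ ← ∑<⇒∃< {K = q ^ n * B} (λ x → ∑words n (f ∘ (x ∷_))) (subst (∑words (suc n) f <_) (*-assoc q (q ^ n) B) lt)
    with w , ltᵥ ← ∑words<⇒∃< n (f ∘ (x ∷_)) ltₓ
    = x ∷ w , ltᵥ

  -- A single codeword with agreement at least a would contribute 2^a on its own.
  weight<2^a : ∀ {q n a} (cs : List (Word q n)) w → weight cs w < 2 ^ a → ∀ {c} → c ∈ cs → agreement w c < a
  weight<2^a {a = a} (c ∷ cs) w lt (here refl) with agreement w c <? a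
  ... | yes p = p
  ... | no ¬p = contradiction (≤-<-trans (≤-trans (^-monoʳ-≤ 2 (≮⇒≥ ¬p)) (m≤m+n _ _)) lt) (<-irrefl refl)
  weight<2^a (c ∷ cs) w lt (there c∈cs) = weight<2^a cs w (≤-<-trans (m≤n+m _ _) lt) c∈cs

  -- Bernoulli's inequality (1 - 1/(q + 1))^n ≥ 1 - n/(q + 1), cleared of denominators.
  bernoulli : ∀ q n → (suc q) * suc q ^ n ≤ suc q * q ^ n + n * suc q ^ n
  bernoulli q zero    = m≤m+n _ _
  bernoulli q (suc n) = begin
    suc q * (suc q * suc q ^ n)
      ≤⟨ *-monoʳ-≤ (suc q) (bernoulli q n) ⟩
    suc q * (suc q * q ^ n + n * suc q ^ n)
      ≡⟨ lemma q (q ^ n) n (suc q ^ n) ⟩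
    suc q * (q * q ^ n) + (suc q * q ^ n + n * (suc q * suc q ^ n))
      ≤⟨ +-monoʳ-≤ (suc q * (q * q ^ n)) (+-monoˡ-≤ _ (*-monoʳ-≤ (suc q) (^-monoˡ-≤ n (n≤1+n q)))) ⟩
    suc q * (q * q ^ n) + (suc q * suc q ^ n + n * (suc q * suc q ^ n)) ∎
    where
    open ≤-Reasoning
    lemma : ∀ q x n y → suc q * (suc q * x + n * y) ≡ suc q * (q * x) + (suc q * x + n * (suc q * y))
    lemma = solve-∀

  -- For q = 2n the deficit n/(q + 1) in Bernoulli's inequality is below 1/2; this is what fixes the
  -- size of the alphabet.
  [1+2n]^n≤2[2n]^n : ∀ n → suc (2 * n) ^ n ≤ 2 * (2 * n) ^ n
  [1+2n]^n≤2[2n]^n n = *-cancelˡ-≤ (suc (2 * n)) (+-cancelʳ-≤ (suc (2 * n) * X) _ _ (begin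
    suc (2 * n) * X + suc (2 * n) * X
      ≤⟨ +-mono-≤ (bernoulli (2 * n) n) (bernoulli (2 * n) n) ⟩
    (suc (2 * n) * Y + n * X) + (suc (2 * n) * Y + n * X)
      ≡⟨ lemma (2 * n) n X Y ⟩
    suc (2 * n) * (2 * Y) + (2 * n) * X
      ≤⟨ +-monoʳ-≤ (suc (2 * n) * (2 * Y)) (*-monoˡ-≤ X (n≤1+n (2 * n))) ⟩
    suc (2 * n) * (2 * Y) + suc (2 * n) * X ∎))
    where
    open ≤-Reasoning
    X = suc (2 * n) ^ n
    Y = (2 * n) ^ n
    lemma : ∀ m n x y → (suc m * y + n * x) + (suc m * y + n * x) ≡ suc m * (2 * y) + (2 * n) * x
    lemma = solve-∀

  record Code (q n a N : ℕ) : Set where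
    field
      words    : List (Word q n)
      size     : length words ≡ N
      unique   : Unique words
      distance : ∀ {v w} → v ∈ words → w ∈ words → v ≡ w ⊎ agreement v w < a

  ∑-weight< : ∀ n a N (cs : List (Word (2 * n) n)) → length cs ≡ N → 1 ≤ n → suc N * 2 ≤ 2 ^ a →
              ∑words n (weight cs) < (2 * n) ^ n * 2 ^ a
  ∑-weight< n a N cs size 1≤n N2≤ = begin-strict
      ∑words n (weight cs)               ≡⟨ ∑-weight n cs ⟩
      length cs * suc (2 * n) ^ n        ≡⟨ cong (_* suc (2 * n) ^ n) size ⟩
      N * suc (2 * n) ^ n                ≤⟨ *-monoʳ-≤ N ([1+2n]^n≤2[2n]^n n) ⟩
      N * (2 * (2 * n) ^ n)              ≡⟨ *-assoc N 2 _ ⟨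
      -- Strictness comes from the room for one more word: 2N < 2(N + 1).
      N * 2 * (2 * n) ^ n                <⟨ *-monoˡ-< ((2 * n) ^ n) {{m^n≢0 (2 * n) n {{m*n≢0 2 n {{_}} {{>-nonZero 1≤n}}}}}} (<-≤-trans (m<n+m (N * 2) {2} (s≤s z≤n)) N2≤) ⟩
      2 ^ a * (2 * n) ^ n                ≡⟨ *-comm (2 ^ a) _ ⟩
      (2 * n) ^ n * 2 ^ a ∎
    where open ≤-Reasoning

  -- Gilbert–Varshamov: the average of 2^agreement(w,c) over all words w is (1 + 1/q)^n ≤ 2.
  greedyCode : ∀ n a N → 1 ≤ n → a ≤ n → N * 2 ≤ 2 ^ a → Code (2 * n) n a N
  greedyCode n a zero    _ _ _ = record { words = [] ; size = refl ; unique = [] ; distance = λ () }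
  greedyCode n a (suc N) 1≤n a≤n N2≤ with greedyCode n a N 1≤n a≤n (≤-trans (m≤n+m _ 2) N2≤)
  ... | record { words = cs ; size = size ; unique = unique ; distance = distance }
    with w , lt ← ∑words<⇒∃< n {2 ^ a} (weight cs) (∑-weight< n a N cs size 1≤n N2≤) = record
    { words    = w ∷ cs
    ; size     = cong suc size
    -- `w` agrees with itself in n ≥ a positions, so it is none of the earlier words.
    ; unique   = All.tabulate (λ {c} c∈cs w≡c → <-irrefl refl (<-≤-trans (subst (_< a) (trans (cong (agreement w) (sym w≡c)) (agreement-refl w)) (near c∈cs)) a≤n)) ∷ unique
    ; distance = λ
      { (here refl) (here refl) → inj₁ refl
      ; (here refl) (there v∈) → inj₂ (near v∈)
      ; {v} (there v∈) (here refl) → inj₂ (subst (_< a) (agreement-sym w v) (near v∈))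
      ; (there v∈) (there w∈) → distance v∈ w∈
      }
    }
    where
    near : ∀ {c} → c ∈ cs → agreement w c < a
    near = weight<2^a cs w lt

open Words

-- Words as 0/1-vectors

encode : ∀ {q n} → Word q n → Fin (n ℕ.* q) → ℕ
encode []      = λ ()
encode (x ∷ w) = κ x ⊕ encode w

∑-κ*κ : ∀ {q} (x y : Fin q) → ℕΣ.sum (λ i → κ x i ℕ.* κ y i) ≡ κ x y
∑-κ*κ {suc q} zero    zero    = cong suc (∑0 q)
  where
  ∑0 : ∀ q → ℕΣ.sum {q} (λ _ → 0) ≡ 0
  ∑0 q = trans (∑-const q 0) (ℕ.*-zeroʳ q)
∑-κ*κ {suc q} zero    (suc y) = trans (∑-const q 0) (ℕ.*-zeroʳ q)
∑-κ*κ {suc q} (suc x) zero    = trans (ℕΣ.sum-cong-≗ (λ i → ℕ.*-zeroʳ (κ x i))) (trans (∑-const q 0) (ℕ.*-zeroʳ q))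
∑-κ*κ {suc q} (suc x) (suc y) = ∑-κ*κ x y

∑-encode : ∀ {q n} (v w : Word q n) → ℕΣ.sum (λ r → encode v r ℕ.* encode w r) ≡ agreement v w
∑-encode []      []      = refl
∑-encode {q} {suc n} (x ∷ v) (y ∷ w) = trans (sumℕ-↑ q (λ r → encode (x ∷ v) r ℕ.* encode (y ∷ w) r))
  (cong₂ ℕ._+_
    (trans (ℕΣ.sum-cong-≗ (λ i → cong₂ ℕ._*_ (lookup-++ˡ (κ x) (encode v) i) (lookup-++ˡ (κ y) (encode w) i))) (∑-κ*κ x y))
    (trans (ℕΣ.sum-cong-≗ (λ i → cong₂ ℕ._*_ (lookup-++ʳ (κ x) (encode v) i) (lookup-++ʳ (κ y) (encode w) i))) (∑-encode v w)))

encode≤1 : ∀ {q n} (w : Word q n) r → encode w r ℕ.≤ 1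
encode≤1 {q} (x ∷ w) r with split q r
... | left i  = subst (ℕ._≤ 1) (sym (lookup-++ˡ (κ x) (encode w) i)) (κ≤1 x i)
... | right i = subst (ℕ._≤ 1) (sym (lookup-++ʳ (κ x) (encode w) i)) (encode≤1 w i)

-- Integer logarithms and the choice of parameters

module Growth where

  open import Data.Nat.Base
  open import Data.Nat.Properties

  1≤2^ : ∀ n → 1 ≤ 2 ^ n
  1≤2^ n = m^n>0 2 n

  n<2^n : ∀ n → n < 2 ^ n
  n<2^n zero    = s≤s z≤n
  n<2^n (suc n) = ≤-trans (+-mono-≤ (1≤2^ n) (n<2^n n)) (≤-reflexive (cong (2 ^ n +_) (sym (+-identityʳ (2 ^ n)))))

  n²≤2*2^n : ∀ n → n * n ≤ 2 * 2 ^ n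
  n²≤2*2^n zero    = z≤n
  n²≤2*2^n (suc n) = begin
    suc n * suc n                ≡⟨ lemma n ⟩
    n * n + (suc n + n)          ≤⟨ +-mono-≤ (n²≤2*2^n n) (+-mono-≤ (n<2^n n) (<⇒≤ (n<2^n n))) ⟩
    2 * 2 ^ n + (2 ^ n + 2 ^ n)  ≡⟨ lemma′ (2 ^ n) ⟩
    2 * (2 * 2 ^ n)              ∎
    where
    open ≤-Reasoning
    lemma : ∀ n → suc n * suc n ≡ n * n + (suc n + n)
    lemma = solve-∀
    lemma′ : ∀ x → 2 * x + (x + x) ≡ 2 * (2 * x)
    lemma′ = solve-∀

  2^-cancel-≤ : ∀ {m n} → 2 ^ m ≤ 2 ^ n → m ≤ n
  2^-cancel-≤ {m} {n} p with m ≤? n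
  ... | yes m≤n = m≤n
  ... | no m≰n  = contradiction p (<⇒≱ (^-monoʳ-< 2 (s≤s (s≤s z≤n)) (≰⇒> m≰n)))

  ceilLog : ∀ n → ∃[ l ] suc n ≤ 2 ^ l × 2 ^ l ≤ 2 * suc n
  ceilLog zero    = 0 , s≤s z≤n , s≤s z≤n
  ceilLog (suc n) with l , lower , upper ← ceilLog n with suc (suc n) ≤? 2 ^ l
  ... | yes p = l , p , ≤-trans upper (*-monoʳ-≤ 2 (n≤1+n (suc n)))
  ... | no ¬p with 2^l≡ ← ≤-antisym (≤-pred (≰⇒> ¬p)) lower =
    suc l ,
    subst (λ x → suc (suc n) ≤ 2 * x) (sym 2^l≡) (s≤s (≤-trans (m≤n+m (suc n) n) (+-monoʳ-≤ n (m≤m+n (suc n) 0)))) ,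
    *-monoʳ-≤ 2 (≤-trans (≤-reflexive 2^l≡) (n≤1+n (suc n)))

  -- The additional `suc` keeps `log k` positive, since it becomes a denominator; the price is the
  -- factor 4 in `2^log≤`.
  log : ℕ → ℕ
  log k = suc (proj₁ (ceilLog (pred k)))

  loglog : ℕ → ℕ
  loglog k = proj₁ (ceilLog (pred (log k)))

  ≤2^log : ∀ k → k ≤ 2 ^ log k
  ≤2^log zero    = z≤n
  ≤2^log (suc k) = ≤-trans (proj₁ (proj₂ (ceilLog k))) (m≤m+n _ _)

  2^log≤ : ∀ k → 1 ≤ k → 2 ^ log k ≤ 4 * k
  2^log≤ (suc k) _ = ≤-trans (*-monoʳ-≤ 2 (proj₂ (proj₂ (ceilLog k)))) (≤-reflexive (sym (*-assoc 2 2 (suc k))))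

  log≤2^loglog : ∀ k → log k ≤ 2 ^ loglog k
  log≤2^loglog k = proj₁ (proj₂ (ceilLog (pred (log k))))

  2^loglog≤ : ∀ k → 2 ^ loglog k ≤ 2 * log k
  2^loglog≤ k = proj₂ (proj₂ (ceilLog (pred (log k))))

  -- Parameters of the lower bound: b ≥ β bounds the size exponent, codewords agree in fewer
  -- than `closeness` of the `wordLength` = closeness · 2^halving positions, and `count`
  -- parties are left after using up wordLength · (2 wordLength) of the k dimensions.
  module Parameters (b k : ℕ) where

    -- Base-2 logarithm of a bound on 8 · `closeness`² · `log k`, where `closeness` is at most 2^(b
    -- + 3) · 2^`loglog k`. Setting it aside makes 4 · `dimensions` · `log k` fit into 2^`log k`.
    slack : ℕ
    slack = 3 + 2 * (b + 3) + 3 * loglog k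

    -- Half of what remains, because `dimensions` is quadratic in `wordLength`.
    halving : ℕ
    halving = (log k ∸ slack) / 2

    closeness : ℕ
    -- The summand 3 covers the passage from t ≤ k^b to 2(t + 1), the count that the greedy code
    -- asks for.
    closeness = b * log k + 3

    wordLength : ℕ
    wordLength = closeness * 2 ^ halving

    dimensions : ℕ
    dimensions = wordLength * (2 * wordLength)

    count : ℕ
    count = k ∸ dimensions

    -- Base-2 logarithm of (`wordLength` / `closeness`)^(2 · `count`), the lower bound for α.
    exponent : ℕ
    exponent = 2 * halving * count

    2*halving≤ : 2 * halving ≤ log k ∸ slack
    2*halving≤ = subst (_≤ log k ∸ slack) (*-comm halving 2) (m/n*n≤m (log k ∸ slack) 2)

    ≤1+2*halving : log k ∸ slack ≤ 1 + 2 * halving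
    ≤1+2*halving = begin
      log k ∸ slack                           ≡⟨ m≡m%n+[m/n]*n (log k ∸ slack) 2 ⟩
      (log k ∸ slack) % 2 + halving * 2       ≤⟨ +-mono-≤ (≤-pred (m%n<n (log k ∸ slack) 2)) (≤-reflexive (*-comm halving 2)) ⟩
      1 + 2 * halving                         ∎
      where open ≤-Reasoning

    exponent≤ : exponent ≤ log k * k
    exponent≤ = *-mono-≤ (≤-trans 2*halving≤ (m∸n≤m (log k) slack)) (m∸n≤m k dimensions)

    1≤closeness : 1 ≤ closeness
    1≤closeness = ≤-trans (s≤s z≤n) (m≤n+m 3 (b * log k))

    closeness≤ : closeness ≤ 2 ^ (b + 3) * 2 ^ loglog k
    closeness≤ = begin
      b * log k + 3              ≤⟨ +-monoʳ-≤ (b * log k) (m≤m*n 3 (log k)) ⟩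
      b * log k + 3 * log k      ≡⟨ *-distribʳ-+ (log k) b 3 ⟨
      (b + 3) * log k            ≤⟨ *-mono-≤ (<⇒≤ (n<2^n (b + 3))) (log≤2^loglog k) ⟩
      2 ^ (b + 3) * 2 ^ loglog k ∎
      where open ≤-Reasoning

    size≤2^closeness : ∀ {t} → t ≤ k ^ b → suc t * 2 ≤ 2 ^ closeness
    size≤2^closeness {t} t≤k^b = begin
      suc t * 2                        ≤⟨ *-monoˡ-≤ 2 (s≤s (≤-trans t≤k^b (^-monoˡ-≤ b (≤2^log k)))) ⟩
      suc ((2 ^ log k) ^ b) * 2        ≡⟨ cong (λ x → suc x * 2) (trans (^-*-assoc 2 (log k) b) (cong (2 ^_) (*-comm (log k) b))) ⟩
      suc (2 ^ (b * log k)) * 2        ≤⟨ *-mono-≤ (+-monoˡ-≤ (2 ^ (b * log k)) (1≤2^ (b * log k))) (s≤s (s≤s (z≤n {2}))) ⟩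
      (2 ^ (b * log k) + 2 ^ (b * log k)) * 4
                                       ≡⟨ lemma (2 ^ (b * log k)) ⟩
      2 ^ (b * log k) * 2 ^ 3          ≡⟨ ^-distribˡ-+-* 2 (b * log k) 3 ⟨
      2 ^ closeness                    ∎
      where
      open ≤-Reasoning
      lemma : ∀ x → (x + x) * 4 ≡ x * 8
      lemma = solve-∀

    -- The z-coordinates take up at most k / `log k` dimensions, and so cost at most k in an
    -- exponent of order k · `log k`.
    dimensions*log≤ : 1 ≤ k → 1 ≤ halving → dimensions * log k ≤ k
    dimensions*log≤ 1≤k 1≤h = *-cancelˡ-≤ 4 (begin
      4 * (dimensions * log k)
        ≤⟨ *-monoʳ-≤ 4 (*-mono-≤ (*-mono-≤ length≤ (*-monoʳ-≤ 2 length≤)) (log≤2^loglog k)) ⟩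
      4 * (C * G * H * (2 * (C * G * H)) * G)
        ≡⟨ lemma C G H ⟩
      8 * (C * (C * 1)) * (G * (G * (G * 1))) * (H * (H * 1))
        ≡⟨ cong₂ _*_ (cong₂ _*_ (cong (8 *_) (pow 2 (b + 3))) (pow 3 (loglog k))) (pow 2 halving) ⟩
      2 ^ 3 * 2 ^ (2 * (b + 3)) * 2 ^ (3 * loglog k) * 2 ^ (2 * halving)
        ≡⟨ cong (λ x → x * 2 ^ (3 * loglog k) * 2 ^ (2 * halving)) (^-distribˡ-+-* 2 3 (2 * (b + 3))) ⟨
      2 ^ (3 + 2 * (b + 3)) * 2 ^ (3 * loglog k) * 2 ^ (2 * halving)
        ≡⟨ cong (_* 2 ^ (2 * halving)) (^-distribˡ-+-* 2 (3 + 2 * (b + 3)) (3 * loglog k)) ⟨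
      2 ^ slack * 2 ^ (2 * halving)
        ≡⟨ ^-distribˡ-+-* 2 slack (2 * halving) ⟨
      2 ^ (slack + 2 * halving)
        ≤⟨ ^-monoʳ-≤ 2 slack+2*halving≤ ⟩
      2 ^ log k
        ≤⟨ 2^log≤ k 1≤k ⟩
      4 * k ∎)
      where
      open ≤-Reasoning
      C = 2 ^ (b + 3)
      G = 2 ^ loglog k
      H = 2 ^ halving
      length≤ : wordLength ≤ C * G * H
      length≤ = *-monoˡ-≤ H closeness≤
      pow : ∀ e x → (2 ^ x) ^ e ≡ 2 ^ (e * x)
      pow e x = trans (^-*-assoc 2 x e) (cong (2 ^_) (*-comm x e))
      lemma : ∀ C G H → 4 * (C * G * H * (2 * (C * G * H)) * G) ≡ 8 * (C * (C * 1)) * (G * (G * (G * 1))) * (H * (H * 1))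
      lemma = solve-∀
      -- A positive `halving` shows that the subtraction `log k ∸ slack` was not truncated.
      slack≤log : slack ≤ log k
      slack≤log with slack ≤? log k
      ... | yes p = p
      ... | no ¬p = contradiction (≤-trans (*-mono-≤ {1} {2} (s≤s z≤n) 1≤h)
        (≤-trans 2*halving≤ (≤-reflexive (m≤n⇒m∸n≡0 (<⇒≤ (≰⇒> ¬p)))))) λ ()
      slack+2*halving≤ : slack + 2 * halving ≤ log k
      slack+2*halving≤ = ≤-trans (+-monoʳ-≤ slack 2*halving≤) (≤-reflexive (m+[n∸m]≡n slack≤log))

    count+dimensions : 1 ≤ k → 1 ≤ halving → count + dimensions ≡ k
    count+dimensions 1≤k 1≤h = m∸n+n≡m (≤-trans (m≤m*n dimensions (log k)) (dimensions*log≤ 1≤k 1≤h))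

    -- This is `exponent` / (k · `log k`) ≥ 1 - 1/r without denominators. The deficit is at most
    -- (`slack` + 2) · k: the slack and the rounding of `halving` cost (`slack` + 1) · k, the
    -- missing dimensions another k.
    exponent-large : ∀ r → 1 ≤ r → 1 ≤ k → r * (slack + 2) ≤ log k → r * (log k * k) ≤ r * exponent + log k * k
    exponent-large r 1≤r 1≤k r*≤log = begin
      r * (log k * k)
        ≤⟨ *-monoʳ-≤ r (begin
          log k * k
            ≡⟨ cong (log k *_) (count+dimensions 1≤k 1≤h) ⟨
          log k * (count + dimensions)
            ≡⟨ lemma (log k) count dimensions ⟩
          log k * count + dimensions * log k
            ≤⟨ +-mono-≤ (*-monoˡ-≤ count log≤) (dimensions*log≤ 1≤k 1≤h) ⟩
          (slack + (1 + 2 * halving)) * count + k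
            ≡⟨ lemma′ slack (2 * halving) count k ⟩
          exponent + ((slack + 1) * count + k)
            ≤⟨ +-monoʳ-≤ exponent (+-monoˡ-≤ k (*-monoʳ-≤ (slack + 1) (m∸n≤m k dimensions))) ⟩
          exponent + ((slack + 1) * k + k)
            ≡⟨ lemma″ exponent slack k ⟩
          exponent + (slack + 2) * k ∎) ⟩
      r * (exponent + (slack + 2) * k)
        ≡⟨ lemma‴ r exponent (slack + 2) k ⟩
      r * exponent + r * (slack + 2) * k
        ≤⟨ +-monoʳ-≤ (r * exponent) (*-monoˡ-≤ k r*≤log) ⟩
      r * exponent + log k * k ∎
      where
      open ≤-Reasoning
      lemma : ∀ l c d → l * (c + d) ≡ l * c + d * l
      lemma = solve-∀
      lemma′ : ∀ s h c k → (s + (1 + h)) * c + k ≡ h * c + ((s + 1) * c + k)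
      lemma′ = solve-∀
      lemma″ : ∀ e s k → e + ((s + 1) * k + k) ≡ e + (s + 2) * k
      lemma″ = solve-∀
      lemma‴ : ∀ r e s k → r * (e + s * k) ≡ r * e + r * s * k
      lemma‴ = solve-∀
      slack+2≤log : slack + 2 ≤ log k
      slack+2≤log = ≤-trans (m≤n*m (slack + 2) r {{>-nonZero 1≤r}}) r*≤log
      log≤ : log k ≤ slack + (1 + 2 * halving)
      log≤ = ≤-trans (≤-reflexive (sym (m+[n∸m]≡n (≤-trans (m≤m+n slack 2) slack+2≤log)))) (+-monoʳ-≤ slack ≤1+2*halving)
      1≤h : 1 ≤ halving
      1≤h with halving in eq
      ... | suc _ = s≤s z≤n
      ... | zero  = contradiction (≤-trans (subst (_≤ log k ∸ slack) (m+n∸m≡n slack 2) (∸-monoˡ-≤ slack slack+2≤log))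
        (subst (λ h → log k ∸ slack ≤ 1 + 2 * h) eq ≤1+2*halving)) λ { (s≤s ()) }

  -- loglog k is at most of order √(log k), as n² ≤ 2·2ⁿ.
  slack-negligible : ∀ b r → 1 ≤ r → ∃[ K ] (∀ k → K ≤ k → r * (Parameters.slack b k + 2) ≤ log k)
  slack-negligible b r 1≤r = 2 ^ (2 ^ T) , λ k K≤k → *-cancelˡ-≤ 4 (begin
    4 * (r * (Parameters.slack b k + 2))
      ≡⟨ lemma r (3 + 2 * (b + 3)) (loglog k) ⟩
    4 * r * (3 + 2 * (b + 3) + 2) + 4 * r * 3 * loglog k
      ≤⟨ +-monoˡ-≤ _ (m≤m*n (4 * r * (3 + 2 * (b + 3) + 2)) (loglog k) {{>-nonZero (≤-trans 1≤T (T≤loglog k K≤k))}}) ⟩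
    4 * r * (3 + 2 * (b + 3) + 2) * loglog k + 4 * r * 3 * loglog k
      ≡⟨ *-distribʳ-+ (loglog k) (4 * r * (3 + 2 * (b + 3) + 2)) (4 * r * 3) ⟨
    T * loglog k
      ≤⟨ *-monoˡ-≤ (loglog k) (T≤loglog k K≤k) ⟩
    loglog k * loglog k
      ≤⟨ n²≤2*2^n (loglog k) ⟩
    2 * 2 ^ loglog k
      ≤⟨ *-monoʳ-≤ 2 (2^loglog≤ k) ⟩
    2 * (2 * log k)
      ≡⟨ *-assoc 2 2 (log k) ⟨
    4 * log k ∎)
    where
    open ≤-Reasoning
    -- T collects the coefficients in 4r(`slack` + 2) ≤ T · `loglog k`, and k ≥ 2^(2^T) ensures T ≤
    -- `loglog k`.
    T = 4 * r * (3 + 2 * (b + 3) + 2) + 4 * r * 3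
    1≤T : 1 ≤ T
    1≤T = ≤-trans (*-mono-≤ {1} {4 * r} {1} {3} (*-mono-≤ {1} {4} (s≤s z≤n) 1≤r) (s≤s z≤n)) (m≤n+m (4 * r * 3) _)
    T≤loglog : ∀ k → 2 ^ (2 ^ T) ≤ k → T ≤ loglog k
    T≤loglog k K≤k = 2^-cancel-≤ (≤-trans (2^-cancel-≤ (≤-trans K≤k (≤2^log k))) (log≤2^loglog k))
    lemma : ∀ r A l → 4 * (r * (A + 3 * l + 2)) ≡ 4 * r * (A + 2) + 4 * r * 3 * l
    lemma = solve-∀

  1≤log : ∀ k → 1 ≤ log k
  1≤log k = s≤s z≤n

  exponent-asymptotics : ∀ b r → 1 ≤ r → ∃[ K ] (∀ k → K ≤ k → 1 ≤ k →
    r * (log k * k) ≤ r * Parameters.exponent b k + log k * k)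
  exponent-asymptotics b r 1≤r = let K , negligible = slack-negligible b r 1≤r in
    K , λ k K≤k 1≤k → Parameters.exponent-large b k r 1≤r 1≤k (negligible k K≤k)

module CoreSets (R : Reals) where

  open Reals R
  open DeterminantMaximization R
  open Growth

  open CommutativeRing commutativeRing using
    (+-assoc; +-comm; +-identityˡ; +-identityʳ; *-assoc; *-comm; *-identityˡ; *-identityʳ;
     distribˡ; distribʳ; zeroˡ; zeroʳ; -‿inverseˡ; -‿inverseʳ; commutativeSemiring)
  open RingProperties ring using (-‿distribˡ-*; -‿distribʳ-*; -‿involutive; -1*x≈-x; -0#≈0#; -‿+-comm)
  open SemiringExp semiring using (^-assocʳ)
  open CommutativeSemiringExp commutativeSemiring using (^-distrib-*)
  open SemiringMult semiring using (×-homo-+; ×1-homo-*)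
  open SemiringSum semiring using
    (sum-cong-≗; *-distribˡ-sum; *-distribʳ-sum; ∑-distrib-+; sum-remove; sum-replicate-zero)
  open DecTotalOrder decTotalOrder using () renaming
    (refl to ≤-refl; reflexive to ≤-reflexive; trans to ≤-trans; antisym to ≤-antisym; total to ≤-total; poset to ≤-poset)
  open DecTotalOrderProperties decTotalOrder using (≰⇒>)
  module ≤-Reasoning where
    open PartialOrderReasoning ≤-poset public

  -- Ordered-field arithmetic, the Archimedean property and suprema

  x+y-y≡x : ∀ x y → x + y - y ≡ x
  x+y-y≡x x y = trans (+-assoc x y (- y)) (trans (cong (x +_) (-‿inverseʳ y)) (+-identityʳ x))

  x-y+y≡x : ∀ x y → x - y + y ≡ x
  x-y+y≡x x y = trans (+-assoc x (- y) y) (trans (cong (x +_) (-‿inverseˡ y)) (+-identityʳ x))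

  +-monoʳ-≤ : ∀ z {x y} → x ≤ y → z + x ≤ z + y
  +-monoʳ-≤ z {x} {y} x≤y = subst₂ _≤_ (+-comm x z) (+-comm y z) (+-monoˡ-≤ z x≤y)

  +-mono-≤ : ∀ {x y u v} → x ≤ y → u ≤ v → x + u ≤ y + v
  +-mono-≤ {y = y} {u = u} x≤y u≤v = ≤-trans (+-monoˡ-≤ u x≤y) (+-monoʳ-≤ y u≤v)

  +-cancelʳ-≤ : ∀ z {x y} → x + z ≤ y + z → x ≤ y
  +-cancelʳ-≤ z {x} {y} p = subst₂ _≤_ (x+y-y≡x x z) (x+y-y≡x y z) (+-monoˡ-≤ (- z) p)

  x≤y⇒0≤y-x : ∀ {x y} → x ≤ y → 0# ≤ y - x
  x≤y⇒0≤y-x {x} {y} x≤y = subst (_≤ y - x) (-‿inverseʳ x) (+-monoˡ-≤ (- x) x≤y)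

  0≤y-x⇒x≤y : ∀ {x y} → 0# ≤ y - x → x ≤ y
  0≤y-x⇒x≤y {x} {y} p = subst₂ _≤_ (+-identityˡ x) (x-y+y≡x y x) (+-monoˡ-≤ x p)

  *-distribʳ-- : ∀ x y z → (x - y) * z ≡ x * z - y * z
  *-distribʳ-- x y z = trans (distribʳ z x (- y)) (cong (x * z +_) (sym (-‿distribˡ-* y z)))

  *-monoˡ-≤ : ∀ {z} → 0# ≤ z → ∀ {x y} → x ≤ y → x * z ≤ y * z
  *-monoˡ-≤ {z} 0≤z {x} {y} x≤y =
    0≤y-x⇒x≤y (subst (0# ≤_) (*-distribʳ-- y x z) (*-nonNeg (x≤y⇒0≤y-x x≤y) 0≤z))

  *-monoʳ-≤ : ∀ {z} → 0# ≤ z → ∀ {x y} → x ≤ y → z * x ≤ z * y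
  *-monoʳ-≤ {z} 0≤z {x} {y} x≤y = subst₂ _≤_ (*-comm x z) (*-comm y z) (*-monoˡ-≤ 0≤z x≤y)

  *-mono-≤ : ∀ {x y u v} → 0# ≤ u → 0# ≤ y → x ≤ y → u ≤ v → x * u ≤ y * v
  *-mono-≤ 0≤u 0≤y x≤y u≤v = ≤-trans (*-monoˡ-≤ 0≤u x≤y) (*-monoʳ-≤ 0≤y u≤v)

  -‿anti-≤ : ∀ {x y} → x ≤ y → - y ≤ - x
  -‿anti-≤ {x} {y} x≤y = subst₂ _≤_
    (trans (cong (x +_) (+-comm (- x) (- y))) (trans (sym (+-assoc x (- y) (- x))) (x+-y-x x (- y))))
    (trans (cong (y +_) (+-comm (- x) (- y))) (trans (sym (+-assoc y (- y) (- x)))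
      (trans (cong (_- x) (-‿inverseʳ y)) (+-identityˡ (- x)))))
    (+-monoˡ-≤ (- x + - y) x≤y)
    where
    x+-y-x : ∀ x y → x + y - x ≡ y
    x+-y-x x y = trans (cong (_- x) (+-comm x y)) (x+y-y≡x y x)

  0<1 : 0# < 1#
  0<1 = 0≤1 , 0≢1

  fromℕ-+ : ∀ m n → fromℕ (m ℕ.+ n) ≡ fromℕ m + fromℕ n
  fromℕ-+ = ×-homo-+ 1#

  fromℕ-* : ∀ m n → fromℕ (m ℕ.* n) ≡ fromℕ m * fromℕ n
  fromℕ-* = ×1-homo-*

  fromℕ-1 : fromℕ 1 ≡ 1#
  fromℕ-1 = +-identityʳ 1#

  fromℕ-^ : ∀ m n → fromℕ (m ℕ.^ n) ≡ fromℕ m ^ n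
  fromℕ-^ m zero    = fromℕ-1
  fromℕ-^ m (suc n) = trans (fromℕ-* m (m ℕ.^ n)) (cong (fromℕ m *_) (fromℕ-^ m n))

  fromℕ-sum : ∀ {n} (f : Fin n → ℕ) → fromℕ (ℕΣ.sum f) ≡ sum (fromℕ ∘ f)
  fromℕ-sum {zero}  f = refl
  fromℕ-sum {suc n} f = trans (fromℕ-+ (f zero) _) (cong (fromℕ (f zero) +_) (fromℕ-sum (f ∘ suc)))

  0≤fromℕ : ∀ n → 0# ≤ fromℕ n
  0≤fromℕ zero    = ≤-refl
  0≤fromℕ (suc n) = subst (_≤ fromℕ (suc n)) (+-identityˡ 0#) (+-mono-≤ 0≤1 (0≤fromℕ n))

  fromℕ-mono : ∀ {m n} → m ℕ.≤ n → fromℕ m ≤ fromℕ n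
  fromℕ-mono {n = n} z≤n = 0≤fromℕ n
  fromℕ-mono (s≤s m≤n) = +-monoʳ-≤ 1# (fromℕ-mono m≤n)

  fromℕ<fromℕ-suc : ∀ n → ¬ (fromℕ (suc n) ≤ fromℕ n)
  fromℕ<fromℕ-suc n p = 0≢1 (≤-antisym 0≤1
    (+-cancelʳ-≤ (fromℕ n) (subst (1# + fromℕ n ≤_) (sym (+-identityˡ _)) p)))

  fromℕ-cancel-≤ : ∀ {m n} → fromℕ m ≤ fromℕ n → m ℕ.≤ n
  fromℕ-cancel-≤ {m} {n} p with m ℕ.≤? n
  ... | yes m≤n = m≤n
  ... | no m≰n  = ⊥-elim (fromℕ<fromℕ-suc n (≤-trans (fromℕ-mono (ℕ.≰⇒> m≰n)) p))

  fromℕ-injective : ∀ {m n} → fromℕ m ≡ fromℕ n → m ≡ n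
  fromℕ-injective eq = ℕ.≤-antisym (fromℕ-cancel-≤ (≤-reflexive eq)) (fromℕ-cancel-≤ (≤-reflexive (sym eq)))

  0<fromℕ : ∀ {n} → 1 ℕ.≤ n → 0# < fromℕ n
  0<fromℕ {n} 1≤n = 0≤fromℕ n , λ 0≡n → 0≢1 (≤-antisym 0≤1
    (subst₂ _≤_ fromℕ-1 (sym 0≡n) (fromℕ-mono 1≤n)))

  *-inverseʳ : ∀ {x} → x ≢ 0# → x * x ⁻¹ ≡ 1#
  *-inverseʳ {x} x≢0 with x ≟ 0#
  ... | yes x≡0 = contradiction x≡0 x≢0
  ... | no x≢0′ = proj₂ (inverse x x≢0′)

  0⁻¹≡0 : 0# ⁻¹ ≡ 0#
  0⁻¹≡0 with 0# ≟ 0#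
  ... | yes _ = refl
  ... | no ¬p = contradiction refl ¬p

  0<⇒≢0 : ∀ {x} → 0# < x → x ≢ 0#
  0<⇒≢0 (_ , 0≢x) = 0≢x ∘ sym

  ⁻¹-nonNeg : ∀ {x} → 0# < x → 0# ≤ x ⁻¹
  ⁻¹-nonNeg {x} 0<x@(0≤x , _) with ≤-total 0# (x ⁻¹)
  ... | inj₁ p = p
  ... | inj₂ p = contradiction (≤-antisym 0≤1
    (subst₂ _≤_ (*-inverseʳ (0<⇒≢0 0<x)) (zeroʳ x) (*-monoʳ-≤ 0≤x p))) 0≢1

  x/y*y≡x : ∀ x {y} → 0# < y → x / y * y ≡ x
  x/y*y≡x x {y} 0<y = trans (*-assoc x (y ⁻¹) y)
    (trans (cong (x *_) (trans (*-comm (y ⁻¹) y) (*-inverseʳ (0<⇒≢0 0<y)))) (*-identityʳ x))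

  x*y/y≡x : ∀ x {y} → 0# < y → x * y / y ≡ x
  x*y/y≡x x {y} 0<y = trans (*-assoc x y (y ⁻¹))
    (trans (cong (x *_) (*-inverseʳ (0<⇒≢0 0<y))) (*-identityʳ x))

  *-cancelʳ-≤ : ∀ {z} → 0# < z → ∀ {x y} → x * z ≤ y * z → x ≤ y
  *-cancelʳ-≤ {z} 0<z {x} {y} p = subst₂ _≤_ (x*y/y≡x x 0<z) (x*y/y≡x y 0<z) (*-monoˡ-≤ (⁻¹-nonNeg 0<z) p)

  *-pos : ∀ {x y} → 0# < x → 0# < y → 0# < x * y
  *-pos {x} {y} 0<x@(0≤x , _) 0<y@(0≤y , 0≢y) = *-nonNeg 0≤x 0≤y ,
    λ 0≡xy → 0≢y (≤-antisym 0≤y (*-cancelʳ-≤ 0<x (≤-reflexive (trans (*-comm y x) (trans (sym 0≡xy) (sym (zeroˡ x)))))))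

  <-≤-trans : ∀ {x y z} → x < y → y ≤ z → x < z
  <-≤-trans {x} {y} (x≤y , x≢y) y≤z = ≤-trans x≤y y≤z , λ { refl → x≢y (≤-antisym x≤y y≤z) }

  ^-nonNeg : ∀ {x} → 0# ≤ x → ∀ n → 0# ≤ x ^ n
  ^-nonNeg 0≤x zero    = 0≤1
  ^-nonNeg 0≤x (suc n) = *-nonNeg 0≤x (^-nonNeg 0≤x n)

  ^-pos : ∀ {x} → 0# < x → ∀ n → 0# < x ^ n
  ^-pos 0<x zero    = 0<1
  ^-pos 0<x (suc n) = *-pos 0<x (^-pos 0<x n)

  ^-mono-≤ : ∀ {x y} → 0# ≤ x → x ≤ y → ∀ n → x ^ n ≤ y ^ n
  ^-mono-≤ 0≤x x≤y zero    = ≤-refl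
  ^-mono-≤ 0≤x x≤y (suc n) = *-mono-≤ (^-nonNeg 0≤x n) (≤-trans 0≤x x≤y) x≤y (^-mono-≤ 0≤x x≤y n)

  1^n≡1 : ∀ n → 1# ^ n ≡ 1#
  1^n≡1 zero    = refl
  1^n≡1 (suc n) = trans (*-identityˡ _) (1^n≡1 n)

  1≤x^n : ∀ {x} → 1# ≤ x → ∀ n → 1# ≤ x ^ n
  1≤x^n {x} 1≤x n = subst (_≤ x ^ n) (1^n≡1 n) (^-mono-≤ 0≤1 1≤x n)

  ^-exponent-mono : ∀ {x} → 1# ≤ x → ∀ {m n} → m ℕ.≤ n → x ^ m ≤ x ^ n
  ^-exponent-mono 1≤x {n = n} z≤n = 1≤x^n 1≤x n
  ^-exponent-mono 1≤x (s≤s m≤n) = *-monoʳ-≤ (≤-trans 0≤1 1≤x) (^-exponent-mono 1≤x m≤n)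

  ^-cancel-≤ : ∀ {x y} n → 0# ≤ y → x ^ suc n ≤ y ^ suc n → x ≤ y
  ^-cancel-≤ {x} {y} n 0≤y p with x ≤? y
  ... | yes x≤y = x≤y
  ... | no x≰y  = *-cancelʳ-≤ (^-pos 0<x n) (≤-trans p (*-monoʳ-≤ 0≤y (^-mono-≤ 0≤y (proj₁ y<x) n)))
    where
    y<x : y < x
    y<x = ≰⇒> x≰y
    0<x : 0# < x
    0<x = ≤-trans 0≤y (proj₁ y<x) , λ { refl → proj₂ y<x (≤-antisym (proj₁ y<x) 0≤y) }

  ⁻¹≤1 : ∀ {x} → 1# ≤ x → x ⁻¹ ≤ 1#
  ⁻¹≤1 {x} 1≤x = *-cancelʳ-≤ 0<x (subst₂ _≤_
    (sym (trans (*-comm (x ⁻¹) x) (*-inverseʳ (0<⇒≢0 0<x)))) (sym (*-identityˡ x)) 1≤x)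
    where
    0<x : 0# < x
    0<x = <-≤-trans 0<1 1≤x

  -- If x bounded the natural numbers they would have a supremum s; some n exceeds s - 1, and then n
  -- + 1 exceeds s.
  archimedean : ∀ x → ∃[ n ] x ≤ fromℕ n
  archimedean x with em (∃[ n ] x ≤ fromℕ n)
  ... | yes p = p
  ... | no ¬p with complete (λ z → ∃[ n ] z ≡ fromℕ n) (0# , 0 , refl) (x , below)
    where
    below : IsUpperBound (λ z → ∃[ n ] z ≡ fromℕ n) x
    below _ (n , refl) with ≤-total (fromℕ n) x
    ... | inj₁ q = q
    ... | inj₂ q = contradiction (n , q) ¬p
  ... | s , ub , approx with approx (s - 1#) s-1<s
    where
    s-1<s : s - 1# < s
    s-1<s = subst (s - 1# ≤_) (+-identityʳ s) (+-monoʳ-≤ s (subst (- 1# ≤_) -0#≈0# (-‿anti-≤ 0≤1)))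
          , λ eq → 0≢1 (trans (sym (-‿inverseʳ s)) (trans (cong (_- s) (trans (sym (x-y+y≡x s 1#)) (cong (_+ 1#) eq)))
              (trans (cong (_- s) (+-comm s 1#)) (x+y-y≡x 1# s))))
  ... | _ , (n , refl) , (s-1≤n , s-1≢n) = contradiction (≤-antisym s-1≤n n≤s-1) s-1≢n
    where
    n≤s-1 : fromℕ n ≤ s - 1#
    n≤s-1 = +-cancelʳ-≤ 1# (subst₂ _≤_ (+-comm 1# (fromℕ n)) (sym (x-y+y≡x s 1#)) (ub _ (suc n , refl)))

  -- The hypothesis `0# ≤ B` takes care of the junk value of `sup`.
  sup-least : ∀ {P B} → 0# ≤ B → IsUpperBound P B → sup P ≤ B
  sup-least {P} {B} 0≤B ub with em (∃ P × ∃ (IsUpperBound P))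
  ... | no _ = 0≤B
  ... | yes (p , q) with complete P p q
  ...   | s , _ , approx with s ≤? B
  ...     | yes s≤B = s≤B
  ...     | no s≰B with x , Px , (B≤x , B≢x) ← approx B (≰⇒> s≰B) =
    contradiction (≤-antisym B≤x (ub x Px)) B≢x

  sup-upper : ∀ {P B z} → IsUpperBound P B → P z → z ≤ sup P
  sup-upper {P} {B} {z} ub Pz with em (∃ P × ∃ (IsUpperBound P))
  ... | no ¬p = contradiction ((z , Pz) , (B , ub)) ¬p
  ... | yes (p , q) = proj₁ (proj₂ (complete P p q)) z Pz

  -- The second case is the junk value of an unbounded supremum.
  sup-upper′ : ∀ {P z} → P z → z ≤ sup P ⊎ sup P ≡ 0#
  sup-upper′ {P} {z} Pz with em (∃ P × ∃ (IsUpperBound P))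
  ... | no ¬p = inj₂ refl
  ... | yes (p , q) = inj₁ (proj₁ (proj₂ (complete P p q)) z Pz)

  sum-zero : ∀ {n} {f : Fin n → ℝ} → (∀ i → f i ≡ 0#) → sum f ≡ 0#
  sum-zero {n} f≡0 = trans (sum-cong-≗ f≡0) (sum-replicate-zero n)

  sum-single : ∀ {n} {f : Fin n → ℝ} i → (∀ j → j ≢ i → f j ≡ 0#) → sum f ≡ f i
  sum-single {suc n} {f} i f≡0 = trans (sum-remove {i = i} f)
    (trans (cong (f i +_) (sum-zero (λ j → f≡0 (punchIn i j) (punchInᵢ≢i i j)))) (+-identityʳ (f i)))

  x+y≡0⇒x≡-y : ∀ {x y} → x + y ≡ 0# → x ≡ - y
  x+y≡0⇒x≡-y {x} {y} eq = trans (sym (x+y-y≡x x y)) (trans (cong (_- y) eq) (+-identityˡ (- y)))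

  -‿zero : ∀ {x} → x ≡ 0# → - x ≡ 0#
  -‿zero refl = -0#≈0#

  *-swap : ∀ x y z → x * (y * z) ≡ y * (x * z)
  *-swap x y z = trans (sym (*-assoc x y z)) (trans (cong (_* z) (*-comm x y)) (*-assoc y x z))

  -- Determinants as alternating multilinear forms

  Rows : ℕ → ℕ → Set
  Rows n N = Fin n → Fin N → ℝ

  -- Equations are pointwise for want of function extensionality. Alternation is asked of adjacent
  -- arguments only, which is what the cofactor recursion delivers; swaps extend it.
  record Alternating {n N} (F : Rows n N → ℝ) : Set where
    field
      congruent  : ∀ {A B} → (∀ i p → A i p ≡ B i p) → F A ≡ F B
      linear     : ∀ i x y {A B C} → (∀ p → C i p ≡ x * A i p + y * B i p) →
                   (∀ j → j ≢ i → ∀ p → C j p ≡ A j p) → (∀ j → j ≢ i → ∀ p → C j p ≡ B j p) →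
                   F C ≡ x * F A + y * F B
      alternates : ∀ {i j} → toℕ j ≡ suc (toℕ i) → ∀ {A} → (∀ p → A i p ≡ A j p) → F A ≡ 0#

  ◂-cong : ∀ {n N} {u v : Fin N → ℝ} {A B : Rows n N} → (∀ p → u p ≡ v p) → (∀ i p → A i p ≡ B i p) →
           ∀ i p → (u ◂ A) i p ≡ (v ◂ B) i p
  ◂-cong u≗v A≗B zero    = u≗v
  ◂-cong u≗v A≗B (suc i) = A≗B i

  ◂-η : ∀ {n N} (A : Rows (suc n) N) → ∀ i p → A i p ≡ (A zero ◂ tail A) i p
  ◂-η A zero    p = refl
  ◂-η A (suc i) p = refl

  fixHead : ∀ {n N} {F : Rows (suc n) N → ℝ} → Alternating F → ∀ u → Alternating (λ C → F (u ◂ C))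
  fixHead {F = F} alt u = record
    { congruent  = λ A≗B → congruent (◂-cong (λ _ → refl) A≗B)
    ; linear     = λ i x y {A} {B} {C} Cᵢ C≗A C≗B → linear (suc i) x y Cᵢ (extend C≗A) (extend C≗B)
    ; alternates = λ eq → alternates (cong suc eq)
    }
    where
    open Alternating alt
    extend : ∀ {i} {C A : Rows _ _} → (∀ j → j ≢ i → ∀ p → C j p ≡ A j p) →
             ∀ j → j ≢ suc i → ∀ p → (u ◂ C) j p ≡ (u ◂ A) j p
    extend C≗A zero    _  p = refl
    extend C≗A (suc j) j≢ p = C≗A j (j≢ ∘ cong suc) p

  module _ {n N} {F : Rows (suc n) N → ℝ} (alt : Alternating F) where
    open Alternating alt

    head-linear : ∀ x y u v C → F ((λ p → x * u p + y * v p) ◂ C) ≡ x * F (u ◂ C) + y * F (v ◂ C)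
    head-linear x y u v C = linear zero x y (λ _ → refl) same same
      where
      same : ∀ {w w′} j → j ≢ zero → ∀ p → (w ◂ C) j p ≡ (w′ ◂ C) j p
      same zero    0≢0 _ = contradiction refl 0≢0
      same (suc j) _   _ = refl

    head-+ : ∀ u v C → F ((λ p → u p + v p) ◂ C) ≡ F (u ◂ C) + F (v ◂ C)
    head-+ u v C = trans
      (congruent (◂-cong (λ p → sym (cong₂ _+_ (*-identityˡ (u p)) (*-identityˡ (v p)))) (λ _ _ → refl)))
      (trans (head-linear 1# 1# u v C) (cong₂ _+_ (*-identityˡ _) (*-identityˡ _)))

    head-+* : ∀ y u v C → F ((λ p → u p + y * v p) ◂ C) ≡ F (u ◂ C) + y * F (v ◂ C)
    head-+* y u v C = trans
      (congruent (◂-cong (λ p → sym (cong (_+ y * v p) (*-identityˡ (u p)))) (λ _ _ → refl)))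
      (trans (head-linear 1# y u v C) (cong (_+ y * F (v ◂ C)) (*-identityˡ _)))

    head-zero : ∀ C → F ((λ _ → 0#) ◂ C) ≡ 0#
    head-zero C = trans
      (congruent (◂-cong (λ p → sym (trans (cong₂ _+_ (zeroˡ 0#) (zeroˡ 0#)) (+-identityˡ 0#))) (λ _ _ → refl)))
      (trans (head-linear 0# 0# (λ _ → 0#) (λ _ → 0#) C)
        (trans (cong₂ _+_ (zeroˡ _) (zeroˡ _)) (+-identityˡ 0#)))

    head-sum : ∀ {t} (a : Fin t → ℝ) (D : Rows t N) C →
               F ((λ p → sum (λ j → a j * D j p)) ◂ C) ≡ sum (λ j → a j * F (D j ◂ C))
    head-sum {zero}  a D C = head-zero C
    head-sum {suc t} a D C = trans
      (congruent (◂-cong (λ p → +-comm (a zero * D zero p) _) (λ _ _ → refl)))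
      (trans (head-+* (a zero) _ (D zero) C)
        (trans (+-comm _ (a zero * F (D zero ◂ C))) (cong (a zero * F (D zero ◂ C) +_) (head-sum (a ∘ suc) (D ∘ suc) C))))

  -- Polarisation of F(u + v, u + v, C) = 0.
  swap-head : ∀ {n N} {F : Rows (suc (suc n)) N → ℝ} → Alternating F → ∀ u v C →
              F (u ◂ v ◂ C) ≡ - F (v ◂ u ◂ C)
  swap-head {F = F} alt u v C = x+y≡0⇒x≡-y (begin
    F (u ◂ v ◂ C) + F (v ◂ u ◂ C)
      ≡⟨ cong₂ _+_
           (trans (cong (_+ F (u ◂ v ◂ C)) (repeated u)) (+-identityˡ _))
           (trans (cong (F (v ◂ u ◂ C) +_) (repeated v)) (+-identityʳ _)) ⟨
    (F (u ◂ u ◂ C) + F (u ◂ v ◂ C)) + (F (v ◂ u ◂ C) + F (v ◂ v ◂ C))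
      ≡⟨ cong₂ _+_ (head-+ (fixHead alt u) u v C) (head-+ (fixHead alt v) u v C) ⟨
    F (u ◂ u+v ◂ C) + F (v ◂ u+v ◂ C)
      ≡⟨ head-+ alt u v (u+v ◂ C) ⟨
    F (u+v ◂ u+v ◂ C)
      ≡⟨ repeated u+v ⟩
    0# ∎)
    where
    open Alternating alt
    open ≡-Reasoning
    u+v = λ p → u p + v p
    repeated : ∀ w → F (w ◂ w ◂ C) ≡ 0#
    repeated w = alternates {zero} {suc zero} refl (λ _ → refl)

  -- Adjacent swaps carry the first vector towards its copy until the two are neighbours.
  head-repeated : ∀ {n N} {F : Rows (suc n) N → ℝ} → Alternating F → ∀ i {w} C → (∀ p → C i p ≡ w p) → F (w ◂ C) ≡ 0#
  head-repeated {suc n} alt zero C eq = Alternating.alternates alt {zero} {suc zero} refl (sym ∘ eq)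
  head-repeated {suc n} {F = F} alt (suc i) {w} C eq = begin
    F (w ◂ C)                      ≡⟨ Alternating.congruent alt (◂-cong (λ _ → refl) (◂-η C)) ⟩
    F (w ◂ C zero ◂ tail C)        ≡⟨ swap-head alt w (C zero) (tail C) ⟩
    - F (C zero ◂ w ◂ tail C)      ≡⟨ -‿zero (head-repeated (fixHead alt (C zero)) i (tail C) eq) ⟩
    0#                             ∎
    where open ≡-Reasoning

  -- By linearity, one argument at a time. With B j in first place, w = B j is such a null vector,
  -- so its multiples can be struck from all other arguments.
  shift-by-null : ∀ {n N} {F : Rows n N → ℝ} → Alternating F → (w : Fin N → ℝ) →
                  (∀ C i → (∀ p → C i p ≡ w p) → F C ≡ 0#) →
                  ∀ C (c : Fin n → ℝ) → F (λ i p → C i p + c i * w p) ≡ F C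
  shift-by-null {zero} alt w null C c = Alternating.congruent alt (λ ())
  shift-by-null {suc n} {F = F} alt w null C c = begin
    F D
      ≡⟨ congruent (◂-η D) ⟩
    F ((λ p → C zero p + c zero * w p) ◂ tail D)
      ≡⟨ head-+* alt (c zero) (C zero) w (tail D) ⟩
    F (C zero ◂ tail D) + c zero * F (w ◂ tail D)
      ≡⟨ cong (λ z → F (C zero ◂ tail D) + c zero * z) (null (w ◂ tail D) zero (λ _ → refl)) ⟩
    F (C zero ◂ tail D) + c zero * 0#
      ≡⟨ trans (cong (F (C zero ◂ tail D) +_) (zeroʳ (c zero))) (+-identityʳ _) ⟩
    F (C zero ◂ tail D)
      ≡⟨ shift-by-null (fixHead alt (C zero)) w (λ C′ i → null (C zero ◂ C′) (suc i)) (tail C) (c ∘ suc) ⟩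
    F (C zero ◂ tail C)
      ≡⟨ congruent (◂-η C) ⟨
    F C ∎
    where
    open Alternating alt
    open ≡-Reasoning
    D = λ i p → C i p + c i * w p

  move-to-head : ∀ {n N} {F : Rows (suc n) N → ℝ} → Alternating F → ∀ B j →
                 F (B j ◂ B ∘ punchIn j) ≡ (- 1#) ^ toℕ j * F B
  move-to-head {F = F} alt B zero = trans (sym (Alternating.congruent alt (◂-η B))) (sym (*-identityˡ (F B)))
  move-to-head {suc n} {F = F} alt B (suc j) = begin
    F (B (suc j) ◂ B ∘ punchIn (suc j))
      ≡⟨ congruent (◂-cong (λ _ → refl) (◂-η (B ∘ punchIn (suc j)))) ⟩
    F (B (suc j) ◂ B zero ◂ tail B ∘ punchIn j)
      ≡⟨ swap-head alt (B (suc j)) (B zero) (tail B ∘ punchIn j) ⟩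
    - F (B zero ◂ B (suc j) ◂ tail B ∘ punchIn j)
      ≡⟨ cong -_ (move-to-head (fixHead alt (B zero)) (tail B) j) ⟩
    - ((- 1#) ^ toℕ j * F (B zero ◂ tail B))
      ≡⟨ -1*x≈-x _ ⟨
    (- 1#) * ((- 1#) ^ toℕ j * F (B zero ◂ tail B))
      ≡⟨ *-assoc (- 1#) _ _ ⟨
    (- 1#) ^ toℕ (suc j) * F (B zero ◂ tail B)
      ≡⟨ cong ((- 1#) ^ toℕ (suc j) *_) (congruent (◂-η B)) ⟨
    (- 1#) ^ toℕ (suc j) * F B ∎
    where
    open Alternating alt
    open ≡-Reasoning

  minor : ∀ {n} → Matrix (suc n) → Fin (suc n) → Matrix n
  minor A j a b = A (suc a) (punchIn j b)

  -- Expanding the first argument and striking B j from the others reproduces the cofactor expansion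
  -- that defines `det`. Applied to the determinant itself, this uniqueness of alternating forms
  -- gives multiplicativity without sums over permutations.
  alternating-of-combinations : ∀ {n N} {F : Rows n N → ℝ} → Alternating F → (A : Matrix n) (B : Rows n N) →
    F (λ i p → sum (λ j → A i j * B j p)) ≡ det A * F B
  alternating-of-combinations {zero} alt A B =
    trans (Alternating.congruent alt (λ ())) (sym (*-identityˡ _))
  alternating-of-combinations {suc n} {N} {F} alt A B = begin
    F (λ i p → sum (λ j → A i j * B j p))
      ≡⟨ congruent (◂-η _) ⟩
    F ((λ p → sum (λ j → A zero j * B j p)) ◂ T)
      ≡⟨ head-sum alt (A zero) B T ⟩
    sum (λ j → A zero j * F (B j ◂ T))
      ≡⟨ sum-cong-≗ term ⟩
    sum (λ j → (- 1#) ^ toℕ j * A zero j * det (minor A j) * F B)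
      ≡⟨ *-distribʳ-sum (F B) (λ j → (- 1#) ^ toℕ j * A zero j * det (minor A j)) ⟨
    det A * F B ∎
    where
    open Alternating alt
    open ≡-Reasoning
    T : Rows n N
    T i p = sum (λ l → A (suc i) l * B l p)
    T′ : Fin (suc n) → Rows n N
    T′ j i p = sum (λ l → minor A j i l * B (punchIn j l) p)
    term : ∀ j → A zero j * F (B j ◂ T) ≡ (- 1#) ^ toℕ j * A zero j * det (minor A j) * F B
    term j = begin
      A zero j * F (B j ◂ T)
        ≡⟨ cong (A zero j *_) (congruent (◂-cong (λ _ → refl) (λ i p →
             trans (sum-remove {i = j} (λ l → A (suc i) l * B l p)) (+-comm _ (T′ j i p))))) ⟩
      A zero j * F (B j ◂ λ i p → T′ j i p + A (suc i) j * B j p)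
        ≡⟨ cong (A zero j *_) (shift-by-null (fixHead alt (B j)) (B j)
             (λ C i eq → head-repeated alt i C eq) (T′ j) (λ i → A (suc i) j)) ⟩
      A zero j * F (B j ◂ T′ j)
        ≡⟨ cong (A zero j *_) (alternating-of-combinations (fixHead alt (B j)) (minor A j) (B ∘ punchIn j)) ⟩
      A zero j * (det (minor A j) * F (B j ◂ B ∘ punchIn j))
        ≡⟨ cong (λ z → A zero j * (det (minor A j) * z)) (move-to-head alt B j) ⟩
      A zero j * (det (minor A j) * ((- 1#) ^ toℕ j * F B))
        ≡⟨ cong (A zero j *_) (*-swap (det (minor A j)) ((- 1#) ^ toℕ j) (F B)) ⟩
      A zero j * ((- 1#) ^ toℕ j * (det (minor A j) * F B))
        ≡⟨ *-swap (A zero j) ((- 1#) ^ toℕ j) _ ⟩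
      (- 1#) ^ toℕ j * (A zero j * (det (minor A j) * F B))
        ≡⟨ trans (*-assoc _ (det (minor A j)) (F B)) (*-assoc ((- 1#) ^ toℕ j) (A zero j) _) ⟨
      (- 1#) ^ toℕ j * A zero j * det (minor A j) * F B ∎

  det-cong : ∀ {n} {A B : Matrix n} → (∀ i j → A i j ≡ B i j) → det A ≡ det B
  det-cong {zero}  A≗B = refl
  det-cong {suc n} A≗B = sum-cong-≗ (λ j →
    cong₂ _*_ (cong ((- 1#) ^ toℕ j *_) (A≗B zero j)) (det-cong (λ a b → A≗B (suc a) (punchIn j b))))

  det-linear : ∀ {n} i x y {A B C : Matrix n} → (∀ r → C r i ≡ x * A r i + y * B r i) →
               (∀ j → j ≢ i → ∀ r → C r j ≡ A r j) → (∀ j → j ≢ i → ∀ r → C r j ≡ B r j) →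
               det C ≡ x * det A + y * det B
  det-linear {suc n} i x y {A} {B} {C} Cᵢ C≗A C≗B = begin
    det C
      ≡⟨ sum-cong-≗ term ⟩
    sum (λ j → x * α j + y * β j)
      ≡⟨ ∑-distrib-+ (λ j → x * α j) (λ j → y * β j) ⟩
    sum (λ j → x * α j) + sum (λ j → y * β j)
      ≡⟨ cong₂ _+_ (*-distribˡ-sum x α) (*-distribˡ-sum y β) ⟨
    x * det A + y * det B ∎
    where
    open ≡-Reasoning
    s : Fin (suc n) → ℝ
    s j = (- 1#) ^ toℕ j
    α β : Fin (suc n) → ℝ
    α j = s j * A zero j * det (minor A j)
    β j = s j * B zero j * det (minor B j)
    term : ∀ j → s j * C zero j * det (minor C j) ≡ x * α j + y * β j
    term j with j ≟ᶠ i
    ... | yes refl = begin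
      s j * C zero j * det (minor C j)
        ≡⟨ cong (λ z → s j * z * det (minor C j)) (Cᵢ zero) ⟩
      s j * (x * A zero j + y * B zero j) * det (minor C j)
        ≡⟨ trans (cong (_* det (minor C j)) (distribˡ (s j) _ _)) (distribʳ (det (minor C j)) _ _) ⟩
      s j * (x * A zero j) * det (minor C j) + s j * (y * B zero j) * det (minor C j)
        ≡⟨ cong₂ _+_ (pull x A C≗A) (pull y B C≗B) ⟩
      x * α j + y * β j ∎
      where
      pull : ∀ z (D : Matrix (suc n)) → (∀ l → l ≢ j → ∀ r → C r l ≡ D r l) →
             s j * (z * D zero j) * det (minor C j) ≡ z * (s j * D zero j * det (minor D j))
      pull z D C≗D = trans (cong₂ _*_ (*-swap (s j) z (D zero j))
        (det-cong (λ a b → C≗D (punchIn j b) (punchInᵢ≢i j b) (suc a)))) (*-assoc z _ _)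
    ... | no j≢i = begin
      s j * C zero j * det (minor C j)
        ≡⟨ cong (s j * C zero j *_) (det-linear (punchOut j≢i) x y
             (λ r → subst (λ l → C (suc r) l ≡ x * A (suc r) l + y * B (suc r) l) (sym (punchIn-punchOut j≢i)) (Cᵢ (suc r)))
             (λ l l≢ r → C≗A (punchIn j l) (avoid l l≢) (suc r))
             (λ l l≢ r → C≗B (punchIn j l) (avoid l l≢) (suc r))) ⟩
      s j * C zero j * (x * det (minor A j) + y * det (minor B j))
        ≡⟨ trans (distribˡ (s j * C zero j) _ _) (cong₂ _+_ (*-swap _ x _) (*-swap _ y _)) ⟩
      x * (s j * C zero j * det (minor A j)) + y * (s j * C zero j * det (minor B j))
        ≡⟨ cong₂ (λ a b → x * (s j * a * det (minor A j)) + y * (s j * b * det (minor B j)))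
             (C≗A j j≢i zero) (C≗B j j≢i zero) ⟩
      x * α j + y * β j ∎
      where
      avoid : ∀ l → l ≢ punchOut j≢i → punchIn j l ≢ i
      avoid l l≢ eq = l≢ (punchIn-injective j l (punchOut j≢i) (trans eq (sym (punchIn-punchOut j≢i))))

  -- The enumerations skipping i and its successor j differ in one place, where they yield j and i;
  -- hence equal adjacent columns have equal minors.
  punchIn-adjacent : ∀ {n} {i j : Fin (suc n)} → toℕ j ≡ suc (toℕ i) → ∀ l →
                     punchIn i l ≡ punchIn j l ⊎ (punchIn i l ≡ j × punchIn j l ≡ i)
  punchIn-adjacent {i = zero}  {suc zero} _  zero    = inj₂ (refl , refl)
  punchIn-adjacent {i = zero}  {suc zero} _  (suc l) = inj₁ refl
  punchIn-adjacent {i = suc i} {suc j}    eq zero    = inj₁ refl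
  punchIn-adjacent {i = suc i} {suc j}    eq (suc l) with punchIn-adjacent (ℕ.suc-injective eq) l
  ... | inj₁ p       = inj₁ (cong suc p)
  ... | inj₂ (p , q) = inj₂ (cong suc p , cong suc q)

  punchOut-adjacent : ∀ {n} {t i j : Fin (suc n)} → toℕ j ≡ suc (toℕ i) → (t≢i : t ≢ i) (t≢j : t ≢ j) →
                      toℕ (punchOut t≢j) ≡ suc (toℕ (punchOut t≢i))
  punchOut-adjacent {t = zero} {zero}         _  t≢i _ = contradiction refl t≢i
  punchOut-adjacent {t = zero} {suc i} {suc j} eq _ _ = ℕ.suc-injective eq
  punchOut-adjacent {suc n} {suc zero} {zero} {suc zero} _ _ t≢j = contradiction refl t≢j
  punchOut-adjacent {suc (suc n)} {suc (suc t)} {zero} {suc zero} _ _ _ = refl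
  punchOut-adjacent {suc n} {suc t} {suc i} {suc j} eq t≢i t≢j =
    cong suc (punchOut-adjacent (ℕ.suc-injective eq) (t≢i ∘ cong suc) (t≢j ∘ cong suc))

  -- By induction the cofactor terms of all other columns vanish, as their minors still contain both
  -- equal columns; the two remaining terms have equal minors and opposite signs.
  det-alternates : ∀ {n} {i j : Fin n} → toℕ j ≡ suc (toℕ i) → {A : Matrix n} → (∀ r → A r i ≡ A r j) → det A ≡ 0#
  det-alternates {suc n} {i} {j} eq {A} Aᵢ≗Aⱼ = begin
    sum f
      ≡⟨ sum-remove {i = i} f ⟩
    f i + sum (f ∘ punchIn i)
      ≡⟨ cong (f i +_) (sum-single (punchOut i≢j) others) ⟩
    f i + f (punchIn i (punchOut i≢j))
      ≡⟨ cong (λ l → f i + f l) (punchIn-punchOut i≢j) ⟩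
    f i + f j
      ≡⟨ cong (f i +_) f-opposite ⟩
    f i - f i
      ≡⟨ -‿inverseʳ (f i) ⟩
    0# ∎
    where
    open ≡-Reasoning
    f : Fin (suc n) → ℝ
    f l = (- 1#) ^ toℕ l * A zero l * det (minor A l)
    i≢j : i ≢ j
    i≢j refl = ℕ.1+n≢n (sym eq)
    others : ∀ l → l ≢ punchOut i≢j → f (punchIn i l) ≡ 0#
    others l l≢ = trans (cong ((- 1#) ^ toℕ t * A zero t *_)
        (det-alternates {n} {punchOut t≢i} {punchOut t≢j} (punchOut-adjacent eq t≢i t≢j) (λ r → subst₂ (λ a b → A (suc r) a ≡ A (suc r) b)
          (sym (punchIn-punchOut t≢i)) (sym (punchIn-punchOut t≢j)) (Aᵢ≗Aⱼ (suc r)))))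
      (zeroʳ _)
      where
      t = punchIn i l
      t≢i : t ≢ i
      t≢i = punchInᵢ≢i i l
      t≢j : t ≢ j
      t≢j q = l≢ (punchIn-injective i l (punchOut i≢j) (trans q (sym (punchIn-punchOut i≢j))))
    same-minor : ∀ a b → minor A j a b ≡ minor A i a b
    same-minor a b with punchIn-adjacent eq b
    ... | inj₁ p       = cong (A (suc a)) (sym p)
    ... | inj₂ (p , q) = trans (cong (A (suc a)) q) (trans (Aᵢ≗Aⱼ (suc a)) (cong (A (suc a)) (sym p)))
    f-opposite : f j ≡ - f i
    f-opposite = begin
      (- 1#) ^ toℕ j * A zero j * det (minor A j)
        ≡⟨ cong₂ _*_ (cong₂ (λ e a → (- 1#) ^ e * a) eq (sym (Aᵢ≗Aⱼ zero))) (det-cong same-minor) ⟩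
      (- 1#) * (- 1#) ^ toℕ i * A zero i * det (minor A i)
        ≡⟨ trans (cong (_* det (minor A i)) (*-assoc (- 1#) _ _)) (*-assoc (- 1#) _ _) ⟩
      (- 1#) * f i
        ≡⟨ -1*x≈-x (f i) ⟩
      - f i ∎

  det-alternating : ∀ {n} → Alternating {n} {n} (λ B → det (λ r i → B i r))
  det-alternating = record
    { congruent  = λ A≗B → det-cong (λ r i → A≗B i r)
    ; linear     = λ i x y Cᵢ C≗A C≗B → det-linear i x y Cᵢ C≗A C≗B
    ; alternates = λ eq A≗ → det-alternates eq A≗
    }

  -- The combinations are taken of columns of `B` with coefficients from rows of `A`, so the matrix
  -- on the left is B Aᵀ.
  det-*ᵀ : ∀ {n} (A B : Matrix n) → det (λ r i → sum (λ j → A i j * B r j)) ≡ det A * det B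
  det-*ᵀ A B = alternating-of-combinations det-alternating A (λ j r → B r j)

  -- Triangular matrices, transposes and products

  product : ∀ {n} → (Fin n → ℝ) → ℝ
  product {zero}  f = 1#
  product {suc n} f = f zero * product (f ∘ suc)

  det-lowerTriangular : ∀ {n} (A : Matrix n) → (∀ i j → toℕ i ℕ.< toℕ j → A i j ≡ 0#) →
                        det A ≡ product (λ i → A i i)
  det-lowerTriangular {zero}  A lower = refl
  det-lowerTriangular {suc n} A lower = trans
    (sum-single {f = λ j → (- 1#) ^ toℕ j * A zero j * det (minor A j)} zero (λ
      { zero    0≢0 → contradiction refl 0≢0
      ; (suc j) _   → trans (cong (λ z → (- 1#) ^ toℕ (suc j) * z * det (minor A (suc j))) (lower zero (suc j) (s≤s z≤n)))
                        (trans (cong (_* det (minor A (suc j))) (zeroʳ _)) (zeroˡ _)) }))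
    (cong₂ _*_ (*-identityˡ (A zero zero))
      (det-lowerTriangular (λ a b → A (suc a) (suc b)) (λ a b lt → lower (suc a) (suc b) (s≤s lt))))

  product-ones : ∀ {n} {f : Fin n → ℝ} → (∀ i → f i ≡ 1#) → product f ≡ 1#
  product-ones {zero}  f≡1 = refl
  product-ones {suc n} f≡1 = trans (cong₂ _*_ (f≡1 zero) (product-ones (f≡1 ∘ suc))) (*-identityˡ 1#)

  κℝ : ∀ {n} → Fin n → Fin n → ℝ
  κℝ i j = fromℕ (κ i j)

  κℝ-refl : ∀ {n} (i : Fin n) → κℝ i i ≡ 1#
  κℝ-refl i = trans (cong fromℕ (κ-refl i)) fromℕ-1

  κℝ-≢ : ∀ {n} {i j : Fin n} → i ≢ j → κℝ i j ≡ 0#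
  κℝ-≢ i≢j = cong fromℕ (κ-≢ i≢j)

  sum-κℝ : ∀ {n} (f : Fin n → ℝ) i → sum (λ j → κℝ i j * f j) ≡ f i
  sum-κℝ f i = trans
    (sum-single i (λ j j≢i → trans (cong (_* f j) (κℝ-≢ (j≢i ∘ sym))) (zeroˡ (f j))))
    (trans (cong (_* f i) (κℝ-refl i)) (*-identityˡ (f i)))

  <⇒≢ : ∀ {n} {i j : Fin n} → toℕ i ℕ.< toℕ j → i ≢ j
  <⇒≢ lt refl = ℕ.<-irrefl refl lt

  -- The product formula for B Aᵀ with B the identity.
  det-transpose : ∀ {n} (A : Matrix n) → det (λ i j → A j i) ≡ det A
  det-transpose {n} A = begin
    det (λ r i → A i r)                          ≡⟨ det-cong (λ r i → trans (sum-cong-≗ (λ j → *-comm (A i j) (κℝ r j))) (sum-κℝ (A i) r)) ⟨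
    det (λ r i → sum (λ j → A i j * κℝ r j))     ≡⟨ det-*ᵀ A κℝ ⟩
    det A * det {n} κℝ                           ≡⟨ cong (det A *_) (trans (det-lowerTriangular {n} κℝ (λ i j lt → κℝ-≢ (<⇒≢ lt)))
                                                       (product-ones {n} κℝ-refl)) ⟩
    det A * 1#                                   ≡⟨ *-identityʳ (det A) ⟩
    det A                                        ∎
    where open ≡-Reasoning

  det-* : ∀ {n} (A B : Matrix n) → det (λ i j → sum (λ l → A i l * B l j)) ≡ det A * det B
  det-* A B = trans (det-cong (λ i j → sum-cong-≗ (λ l → *-comm (A i l) (B l j))))
    (trans (det-*ᵀ (λ i l → B l i) A) (trans (cong (_* det A) (det-transpose B)) (*-comm (det B) (det A))))

  det-unitUpperTriangular : ∀ {n} (A : Matrix n) → (∀ i → A i i ≡ 1#) →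
                            (∀ i j → toℕ i ℕ.< toℕ j → A j i ≡ 0#) → det A ≡ 1#
  det-unitUpperTriangular A diag upper = trans (sym (det-transpose A))
    (trans (det-lowerTriangular (λ i j → A j i) upper) (product-ones diag))

  det-zeroRow : ∀ {n} (A : Matrix n) i → (∀ j → A i j ≡ 0#) → det A ≡ 0#
  det-zeroRow {suc n} A zero    Aᵢ≡0 = sum-zero (λ j →
    trans (cong (λ z → (- 1#) ^ toℕ j * z * det (minor A j)) (Aᵢ≡0 j)) (trans (cong (_* det (minor A j)) (zeroʳ _)) (zeroˡ _)))
  det-zeroRow {suc n} A (suc i) Aᵢ≡0 = sum-zero (λ j →
    trans (cong ((- 1#) ^ toℕ j * A zero j *_) (det-zeroRow (minor A j) i (Aᵢ≡0 ∘ punchIn j))) (zeroʳ _))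

  -- The objective

  open Extrema (DecTotalOrder.totalOrder decTotalOrder) using (⊥≤max; xs≤max; max≤v⁺)

  ∈⇒≤maximum : ∀ {x xs} → x ∈ xs → x ≤ maximum xs
  ∈⇒≤maximum {xs = x ∷ xs} (here refl) = ⊥≤max x xs
  ∈⇒≤maximum {xs = x ∷ xs} (there y∈)  = All.lookup (xs≤max x xs) y∈

  maximum≤ : ∀ {B} xs → 0# ≤ B → (∀ {x} → x ∈ xs → x ≤ B) → maximum xs ≤ B
  maximum≤ []       0≤B _  = 0≤B
  maximum≤ (x ∷ xs) 0≤B ub = max≤v⁺ (ub (here refl)) (All.tabulate (ub ∘ there))

  sumList-++ : ∀ xs ys → sumList (xs ++ ys) ≡ sumList xs + sumList ys
  sumList-++ []       ys = sym (+-identityˡ _)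
  sumList-++ (x ∷ xs) ys = trans (cong (x +_) (sumList-++ xs ys)) (sym (+-assoc x _ _))

  sumList-zero : ∀ {A : Set} {g : A → ℝ} xs → (∀ {x} → x ∈ xs → g x ≡ 0#) → sumList (map g xs) ≡ 0#
  sumList-zero []       _   = refl
  sumList-zero (x ∷ xs) g≡0 = trans (cong₂ _+_ (g≡0 (here refl)) (sumList-zero xs (g≡0 ∘ there))) (+-identityˡ 0#)

  -- The initial selection is the only one that avoids `ys`.
  sum-choose : ∀ {A : Set} k (h : Fin k → A) ys (g : Vec A k → ℝ) →
               (∀ T i → lookup T i ∈ ys → g T ≡ 0#) →
               sumList (map g (choose k (List.tabulate h ++ ys))) ≡ g (Vec.tabulate h)
  sum-choose zero    h ys g g≡0 = +-identityʳ (g [])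
  sum-choose (suc k) h ys g g≡0 = begin
    sumList (map g (map (h zero ∷_) (choose k zs) ++ choose (suc k) zs))
      ≡⟨ cong sumList (map-++ g (map (h zero ∷_) (choose k zs)) _) ⟩
    sumList (map g (map (h zero ∷_) (choose k zs)) ++ map g (choose (suc k) zs))
      ≡⟨ sumList-++ (map g (map (h zero ∷_) (choose k zs))) _ ⟩
    sumList (map g (map (h zero ∷_) (choose k zs))) + sumList (map g (choose (suc k) zs))
      ≡⟨ cong₂ _+_ (trans (cong sumList (sym (map-∘ (choose k zs))))
                     (sum-choose k (h ∘ suc) ys (g ∘ (h zero ∷_)) (λ T i → g≡0 (h zero ∷ T) (suc i))))
           (sumList-zero (choose (suc k) zs) avoid) ⟩
    g (Vec.tabulate h) + 0#
      ≡⟨ +-identityʳ _ ⟩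
    g (Vec.tabulate h) ∎
    where
    open ≡-Reasoning
    zs = List.tabulate (h ∘ suc) ++ ys
    avoid : ∀ {T} → T ∈ choose (suc k) zs → g T ≡ 0#
    avoid {T} T∈ with i , p ← choose-meets (suc k) (List.tabulate (h ∘ suc)) (s≤s (ℕ.≤-reflexive (length-tabulate (h ∘ suc)))) T∈ = g≡0 T i p

  -- Every index set other than the first k coordinates contains a zero row.
  detₖ-padded : ∀ k e (A : Matrix (k ℕ.+ e)) → (∀ i j → A (k ↑ʳ i) j ≡ 0#) →
                detₖ k A ≡ det (λ a b → A (a ↑ˡ e) (b ↑ˡ e))
  detₖ-padded k e A zero-rows = begin
    sumList (map g (choose k (allFin (k ℕ.+ e))))
      ≡⟨ cong (sumList ∘ map g ∘ choose k) (tabulate-++ k id) ⟩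
    sumList (map g (choose k (List.tabulate (_↑ˡ e) ++ List.tabulate (k ↑ʳ_))))
      ≡⟨ sum-choose k (_↑ˡ e) _ g vanish ⟩
    g (Vec.tabulate (_↑ˡ e))
      ≡⟨ det-cong (λ a b → cong₂ A (lookup∘tabulate (_↑ˡ e) a) (lookup∘tabulate (_↑ˡ e) b)) ⟩
    det (λ a b → A (a ↑ˡ e) (b ↑ˡ e)) ∎
    where
    open ≡-Reasoning
    g : Vec (Fin (k ℕ.+ e)) k → ℝ
    g T = det (λ a b → A (lookup T a) (lookup T b))
    vanish : ∀ T i → lookup T i ∈ List.tabulate (k ↑ʳ_) → g T ≡ 0#
    vanish T i p with r , eq ← ∈-tabulate⁻ p =
      det-zeroRow _ i (λ j → trans (cong (λ t → A t (lookup T j)) eq) (zero-rows r (lookup T j)))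

  -- On the first k coordinates the sum of outer products is X Xᵀ.
  detₖ-sumOuter : ∀ k e (S : Vec (Point (k ℕ.+ e)) k) → (∀ a j → lookup (lookup S a) (k ↑ʳ j) ≡ 0#) →
                  let X = λ i a → lookup (lookup S a) (i ↑ˡ e) in
                  detₖ k (sumOuter S) ≡ det X * det X
  detₖ-sumOuter k e S padded = trans
    (detₖ-padded k e (sumOuter S) (λ i j → sum-zero {f = λ a → lookup (lookup S a) (k ↑ʳ i) * lookup (lookup S a) j}
      (λ a → trans (cong (_* lookup (lookup S a) j) (padded a i)) (zeroˡ _))))
    (trans (det-cong (λ r i → sum-cong-≗ (λ a → *-comm (X r a) (X i a)))) (det-*ᵀ X X))
    where
    X : Matrix k
    X i a = lookup (lookup S a) (i ↑ˡ e)

  detₖ-cong : ∀ {d} k {A B : Matrix d} → (∀ i j → A i j ≡ B i j) → detₖ k A ≡ detₖ k B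
  detₖ-cong {d} k A≗B = cong sumList (map-cong (λ T → det-cong (λ a b → A≗B (lookup T a) (lookup T b))) (choose k (allFin d)))

  sum-lookup : ∀ {A : Set} {k} (f : A → ℝ) (S : Vec A k) → sum (f ∘ lookup S) ≡ sumList (map f (toList S))
  sum-lookup f []      = refl
  sum-lookup f (x ∷ S) = cong (f x +_) (sum-lookup f S)

  sumList-↭ : ∀ {xs ys} → xs ↭ ys → sumList xs ≡ sumList ys
  sumList-↭ = ↭ₛ.foldr-commMonoid (setoid ℝ) (CommutativeRing.+-isCommutativeMonoid commutativeRing) ∘ ↭⇒↭ₛ

  sumOuter-↭ : ∀ {d k} {S T : Vec (Point d) k} → toList S ↭ toList T → ∀ i j → sumOuter S i j ≡ sumOuter T i j
  sumOuter-↭ {d} {S = S} {T} S↭T i j = trans (sum-lookup f S) (trans (sumList-↭ (↭.map⁺ f S↭T)) (sym (sum-lookup f T)))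
    where
    f : Point d → ℝ
    f v = lookup v i * lookup v j

  detₖ≤objective : ∀ {d} k {V : FinSet d} (S : Vec (Point d) k) → Unique (toList S) → toList S ⊆ V →
                   detₖ k (sumOuter S) ≤ objective k V
  detₖ≤objective k {V} S unique S⊆V
    with T , T∈ , T↭S ← choose-complete _≟ₚ_ k (distinct V) (length-toList S) unique (∈-deduplicate⁺ _≟ₚ_ ∘ S⊆V)
    = subst (_≤ objective k V) (detₖ-cong k (sumOuter-↭ {S = T} {S} T↭S))
        (∈⇒≤maximum (∈-map⁺ (λ U → detₖ k (sumOuter U)) T∈))

  objective≤ : ∀ {d} k {V : FinSet d} {B} → 0# ≤ B →
               (∀ S → Unique (toList S) → toList S ⊆ V → detₖ k (sumOuter S) ≤ B) → objective k V ≤ B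
  objective≤ k {V} {B} 0≤B ub = maximum≤ _ 0≤B λ x∈ → bound (∈-map⁻ (λ U → detₖ k (sumOuter U)) x∈)
    where
    bound : ∀ {x} → (∃[ S ] S ∈ choose k (distinct V) × x ≡ detₖ k (sumOuter S)) → x ≤ B
    bound (S , S∈ , refl) = ub S (choose-unique k (deduplicate-! _≟ₚ_ V) S∈)
      (∈-deduplicate⁻ _≟ₚ_ V ∘ ∈-choose k (distinct V) S∈)

  objective-mono : ∀ {d} k {V W : FinSet d} → 0# ≤ objective k V → W ⊆ V → objective k W ≤ objective k V
  objective-mono k 0≤ W⊆V = objective≤ k 0≤ (λ S unique S⊆W → detₖ≤objective k S unique (W⊆V ∘ S⊆W))

  -- Determinants of columns at separated scales

  infix 4 ∣_∣≤_
  -- Two one-sided bounds by a natural number, so that the bookkeeping of estimates takes place in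
  -- ℕ.
  record ∣_∣≤_ (x : ℝ) (B : ℕ) : Set where
    constructor bounds
    field
      upper : x ≤ fromℕ B
      lower : - x ≤ fromℕ B

  ∣∣≤-mono : ∀ {x A B} → A ℕ.≤ B → ∣ x ∣≤ A → ∣ x ∣≤ B
  ∣∣≤-mono A≤B (bounds p q) = bounds (≤-trans p (fromℕ-mono A≤B)) (≤-trans q (fromℕ-mono A≤B))

  ∣0∣≤ : ∀ {x} B → x ≡ 0# → ∣ x ∣≤ B
  ∣0∣≤ B refl = bounds (0≤fromℕ B) (subst (_≤ fromℕ B) (sym -0#≈0#) (0≤fromℕ B))

  ∣+∣≤ : ∀ {x y A B} → ∣ x ∣≤ A → ∣ y ∣≤ B → ∣ x + y ∣≤ A ℕ.+ B
  ∣+∣≤ {x} {y} {A} {B} (bounds p q) (bounds p′ q′) = bounds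
    (subst (x + y ≤_) (sym (fromℕ-+ A B)) (+-mono-≤ p p′))
    (subst₂ _≤_ (-‿+-comm x y) (sym (fromℕ-+ A B)) (+-mono-≤ q q′))

  ∣sum∣≤ : ∀ {n} {f : Fin n → ℝ} {B} → (∀ i → ∣ f i ∣≤ B) → ∣ sum f ∣≤ n ℕ.* B
  ∣sum∣≤ {zero}  f≤B = ∣0∣≤ 0 refl
  ∣sum∣≤ {suc n} f≤B = ∣+∣≤ (f≤B zero) (∣sum∣≤ (f≤B ∘ suc))

  ∣-∣≤ : ∀ {x B} → ∣ x ∣≤ B → ∣ - x ∣≤ B
  ∣-∣≤ {x} {B} (bounds p q) = bounds q (subst (_≤ fromℕ B) (sym (-‿involutive x)) p)

  ∣sign*∣≤ : ∀ {x B} k → ∣ x ∣≤ B → ∣ (- 1#) ^ k * x ∣≤ B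
  ∣sign*∣≤ {x} {B} zero    p = subst (∣_∣≤ B) (sym (*-identityˡ x)) p
  ∣sign*∣≤ {x} {B} (suc k) p = subst (∣_∣≤ B)
    (sym (trans (*-assoc (- 1#) _ x) (-1*x≈-x _))) (∣-∣≤ (∣sign*∣≤ k p))

  ∣fromℕ*∣≤ : ∀ {x B} m → ∣ x ∣≤ B → ∣ fromℕ m * x ∣≤ m ℕ.* B
  ∣fromℕ*∣≤ {x} {B} m (bounds p q) = bounds
    (subst (fromℕ m * x ≤_) (sym (fromℕ-* m B)) (*-monoʳ-≤ (0≤fromℕ m) p))
    (subst₂ _≤_ (sym (-‿distribʳ-* (fromℕ m) x)) (sym (fromℕ-* m B)) (*-monoʳ-≤ (0≤fromℕ m) q))

  ∣∣≤-cancel : ∀ {M x B} → 1 ℕ.≤ M → ∣ fromℕ M * x ∣≤ M ℕ.* B → ∣ x ∣≤ B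
  ∣∣≤-cancel {M} {x} {B} 1≤M (bounds p q) = bounds
    (*-cancelʳ-≤ (0<fromℕ 1≤M) (subst₂ _≤_ (*-comm (fromℕ M) x) (trans (fromℕ-* M B) (*-comm (fromℕ M) (fromℕ B))) p))
    (*-cancelʳ-≤ (0<fromℕ 1≤M) (subst₂ _≤_ (trans (-‿distribʳ-* (fromℕ M) x) (*-comm (fromℕ M) (- x)))
      (trans (fromℕ-* M B) (*-comm (fromℕ M) (fromℕ B))) q))

  ∣term∣≤ : ∀ {x B} k m → ∣ x ∣≤ B → ∣ (- 1#) ^ k * fromℕ m * x ∣≤ m ℕ.* B
  ∣term∣≤ {x} {B} k m p = subst (∣_∣≤ m ℕ.* B) (sym (*-assoc _ (fromℕ m) x)) (∣sign*∣≤ k (∣fromℕ*∣≤ m p))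

  detℕ : ∀ {r} → (Fin r → Fin r → ℕ) → ℝ
  detℕ Y = det (λ i a → fromℕ (Y i a))

  minorℕ : ∀ {r} → (Fin (suc r) → Fin (suc r) → ℕ) → Fin (suc r) → Fin r → Fin r → ℕ
  minorℕ Y j i a = Y (suc i) (punchIn j a)

  -- The columns of Y carry types: a column of type j has size M^j, and vanishes in the
  -- rows l + i < j.  As M dominates the number of terms in the Laplace expansion, only the
  -- expansions using each type once, in its own row, contribute to the leading order.
  module ScaledColumns (M n : ℕ) (1≤M : 1 ℕ.≤ M) (g : ℕ → ℕ) (g≤n : ∀ j → g j ℕ.≤ n) where

    crude : ℕ → ℕ
    crude = crudeBound n

    scale : ℕ → ℕ → ℕ
    scale = ∏ℕ (M ℕ.^_)

    -- `l` counts the rows already expanded: row `i` of `Y` is row `l + i` of the original matrix,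
    -- and types refer to original rows.
    record Typed {r} (l : ℕ) (Y : Fin r → Fin r → ℕ) (τ : Fin r → ℕ) : Set where
      field
        vanishes : ∀ i a → l ℕ.+ toℕ i ℕ.< τ a → Y i a ≡ 0
        entry    : ∀ i a → Y i a ℕ.≤ M ℕ.^ τ a ℕ.* n
        diagonal : ∀ i a → τ a ≡ l ℕ.+ toℕ i → Y i a ℕ.≤ M ℕ.^ τ a ℕ.* g (τ a)

    minor-typed : ∀ {r l} {Y : Fin (suc r) → Fin (suc r) → ℕ} {τ} → Typed l Y τ → ∀ j →
                  Typed (suc l) (minorℕ Y j) (τ ∘ punchIn j)
    minor-typed {l = l} {τ = τ} typed j = record
      { vanishes = λ i a lt → vanishes (suc i) (punchIn j a) (subst (ℕ._< τ (punchIn j a)) (sym (ℕ.+-suc l (toℕ i))) lt)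
      ; entry    = λ i a → entry (suc i) (punchIn j a)
      ; diagonal = λ i a eq → diagonal (suc i) (punchIn j a) (trans eq (sym (ℕ.+-suc l (toℕ i))))
      }
      where open Typed typed

    module _ {r l} {Y : Fin (suc r) → Fin (suc r) → ℕ} {τ} (typed : Typed l Y τ) where
      open Typed typed

      first-row-zero : ∀ {j} → l ℕ.< τ j → Y zero j ≡ 0
      first-row-zero {j} lt = vanishes zero j (subst (ℕ._< τ j) (sym (ℕ.+-identityʳ l)) lt)

      first-row-diagonal : ∀ {j} → τ j ≡ l → Y zero j ℕ.≤ M ℕ.^ l ℕ.* g l
      first-row-diagonal {j} refl = diagonal zero j (sym (ℕ.+-identityʳ l))

      -- Types above `l` vanish in this row, and the others have scale at most M^l.
      first-row-entry : ∀ j → Y zero j ℕ.≤ M ℕ.^ l ℕ.* n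
      first-row-entry j with τ j ℕ.≤? l
      ... | yes τ≤l = ℕ.≤-trans (entry zero j) (ℕ.*-monoˡ-≤ n (ℕ.^-monoʳ-≤ M {{ℕ.>-nonZero 1≤M}} τ≤l))
      ... | no τ≰l  = subst (ℕ._≤ M ℕ.^ l ℕ.* n) (sym (first-row-zero (ℕ.≰⇒> τ≰l))) z≤n

      first-row-small : ∀ {j} → τ j ℕ.< l → M ℕ.* Y zero j ℕ.≤ M ℕ.^ l ℕ.* n
      first-row-small {j} τ<l = begin
        M ℕ.* Y zero j                ≤⟨ ℕ.*-monoʳ-≤ M (entry zero j) ⟩
        M ℕ.* (M ℕ.^ τ j ℕ.* n)       ≡⟨ ℕ.*-assoc M _ n ⟨
        M ℕ.^ suc (τ j) ℕ.* n         ≤⟨ ℕ.*-monoˡ-≤ n (ℕ.^-monoʳ-≤ M {{ℕ.>-nonZero 1≤M}} τ<l) ⟩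
        M ℕ.^ l ℕ.* n                 ∎
        where open ℕ.≤-Reasoning

      laplaceTerm : Fin (suc r) → ℝ
      laplaceTerm j = (- 1#) ^ toℕ j * fromℕ (Y zero j) * detℕ (minorℕ Y j)

      term-zero : ∀ {j} → Y zero j ≡ 0 → laplaceTerm j ≡ 0#
      term-zero {j} eq = trans (cong (λ z → (- 1#) ^ toℕ j * fromℕ z * detℕ (minorℕ Y j)) eq)
        (trans (cong (_* detℕ (minorℕ Y j)) (zeroʳ _)) (zeroˡ _))

      M*term : ∀ {j B} → ∣ fromℕ M * detℕ (minorℕ Y j) ∣≤ B → ∣ fromℕ M * laplaceTerm j ∣≤ Y zero j ℕ.* B
      M*term {j} {B} p = subst (∣_∣≤ Y zero j ℕ.* B) (*-swap _ (fromℕ M) _) (∣term∣≤ (toℕ j) (Y zero j) p)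

      M*term′ : ∀ {j B} → ∣ detℕ (minorℕ Y j) ∣≤ B → ∣ fromℕ M * laplaceTerm j ∣≤ M ℕ.* Y zero j ℕ.* B
      M*term′ {j} {B} p = subst (∣ fromℕ M * laplaceTerm j ∣≤_) (sym (ℕ.*-assoc M _ B))
        (∣fromℕ*∣≤ M (∣term∣≤ (toℕ j) (Y zero j) p))

      ∣M*det∣≤ : ∀ {B} → (∀ j → ∣ fromℕ M * laplaceTerm j ∣≤ B) → ∣ fromℕ M * detℕ Y ∣≤ suc r ℕ.* B
      ∣M*det∣≤ {B} p = subst (∣_∣≤ suc r ℕ.* B) (sym (*-distribˡ-sum (fromℕ M) laplaceTerm)) (∣sum∣≤ p)

    crude-suc : ∀ r m c s → suc r ℕ.* (m ℕ.* n ℕ.* (c ℕ.* s)) ≡ suc r ℕ.* (n ℕ.* c) ℕ.* (m ℕ.* s)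
    crude-suc r m c s = lemma (suc r) m n c s
      where
      lemma : ∀ r m n c s → r ℕ.* (m ℕ.* n ℕ.* (c ℕ.* s)) ≡ r ℕ.* (n ℕ.* c) ℕ.* (m ℕ.* s)
      lemma = solve-∀

    ∣det∣≤crude : ∀ {r l} {Y : Fin r → Fin r → ℕ} {τ} → Typed l Y τ → ∣ detℕ Y ∣≤ crude r ℕ.* scale l r
    ∣det∣≤crude {zero}  typed = bounds (≤-reflexive (sym fromℕ-1)) (≤-trans
      (subst (- 1# ≤_) -0#≈0# (-‿anti-≤ 0≤1)) (0≤fromℕ 1))
    ∣det∣≤crude {suc r} {l} {Y} typed = subst (∣ detℕ Y ∣≤_) (crude-suc r (M ℕ.^ l) (crude r) _)
      (∣sum∣≤ (λ j → ∣∣≤-mono (ℕ.*-monoˡ-≤ _ (first-row-entry typed j))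
        (∣term∣≤ (toℕ j) (Y zero j) (∣det∣≤crude (minor-typed typed j)))))

    -- A column whose own row has already been expanded costs a factor M: each Laplace term either
    -- uses a column of type below `l`, too small by M for its row, or leaves column `a` to a later
    -- row.
    ∣M*det∣≤crude : ∀ {r l} {Y : Fin r → Fin r → ℕ} {τ} → Typed l Y τ → ∀ a → τ a ℕ.< l →
                    ∣ fromℕ M * detℕ Y ∣≤ crude r ℕ.* scale l r
    ∣M*det∣≤crude {suc r} {l} {Y} {τ} typed a τa<l =
      subst (∣ fromℕ M * detℕ Y ∣≤_) (crude-suc r (M ℕ.^ l) (crude r) _) (∣M*det∣≤ typed term)
      where
      term : ∀ j → ∣ fromℕ M * laplaceTerm typed j ∣≤ M ℕ.^ l ℕ.* n ℕ.* (crude r ℕ.* scale (suc l) r)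
      term j with τ j ℕ.<? l
      ... | yes τj<l = ∣∣≤-mono (ℕ.*-monoˡ-≤ _ (first-row-small typed τj<l))
        (M*term′ typed (∣det∣≤crude (minor-typed typed j)))
      ... | no τj≮l with j ≟ᶠ a
      ...   | yes refl = contradiction τa<l τj≮l
      ...   | no j≢a  = ∣∣≤-mono (ℕ.*-monoˡ-≤ _ (first-row-entry typed j))
        (M*term typed (∣M*det∣≤crude (minor-typed typed j) (punchOut j≢a)
          (subst (λ b → τ b ℕ.< suc l) (sym (punchIn-punchOut j≢a)) (ℕ.m<n⇒m<1+n τa<l))))

    -- The columns of type `l` decide. Without one, the first row is zero. With two, every minor
    -- retains one that is now too late, and a factor M is lost. With exactly one, only its term
    -- survives; it contributes `g l`, and its minor is of the same kind.
    ∣M*det∣≤leading : ∀ {r l} {Y : Fin r → Fin r → ℕ} {τ} → Typed l Y τ → (∀ a → l ℕ.≤ τ a) →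
                      ∣ fromℕ M * detℕ Y ∣≤ (M ℕ.* ∏ℕ g l r ℕ.+ crude r) ℕ.* scale l r
    ∣M*det∣≤leading {zero} {Y = Y} typed _ = ∣∣≤-mono (ℕ.≤-trans (ℕ.m≤m+n _ 1) (ℕ.≤-reflexive (sym (ℕ.*-identityʳ _))))
      (∣fromℕ*∣≤ {B = 1} M (∣det∣≤crude {Y = Y} typed))
    ∣M*det∣≤leading {suc r} {l} {Y} {τ} typed l≤τ = cases
      where
      W = M ℕ.^ l ℕ.* scale (suc l) r
      G = ∏ℕ g (suc l) r
      off-type : ∀ {j} → τ j ≢ l → laplaceTerm typed j ≡ 0#
      off-type {j} τj≢l = term-zero typed (first-row-zero typed (ℕ.≤∧≢⇒< (l≤τ j) (τj≢l ∘ sym)))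
      repeated : ∀ {a b} → a ≢ b → τ a ≡ l → τ b ≡ l → ∀ j →
                 ∣ fromℕ M * laplaceTerm typed j ∣≤ M ℕ.^ l ℕ.* n ℕ.* (crude r ℕ.* scale (suc l) r)
      repeated {a} {b} a≢b τa τb j = ∣∣≤-mono (ℕ.*-monoˡ-≤ _ (first-row-entry typed j)) (M*term typed remaining)
        where
        via : ∀ {c} → j ≢ c → τ c ≡ l → ∣ fromℕ M * detℕ (minorℕ Y j) ∣≤ crude r ℕ.* scale (suc l) r
        via j≢c τc = ∣M*det∣≤crude (minor-typed typed j) (punchOut j≢c)
          (subst (λ d → τ d ℕ.< suc l) (sym (punchIn-punchOut j≢c)) (s≤s (ℕ.≤-reflexive τc)))
        remaining : ∣ fromℕ M * detℕ (minorℕ Y j) ∣≤ crude r ℕ.* scale (suc l) r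
        remaining with j ≟ᶠ a
        ... | no j≢a   = via j≢a τa
        ... | yes refl = via a≢b τb
      arithmetic : M ℕ.^ l ℕ.* g l ℕ.* ((M ℕ.* G ℕ.+ crude r) ℕ.* scale (suc l) r) ℕ.≤
                   (M ℕ.* (g l ℕ.* G) ℕ.+ crude (suc r)) ℕ.* W
      arithmetic = begin
        M ℕ.^ l ℕ.* g l ℕ.* ((M ℕ.* G ℕ.+ crude r) ℕ.* scale (suc l) r)
          ≡⟨ lemma (M ℕ.^ l) (g l) M G (crude r) (scale (suc l) r) ⟩
        (M ℕ.* (g l ℕ.* G) ℕ.+ g l ℕ.* crude r) ℕ.* W
          ≤⟨ ℕ.*-monoˡ-≤ W (ℕ.+-monoʳ-≤ (M ℕ.* (g l ℕ.* G))
               (ℕ.≤-trans (ℕ.*-monoˡ-≤ (crude r) (g≤n l)) (ℕ.m≤m+n _ _))) ⟩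
        (M ℕ.* (g l ℕ.* G) ℕ.+ crude (suc r)) ℕ.* W ∎
        where
        open ℕ.≤-Reasoning
        lemma : ∀ m g M G c s → m ℕ.* g ℕ.* ((M ℕ.* G ℕ.+ c) ℕ.* s) ≡ (M ℕ.* (g ℕ.* G) ℕ.+ g ℕ.* c) ℕ.* (m ℕ.* s)
        lemma = solve-∀
      cases : ∣ fromℕ M * detℕ Y ∣≤ (M ℕ.* (g l ℕ.* G) ℕ.+ crude (suc r)) ℕ.* W
      cases with any? (λ a → τ a ℕ.≟ l)
      ... | no none = ∣0∣≤ _ (trans (cong (fromℕ M *_) (sum-zero {f = laplaceTerm typed} (λ j → off-type (λ eq → none (j , eq))))) (zeroʳ _))
      ... | yes (a , τa) with any? (λ b → ¬? (a ≟ᶠ b) ×-dec τ b ℕ.≟ l)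
      ...   | yes (b , a≢b , τb) = ∣∣≤-mono
        (ℕ.≤-trans (ℕ.≤-reflexive (crude-suc r (M ℕ.^ l) (crude r) _)) (ℕ.*-monoˡ-≤ W (ℕ.m≤n+m (crude (suc r)) (M ℕ.* (g l ℕ.* G)))))
        (∣M*det∣≤ typed (repeated a≢b τa τb))
      ...   | no unique = ∣∣≤-mono (ℕ.≤-trans (ℕ.*-monoˡ-≤ _ (first-row-diagonal typed τa)) arithmetic)
        (subst (λ z → ∣ fromℕ M * z ∣≤ Y zero a ℕ.* ((M ℕ.* G ℕ.+ crude r) ℕ.* scale (suc l) r))
          (sym (sum-single {f = laplaceTerm typed} a (λ j j≢a → off-type (λ τj → unique (j , j≢a ∘ sym , τj)))))
          (M*term typed (∣M*det∣≤leading (minor-typed typed a)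
            (λ c → ℕ.≤∧≢⇒< (l≤τ (punchIn a c)) (λ eq → unique (punchIn a c , punchInᵢ≢i a c ∘ sym , sym eq))))))

  sumℝ-↑ : ∀ m {n} (f : Fin (m ℕ.+ n) → ℝ) → sum f ≡ sum (f ∘ (_↑ˡ n)) + sum (f ∘ (m ↑ʳ_))
  sumℝ-↑ = sum-↑ (Semiring.+-monoid semiring)

  product-cong : ∀ {n} {f g : Fin n → ℝ} → (∀ i → f i ≡ g i) → product f ≡ product g
  product-cong {zero}  f≗g = refl
  product-cong {suc n} f≗g = cong₂ _*_ (f≗g zero) (product-cong (f≗g ∘ suc))

  product-∏ℕ : ∀ (f : ℕ → ℕ) l r → product {r} (λ i → fromℕ (f (l ℕ.+ toℕ i))) ≡ fromℕ (∏ℕ f l r)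
  product-∏ℕ f l zero    = sym fromℕ-1
  product-∏ℕ f l (suc r) = trans (cong₂ _*_ (cong (fromℕ ∘ f) (ℕ.+-identityʳ l))
    (trans (product-cong {r} (λ i → cong (fromℕ ∘ f) (ℕ.+-suc l (toℕ i)))) (product-∏ℕ f (suc l) r)))
    (sym (fromℕ-* (f l) _))

  ∣x∣≤B⇒x²≤B² : ∀ {x B} → ∣ x ∣≤ B → x * x ≤ fromℕ B * fromℕ B
  ∣x∣≤B⇒x²≤B² {x} {B} (bounds p q) with ≤-total 0# x
  ... | inj₁ 0≤x = *-mono-≤ 0≤x (0≤fromℕ B) p p
  ... | inj₂ x≤0 = subst (_≤ fromℕ B * fromℕ B)
    (trans (sym (-‿distribˡ-* x (- x))) (trans (cong -_ (sym (-‿distribʳ-* x x))) (-‿involutive (x * x))))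
    (*-mono-≤ (subst (_≤ - x) -0#≈0# (-‿anti-≤ x≤0)) (0≤fromℕ B) q q)

  -- Padding to larger dimensions and the trivial bound α ≥ 1

  module Padding (k e : ℕ) where

    pad : (Fin k → ℝ) → Point (k ℕ.+ e)
    pad f = Vec.tabulate (f ⊕ (λ (_ : Fin e) → 0#))

    lookup-pad : ∀ f p → lookup (pad f) (p ↑ˡ e) ≡ f p
    lookup-pad f p = trans (lookup∘tabulate (f ⊕ (λ (_ : Fin e) → 0#)) (p ↑ˡ e)) (lookup-++ˡ f (λ (_ : Fin e) → 0#) p)

    lookup-pad-zero : ∀ f j → lookup (pad f) (k ↑ʳ j) ≡ 0#
    lookup-pad-zero f j = trans (lookup∘tabulate (f ⊕ (λ (_ : Fin e) → 0#)) (k ↑ʳ j)) (lookup-++ʳ f (λ (_ : Fin e) → 0#) j)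

    pad-cong : ∀ {f g} → (∀ p → f p ≡ g p) → pad f ≡ pad g
    pad-cong {f} {g} f≗g = tabulate-cong padded
      where
      padded : ∀ i → (f ⊕ (λ (_ : Fin e) → 0#)) i ≡ (g ⊕ (λ _ → 0#)) i
      padded i with splitAt k i
      ... | inj₁ p = f≗g p
      ... | inj₂ _ = refl

    pad-injective : ∀ {f g} → pad f ≡ pad g → ∀ p → f p ≡ g p
    pad-injective {f} {g} eq p = trans (sym (lookup-pad f p)) (trans (cong (λ x → lookup x (p ↑ˡ e)) eq) (lookup-pad g p))

    detₖ-pad : (S : Vec (Point (k ℕ.+ e)) k) (X : Matrix k) →
               (∀ a p → lookup (lookup S a) (p ↑ˡ e) ≡ X p a) →
               (∀ a j → lookup (lookup S a) (k ↑ʳ j) ≡ 0#) → detₖ k (sumOuter S) ≡ det X * det X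
    detₖ-pad S X top padded = trans (detₖ-sumOuter k e S padded)
      (cong₂ _*_ (det-cong (λ p a → top a p)) (det-cong (λ p a → top a p)))

    detₖ-tabulate : (X : Matrix k) → detₖ k (sumOuter (Vec.tabulate (λ a → pad (λ p → X p a)))) ≡ det X * det X
    detₖ-tabulate X = detₖ-pad (Vec.tabulate col) X
      (λ a p → trans (cong (λ x → lookup x (p ↑ˡ e)) (lookup∘tabulate col a)) (lookup-pad (λ p → X p a) p))
      (λ a j → trans (cong (λ x → lookup x (k ↑ʳ j)) (lookup∘tabulate col a)) (lookup-pad-zero (λ p → X p a) j))
      where
      col : Fin k → Point (k ℕ.+ e)
      col a = pad (λ p → X p a)

  -- One party suffices, since a subset cannot have a larger objective. This settles degenerate
  -- parameters and bases k/β below 1.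
  positive-objective⇒1≤factor : ∀ {d k α t c} → IsComposableCoreSet {d} k α t c → ∀ V → 0# < objective k V → 1# ≤ α
  positive-objective⇒1≤factor {d} {k} {α} {t} {c} core V 0<f = *-cancelʳ-≤ 0<f (begin
    1# * objective k V                 ≡⟨ *-identityˡ _ ⟩
    objective k V                      ≡⟨ x/y*y≡x (objective k V) α-positive ⟨
    objective k V / α * α              ≤⟨ *-monoˡ-≤ (proj₁ α-positive) shrink ⟩
    objective k V * α                  ≡⟨ *-comm _ α ⟩
    α * objective k V                  ∎)
    where
    open IsComposableCoreSet core
    open ≤-Reasoning
    shrink : objective k V / α ≤ objective k V
    shrink = begin
      objective k V / α                   ≡⟨ trans (cong (_* objective k V) (*-identityˡ (α ⁻¹))) (*-comm (α ⁻¹) _) ⟨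
      1# / α * objective k V              ≡⟨ cong (λ W → 1# / α * objective k W) (++-identityʳ V) ⟨
      1# / α * objective k (V ++ [])      ≤⟨ approximate (V ∷ []) ⟩
      objective k (c V ++ [])             ≡⟨ cong (objective k) (++-identityʳ (c V)) ⟩
      objective k (c V)                   ≤⟨ objective-mono k (proj₁ 0<f) (subset V) ⟩
      objective k V                       ∎

  orthonormal-objective : ∀ k e → ∃[ V ] 0# < objective {k ℕ.+ e} k V
  orthonormal-objective k e = toList S , <-≤-trans 0<1 (subst (_≤ objective k (toList S)) det≡1
    (detₖ≤objective k S (subst Unique (sym (toList-tabulate col)) (tabulate⁺ col-injective)) id))
    where
    open Padding k e
    col : Fin k → Point (k ℕ.+ e)
    col a = pad (λ p → κℝ p a)
    S = Vec.tabulate col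
    detκ : det {k} κℝ ≡ 1#
    detκ = det-unitUpperTriangular {k} κℝ κℝ-refl (λ i j lt → κℝ-≢ (<⇒≢ lt ∘ sym))
    det≡1 : detₖ k (sumOuter S) ≡ 1#
    det≡1 = trans (detₖ-tabulate κℝ) (trans (cong₂ _*_ detκ detκ) (*-identityˡ 1#))
    col-injective : ∀ {a b} → col a ≡ col b → a ≡ b
    col-injective {a} {b} eq with a ≟ᶠ b
    ... | yes a≡b = a≡b
    ... | no a≢b  = contradiction (trans (sym (κℝ-≢ a≢b)) (trans (sym (pad-injective eq a)) (κℝ-refl a))) 0≢1

  -- The adversarial point sets

  -- The inverse of the coordinate change y_l = x_l + ⟨v_l, z⟩: it turns vectors of natural numbers
  -- into the actual points, by a unit triangular matrix.
  module Shear {q n : ℕ} (m : ℕ) (v : ℕ → Word q n) where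
    s = n ℕ.* q
    k = m ℕ.+ s

    topRows : Fin m → Fin k → ℝ
    topRows l = κℝ l ⊕ (λ r → - fromℕ (encode (v (toℕ l)) r))

    bottomRows : Fin s → Fin k → ℝ
    bottomRows r = (λ (_ : Fin m) → 0#) ⊕ κℝ r

    shearMatrix : Matrix k
    shearMatrix = topRows ⊕ bottomRows

    shear : (Fin k → ℕ) → Fin k → ℝ
    shear y p = sum (λ i → shearMatrix p i * fromℕ (y i))

    ⟨v_,_⟩ : Fin m → (Fin k → ℕ) → ℕ
    ⟨v l , y ⟩ = ℕΣ.sum (λ r → encode (v (toℕ l)) r ℕ.* y (m ↑ʳ r))

    top-row : ∀ l i → shearMatrix (l ↑ˡ s) i ≡ topRows l i
    top-row l i = cong (λ (f : Fin k → ℝ) → f i) (lookup-++ˡ topRows bottomRows l)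

    bottom-row : ∀ r i → shearMatrix (m ↑ʳ r) i ≡ bottomRows r i
    bottom-row r i = cong (λ (f : Fin k → ℝ) → f i) (lookup-++ʳ topRows bottomRows r)

    shear-top : ∀ y l → shear y (l ↑ˡ s) ≡ fromℕ (y (l ↑ˡ s)) - fromℕ ⟨v l , y ⟩
    shear-top y l = trans (sumℝ-↑ m _) (cong₂ _+_
      (trans (sum-cong-≗ (λ i → cong (_* fromℕ (y (i ↑ˡ s)))
               (trans (top-row l (i ↑ˡ s)) (lookup-++ˡ (κℝ l) _ i))))
        (sum-κℝ (λ i → fromℕ (y (i ↑ˡ s))) l))
      (begin
        sum (λ r → shearMatrix (l ↑ˡ s) (m ↑ʳ r) * fromℕ (y (m ↑ʳ r)))
          ≡⟨ sum-cong-≗ entry ⟩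
        sum (λ r → (- 1#) * fromℕ (encode (v (toℕ l)) r ℕ.* y (m ↑ʳ r)))
          ≡⟨ *-distribˡ-sum (- 1#) (λ r → fromℕ (encode (v (toℕ l)) r ℕ.* y (m ↑ʳ r))) ⟨
        (- 1#) * sum (λ r → fromℕ (encode (v (toℕ l)) r ℕ.* y (m ↑ʳ r)))
          ≡⟨ -1*x≈-x _ ⟩
        - sum (λ r → fromℕ (encode (v (toℕ l)) r ℕ.* y (m ↑ʳ r)))
          ≡⟨ cong -_ (fromℕ-sum (λ r → encode (v (toℕ l)) r ℕ.* y (m ↑ʳ r))) ⟨
        - fromℕ ⟨v l , y ⟩ ∎))
      where
      open ≡-Reasoning
      entry : ∀ r → shearMatrix (l ↑ˡ s) (m ↑ʳ r) * fromℕ (y (m ↑ʳ r)) ≡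
                    (- 1#) * fromℕ (encode (v (toℕ l)) r ℕ.* y (m ↑ʳ r))
      entry r = begin
        shearMatrix (l ↑ˡ s) (m ↑ʳ r) * fromℕ (y (m ↑ʳ r))
          ≡⟨ cong (_* fromℕ (y (m ↑ʳ r))) (trans (top-row l (m ↑ʳ r)) (lookup-++ʳ (κℝ l) _ r)) ⟩
        - fromℕ (encode (v (toℕ l)) r) * fromℕ (y (m ↑ʳ r))
          ≡⟨ -‿distribˡ-* _ _ ⟨
        - (fromℕ (encode (v (toℕ l)) r) * fromℕ (y (m ↑ʳ r)))
          ≡⟨ cong -_ (fromℕ-* (encode (v (toℕ l)) r) (y (m ↑ʳ r))) ⟨
        - fromℕ (encode (v (toℕ l)) r ℕ.* y (m ↑ʳ r))
          ≡⟨ -1*x≈-x _ ⟨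
        (- 1#) * fromℕ (encode (v (toℕ l)) r ℕ.* y (m ↑ʳ r)) ∎

    shear-bottom : ∀ y r → shear y (m ↑ʳ r) ≡ fromℕ (y (m ↑ʳ r))
    shear-bottom y r = trans (sumℝ-↑ m _) (trans (cong₂ _+_
      (sum-zero (λ i → trans (cong (_* fromℕ (y (i ↑ˡ s)))
        (trans (bottom-row r (i ↑ˡ s)) (lookup-++ˡ (λ (_ : Fin m) → 0#) (κℝ r) i))) (zeroˡ _)))
      (trans (sum-cong-≗ (λ i → cong (_* fromℕ (y (m ↑ʳ i)))
               (trans (bottom-row r (m ↑ʳ i)) (lookup-++ʳ (λ (_ : Fin m) → 0#) (κℝ r) i))))
        (sum-κℝ (λ i → fromℕ (y (m ↑ʳ i))) r)))
      (+-identityˡ _))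

    -- The bottom block is unchanged, so it determines the inner products subtracted in the top
    -- block. This keeps the points of the optimal selection distinct.
    shear-injective : ∀ {y y′} → (∀ p → shear y p ≡ shear y′ p) → ∀ p → y p ≡ y′ p
    shear-injective {y} {y′} eq p with split m p
    ... | right r = bottom r
      where
      bottom : ∀ r → y (m ↑ʳ r) ≡ y′ (m ↑ʳ r)
      bottom r = fromℕ-injective (trans (sym (shear-bottom y r)) (trans (eq (m ↑ʳ r)) (shear-bottom y′ r)))
    ... | left l = fromℕ-injective (begin
      fromℕ (y (l ↑ˡ s))
        ≡⟨ x-y+y≡x _ (fromℕ ⟨v l , y ⟩) ⟨
      fromℕ (y (l ↑ˡ s)) - fromℕ ⟨v l , y ⟩ + fromℕ ⟨v l , y ⟩
        ≡⟨ cong₂ (λ a b → a + fromℕ b) (trans (sym (shear-top y l)) (trans (eq (l ↑ˡ s)) (shear-top y′ l)))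
             (ℕΣ.sum-cong-≗ (λ r → cong (encode (v (toℕ l)) r ℕ.*_) (bottom r))) ⟩
      fromℕ (y′ (l ↑ˡ s)) - fromℕ ⟨v l , y′ ⟩ + fromℕ ⟨v l , y′ ⟩
        ≡⟨ x-y+y≡x _ (fromℕ ⟨v l , y′ ⟩) ⟩
      fromℕ (y′ (l ↑ˡ s)) ∎)
      where
      open ≡-Reasoning
      bottom : ∀ r → y (m ↑ʳ r) ≡ y′ (m ↑ʳ r)
      bottom r = fromℕ-injective (trans (sym (shear-bottom y r)) (trans (eq (m ↑ʳ r)) (shear-bottom y′ r)))

    det-shearMatrix : det shearMatrix ≡ 1#
    det-shearMatrix = det-unitUpperTriangular shearMatrix diagonal upper
      where
      diagonal : ∀ i → shearMatrix i i ≡ 1#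
      diagonal i with split m i
      ... | left l  = trans (top-row l (l ↑ˡ s)) (trans (lookup-++ˡ (κℝ l) _ l) (κℝ-refl l))
      ... | right r = trans (bottom-row r (m ↑ʳ r)) (trans (lookup-++ʳ (λ (_ : Fin m) → 0#) (κℝ r) r) (κℝ-refl r))
      upper : ∀ i j → toℕ i ℕ.< toℕ j → shearMatrix j i ≡ 0#
      upper i j i<j with split m j | split m i
      ... | left l  | left l′ = trans (top-row l (l′ ↑ˡ s)) (trans (lookup-++ˡ (κℝ l) _ l′)
        (κℝ-≢ λ l≡l′ → ℕ.<-irrefl (cong (toℕ ∘ (_↑ˡ s)) (sym l≡l′)) i<j))
      ... | right r | left l  = trans (bottom-row r (l ↑ˡ s)) (lookup-++ˡ (λ (_ : Fin m) → 0#) (κℝ r) l)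
      ... | right r | right r′ = trans (bottom-row r (m ↑ʳ r′)) (trans (lookup-++ʳ (λ (_ : Fin m) → 0#) (κℝ r) r′)
        (κℝ-≢ λ r≡r′ → ℕ.<-irrefl (cong (toℕ ∘ (m ↑ʳ_)) (sym r≡r′)) i<j))
      ... | left l  | right r = contradiction i<j (ℕ.≤⇒≯ (ℕ.≤-trans
        (ℕ.≤-reflexive (toℕ-↑ˡ l s)) (ℕ.≤-trans (ℕ.<⇒≤ (toℕ<n l)) (subst (m ℕ.≤_) (sym (toℕ-↑ʳ m r)) (ℕ.m≤m+n m (toℕ r))))))

    det-shear : (Y : Fin k → Fin k → ℕ) → det (λ p a → shear (λ i → Y i a) p) ≡ detℕ Y
    det-shear Y = trans (det-* shearMatrix (λ i a → fromℕ (Y i a)))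
      (trans (cong (_* detℕ Y) det-shearMatrix) (*-identityˡ _))

  module Adversary {n a t : ℕ} (m e : ℕ) (1≤n : 1 ℕ.≤ n) (1≤m : 1 ℕ.≤ m) (1≤a : 1 ℕ.≤ a) (a≤n : a ℕ.≤ n)
    (code : Code (2 ℕ.* n) n a (suc t)) where

    q = 2 ℕ.* n
    s = n ℕ.* q
    k = m ℕ.+ s
    d = k ℕ.+ e

    open Code code renaming (words to codewords; unique to codewords-unique)
    open Padding k e

    -- The error term `crude k` then equals M itself, and after division by M counts as a single
    -- unit beside the product of the gains.
    M : ℕ
    M = crudeBound n k

    1≤M : 1 ℕ.≤ M
    1≤M = positive k
      where
      positive : ∀ r → 1 ℕ.≤ crudeBound n r
      positive zero    = ℕ.≤-refl
      positive (suc r) = ℕ.*-mono-≤ {1} (s≤s (z≤n {r})) (ℕ.*-mono-≤ 1≤n (positive r))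

    1≤M^ : ∀ j → 1 ℕ.≤ M ℕ.^ j
    1≤M^ j = ℕ.m^n>0 M {{ℕ.>-nonZero 1≤M}} j

    -- The y- and z-coordinates of `wordVector`. They involve the words v l with l ≥ j, still
    -- unknown when party j is formed, and so occur in the analysis only.
    wordRow : (ℕ → Word q n) → ℕ → Word q n → Fin k → ℕ
    wordRow v j u = (λ l → select (toℕ l) j 0 (M ℕ.^ j ℕ.* agreement (v (toℕ l)) u)) ⊕ (λ r → M ℕ.^ j ℕ.* encode u r)

    -- The shear of wordRow v j u, written so that only the words v l with l < j occur.
    wordVector : (ℕ → Word q n) → ℕ → Word q n → Fin k → ℝ
    wordVector v j u = (λ l → select (toℕ l) j (- fromℕ (M ℕ.^ j ℕ.* agreement (v (toℕ l)) u)) 0#)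
      ⊕ (λ r → fromℕ (M ℕ.^ j ℕ.* encode u r))

    unitRow : Fin s → Fin k → ℕ
    unitRow b = (λ _ → 0) ⊕ (λ r → M ℕ.^ (m ℕ.+ toℕ b) ℕ.* κ b r)

    module _ (v : ℕ → Word q n) (j : ℕ) (u : Word q n) where

      wordRow-top : ∀ l → wordRow v j u (l ↑ˡ s) ≡ select (toℕ l) j 0 (M ℕ.^ j ℕ.* agreement (v (toℕ l)) u)
      wordRow-top l = lookup-++ˡ _ _ l

      wordRow-bottom : ∀ r → wordRow v j u (m ↑ʳ r) ≡ M ℕ.^ j ℕ.* encode u r
      wordRow-bottom r = lookup-++ʳ {m = m} _ _ r

      wordVector-top : ∀ l → wordVector v j u (l ↑ˡ s) ≡ select (toℕ l) j (- fromℕ (M ℕ.^ j ℕ.* agreement (v (toℕ l)) u)) 0#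
      wordVector-top l = lookup-++ˡ _ _ l

      wordVector-bottom : ∀ r → wordVector v j u (m ↑ʳ r) ≡ fromℕ (M ℕ.^ j ℕ.* encode u r)
      wordVector-bottom r = lookup-++ʳ {m = m} _ _ r

      open Shear m v using (shear; shear-top; shear-bottom; ⟨v_,_⟩)

      ⟨v,wordRow⟩ : ∀ l → ⟨v l , wordRow v j u ⟩ ≡ M ℕ.^ j ℕ.* agreement (v (toℕ l)) u
      ⟨v,wordRow⟩ l = begin
        ℕΣ.sum (λ r → encode (v (toℕ l)) r ℕ.* wordRow v j u (m ↑ʳ r))
          ≡⟨ ℕΣ.sum-cong-≗ (λ r → trans (cong (encode (v (toℕ l)) r ℕ.*_) (wordRow-bottom r))
               (lemma (encode (v (toℕ l)) r) (M ℕ.^ j) (encode u r))) ⟩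
        ℕΣ.sum (λ r → M ℕ.^ j ℕ.* (encode (v (toℕ l)) r ℕ.* encode u r))
          ≡⟨ ℕΣ.*-distribˡ-sum (M ℕ.^ j) (λ r → encode (v (toℕ l)) r ℕ.* encode u r) ⟨
        M ℕ.^ j ℕ.* ℕΣ.sum (λ r → encode (v (toℕ l)) r ℕ.* encode u r)
          ≡⟨ cong (M ℕ.^ j ℕ.*_) (∑-encode (v (toℕ l)) u) ⟩
        M ℕ.^ j ℕ.* agreement (v (toℕ l)) u ∎
        where
        open ≡-Reasoning
        lemma : ∀ x y z → x ℕ.* (y ℕ.* z) ≡ y ℕ.* (x ℕ.* z)
        lemma = solve-∀

      shear-wordRow : ∀ p → wordVector v j u p ≡ shear (wordRow v j u) p
      shear-wordRow p with split m p
      ... | right r = trans (wordVector-bottom r) (sym (trans (shear-bottom (wordRow v j u) r) (cong fromℕ (wordRow-bottom r))))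
      ... | left l  = trans (wordVector-top l) (sym (trans (shear-top (wordRow v j u) l)
        (trans (cong₂ (λ x y → fromℕ x - fromℕ y) (wordRow-top l) (⟨v,wordRow⟩ l)) (cases (toℕ l ℕ.<? j)))))
        where
        x = M ℕ.^ j ℕ.* agreement (v (toℕ l)) u
        cases : _ → fromℕ (select (toℕ l) j 0 x) - fromℕ x ≡ select (toℕ l) j (- fromℕ x) 0#
        cases (yes l<j) = trans (cong (λ z → fromℕ z - fromℕ x) (select-< l<j)) (trans (+-identityˡ _) (sym (select-< l<j)))
        cases (no l≮j)  = trans (cong (λ z → fromℕ z - fromℕ x) (select-≥ (ℕ.≮⇒≥ l≮j)))
          (trans (-‿inverseʳ (fromℕ x)) (sym (select-≥ (ℕ.≮⇒≥ l≮j))))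

    wordSet : (ℕ → Word q n) → ℕ → FinSet d
    wordSet v j = map (pad ∘ wordVector v j) codewords

    unitVector : (ℕ → Word q n) → Fin s → Fin k → ℝ
    unitVector v b = Shear.shear m v (unitRow b)

    party : (ℕ → Word q n) → Fin k → FinSet d
    party v = (wordSet v ∘ toℕ) ⊕ (λ b → pad (unitVector v b) ∷ [])

    -- The z-coordinates determine the encoding, and equal encodings agree in n ≥ a positions. Thus
    -- a party has as many points as there are codewords.
    wordVector-injective : ∀ v j {u u′} → u ∈ codewords → u′ ∈ codewords →
                           (∀ p → wordVector v j u p ≡ wordVector v j u′ p) → u ≡ u′
    wordVector-injective v j {u} {u′} u∈ u′∈ eq with distance u∈ u′∈
    ... | inj₁ u≡u′ = u≡u′
    ... | inj₂ near = contradiction (ℕ.<-≤-trans (subst (ℕ._< a) agreement≡n near) a≤n) (ℕ.<-irrefl refl)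
      where
      encode≡ : ∀ r → encode u r ≡ encode u′ r
      encode≡ r = ℕ.*-cancelˡ-≡ (encode u r) (encode u′ r) (M ℕ.^ j) {{ℕ.>-nonZero (1≤M^ j)}} (fromℕ-injective
        (trans (sym (wordVector-bottom v j u r)) (trans (eq (m ↑ʳ r)) (wordVector-bottom v j u′ r))))
      agreement≡n : agreement u u′ ≡ n
      agreement≡n = trans (sym (∑-encode u u′)) (trans
        (ℕΣ.sum-cong-≗ (λ r → cong (ℕ._* encode u′ r) (encode≡ r))) (trans (∑-encode u′ u′) (agreement-refl u′)))

    module _ {α : ℝ} {c : FinSet d → FinSet d} (core : IsComposableCoreSet k α t c) where
      open IsComposableCoreSet core renaming (size to core-size)

      Dropped : (ℕ → Word q n) → ℕ → Word q n → Set
      Dropped v j u = u ∈ codewords × pad (wordVector v j u) ∉ c (wordSet v j)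

      -- The party has t + 1 distinct points, of which the core-set keeps at most t.
      some-dropped : ∀ v j → ∃ (Dropped v j)
      some-dropped v j with em (∃ (Dropped v j))
      ... | yes p = p
      ... | no none = contradiction (ℕ.≤-trans (ℕ.≤-reflexive (sym (trans (length-map _ codewords) size)))
        (ℕ.≤-trans (unique-⊆⇒length≤ _≟ₚ_ (distinct (c (wordSet v j)))
          (unique-map (λ x∈ y∈ eq → wordVector-injective v j x∈ y∈ (pad-injective eq)) codewords-unique)
          (∈-deduplicate⁺ _≟ₚ_ ∘ kept)) (core-size (wordSet v j)))) (ℕ.<-irrefl refl)
        where
        kept : wordSet v j ⊆ c (wordSet v j)
        kept {x} x∈ with em (x ∈ c (wordSet v j)) | ∈-map⁻ (pad ∘ wordVector v j) x∈
        ... | yes p | _ = p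
        ... | no x∉ | u , u∈ , refl = contradiction (u , u∈ , x∉) none

      -- Party j mentions v l for l < j only, so the two lists of points coincide, and with them
      -- their core-sets.
      dropped-local : ∀ {v v′ j u} → (∀ l → l ℕ.< j → v l ≡ v′ l) → Dropped v j u → Dropped v′ j u
      dropped-local {v} {v′} {j} {u} agree (u∈ , u∉) = u∈ ,
        subst₂ (λ x V → x ∉ (c V)) (pad-cong (same u)) (map-cong (λ w → pad-cong (same w)) codewords) u∉
        where
        same : ∀ w p → wordVector v j w p ≡ wordVector v′ j w p
        same w p with split m p
        ... | right r = trans (wordVector-bottom v j w r) (sym (wordVector-bottom v′ j w r))
        ... | left l  = trans (wordVector-top v j w l) (trans (cases (toℕ l ℕ.<? j)) (sym (wordVector-top v′ j w l)))
          where
          entry : (ℕ → Word q n) → ℝ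
          entry v = - fromℕ (M ℕ.^ j ℕ.* agreement (v (toℕ l)) w)
          cases : _ → select (toℕ l) j (entry v) 0# ≡ select (toℕ l) j (entry v′) 0#
          cases (yes l<j) = cong (λ z → select (toℕ l) j (- fromℕ (M ℕ.^ j ℕ.* agreement z w)) 0#) (agree (toℕ l) l<j)
          cases (no l≮j)  = trans (select-≥ (ℕ.≮⇒≥ l≮j)) (sym (select-≥ (ℕ.≮⇒≥ l≮j)))

      initial-word : Word q n
      initial-word with codewords | size
      ... | w ∷ _ | _ = w

      adversarial-choice : ∃[ v ] (∀ j → j ℕ.< m → Dropped v j (v j))
      adversarial-choice = adaptive-choice Dropped dropped-local some-dropped initial-word m

    -- The factor beside M^j that a column of type j contributes in its own row: for word parties n
    -- at the optimum and at most a - 1 on the core-sets, for unit vectors 1.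
    gain : ℕ → ℕ → ℕ
    gain b j = select j m b 1

    gain≤n : ∀ j → gain (a ℕ.∸ 1) j ℕ.≤ n
    gain≤n j with j ℕ.<? m
    ... | yes j<m = subst (ℕ._≤ n) (sym (select-< j<m)) (ℕ.≤-trans (ℕ.m∸n≤m a 1) a≤n)
    ... | no j≮m  = subst (ℕ._≤ n) (sym (select-≥ (ℕ.≮⇒≥ j≮m))) 1≤n

    open ScaledColumns M n 1≤M (gain (a ℕ.∸ 1)) gain≤n

    module _ (v : ℕ → Word q n) where
      open Shear m v using (shear; shear-injective; det-shear)

      module _ {j} (j<m : j ℕ.< m) (u : Word q n) where

        wordRow-vanishes : ∀ i → toℕ i ℕ.< j → wordRow v j u i ≡ 0
        wordRow-vanishes i i<j with split m i
        ... | left l  = trans (wordRow-top v j u l) (select-< (subst (ℕ._< j) (toℕ-↑ˡ l s) i<j))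
        ... | right r = contradiction (ℕ.<-trans i<j j<m) (ℕ.≤⇒≯ (subst (m ℕ.≤_) (sym (toℕ-↑ʳ m r)) (ℕ.m≤m+n m (toℕ r))))

        wordRow-entry : ∀ i → wordRow v j u i ℕ.≤ M ℕ.^ j ℕ.* n
        wordRow-entry i with split m i
        ... | right r = subst (ℕ._≤ M ℕ.^ j ℕ.* n) (sym (wordRow-bottom v j u r))
          (ℕ.*-monoʳ-≤ (M ℕ.^ j) (ℕ.≤-trans (encode≤1 u r) 1≤n))
        ... | left l with toℕ l ℕ.<? j
        ...   | yes l<j = subst (ℕ._≤ M ℕ.^ j ℕ.* n) (sym (trans (wordRow-top v j u l) (select-< l<j))) z≤n
        ...   | no l≮j  = subst (ℕ._≤ M ℕ.^ j ℕ.* n) (sym (trans (wordRow-top v j u l) (select-≥ (ℕ.≮⇒≥ l≮j))))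
          (ℕ.*-monoʳ-≤ (M ℕ.^ j) (agreement≤n (v (toℕ l)) u))

        wordRow-diagonal : ∀ i → j ≡ toℕ i → wordRow v j u i ≡ M ℕ.^ j ℕ.* agreement (v j) u
        wordRow-diagonal i j≡i with split m i
        ... | left l  = trans (wordRow-top v j u l) (trans (select-≥ (ℕ.≤-reflexive j≡l))
          (cong (λ t → M ℕ.^ j ℕ.* agreement (v t) u) (sym j≡l)))
          where
          j≡l : j ≡ toℕ l
          j≡l = trans j≡i (toℕ-↑ˡ l s)
        ... | right r = contradiction j<m (ℕ.≤⇒≯ (subst (m ℕ.≤_) (sym (trans j≡i (toℕ-↑ʳ m r))) (ℕ.m≤m+n m (toℕ r))))

      module _ (b : Fin s) where

        unitRow-top : ∀ l → unitRow b (l ↑ˡ s) ≡ 0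
        unitRow-top l = lookup-++ˡ {m = m} (λ _ → 0) (λ r → M ℕ.^ (m ℕ.+ toℕ b) ℕ.* κ b r) l

        unitRow-bottom : ∀ r → unitRow b (m ↑ʳ r) ≡ M ℕ.^ (m ℕ.+ toℕ b) ℕ.* κ b r
        unitRow-bottom r = lookup-++ʳ {m = m} (λ _ → 0) (λ r → M ℕ.^ (m ℕ.+ toℕ b) ℕ.* κ b r) r

        unitRow-vanishes : ∀ i → toℕ i ℕ.< m ℕ.+ toℕ b → unitRow b i ≡ 0
        unitRow-vanishes i i<b with split m i
        ... | left l  = unitRow-top l
        ... | right r = trans (unitRow-bottom r) (trans (cong (M ℕ.^ (m ℕ.+ toℕ b) ℕ.*_)
          (κ-≢ λ b≡r → ℕ.<-irrefl (trans (toℕ-↑ʳ m r) (cong (λ z → m ℕ.+ toℕ z) (sym b≡r))) i<b)) (ℕ.*-zeroʳ (M ℕ.^ (m ℕ.+ toℕ b))))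

        unitRow-entry : ∀ i → unitRow b i ℕ.≤ M ℕ.^ (m ℕ.+ toℕ b) ℕ.* 1
        unitRow-entry i with split m i
        ... | left l  = subst (ℕ._≤ M ℕ.^ (m ℕ.+ toℕ b) ℕ.* 1) (sym (unitRow-top l)) z≤n
        ... | right r = subst (ℕ._≤ M ℕ.^ (m ℕ.+ toℕ b) ℕ.* 1) (sym (unitRow-bottom r)) (ℕ.*-monoʳ-≤ (M ℕ.^ (m ℕ.+ toℕ b)) (κ≤1 b r))

      party-left : ∀ l → party v (l ↑ˡ s) ≡ wordSet v (toℕ l)
      party-left l = lookup-++ˡ (wordSet v ∘ toℕ) _ l

      party-right : ∀ b → party v (m ↑ʳ b) ≡ pad (unitVector v b) ∷ []
      party-right b = lookup-++ʳ {m = m} (wordSet v ∘ toℕ) (λ b → pad (unitVector v b) ∷ []) b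

      parties : List (FinSet d)
      parties = List.tabulate (party v)

      -- From each word party the dropped word v j, whose own row holds ⟨v j, v j⟩ = n.
      bestRow : Fin k → Fin k → ℕ
      bestRow = (λ l → wordRow v (toℕ l) (v (toℕ l))) ⊕ unitRow

      bestRow-left : ∀ l i → bestRow (l ↑ˡ s) i ≡ wordRow v (toℕ l) (v (toℕ l)) i
      bestRow-left l i = cong (λ (f : Fin k → ℕ) → f i) (lookup-++ˡ (λ l → wordRow v (toℕ l) (v (toℕ l))) unitRow l)

      bestRow-right : ∀ b i → bestRow (m ↑ʳ b) i ≡ unitRow b i
      bestRow-right b i = cong (λ (f : Fin k → ℕ) → f i) (lookup-++ʳ {m = m} (λ l → wordRow v (toℕ l) (v (toℕ l))) unitRow b)

      best : Fin k → Point d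
      best i = pad (shear (bestRow i))

      bestRow-vanishes : ∀ i j → toℕ i ℕ.< toℕ j → bestRow j i ≡ 0
      bestRow-vanishes i j i<j with split m j
      ... | left l  = trans (bestRow-left l i) (wordRow-vanishes (toℕ<n l) (v (toℕ l)) i (subst (toℕ i ℕ.<_) (toℕ-↑ˡ l s) i<j))
      ... | right b = trans (bestRow-right b i) (unitRow-vanishes b i (subst (toℕ i ℕ.<_) (toℕ-↑ʳ m b) i<j))

      bestRow-diagonal : ∀ i → bestRow i i ≡ M ℕ.^ toℕ i ℕ.* gain n (toℕ i)
      bestRow-diagonal i with split m i
      ... | left l = trans (bestRow-left l (l ↑ˡ s)) (trans
        (wordRow-diagonal (toℕ<n l) (v (toℕ l)) (l ↑ˡ s) (sym (toℕ-↑ˡ l s)))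
        (trans (cong (M ℕ.^ toℕ l ℕ.*_) (trans (agreement-refl (v (toℕ l))) (sym (select-< (toℕ<n l)))))
          (cong (λ t → M ℕ.^ t ℕ.* gain n t) (sym (toℕ-↑ˡ l s)))))
      ... | right b = trans (bestRow-right b (m ↑ʳ b)) (trans (unitRow-bottom b b)
        (trans (cong (M ℕ.^ (m ℕ.+ toℕ b) ℕ.*_) (trans (κ-refl b) (sym (select-≥ (ℕ.m≤m+n m (toℕ b))))))
          (cong (λ t → M ℕ.^ t ℕ.* gain n t) (sym (toℕ-↑ʳ m b)))))

      bestRow-diagonal≢0 : ∀ i → bestRow i i ≢ 0
      bestRow-diagonal≢0 i eq = ℕ.<-irrefl refl (ℕ.≤-trans (ℕ.*-mono-≤ (1≤M^ (toℕ i)) 1≤gain)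
        (ℕ.≤-reflexive (trans (sym (bestRow-diagonal i)) eq)))
        where
        1≤gain : 1 ℕ.≤ gain n (toℕ i)
        1≤gain with toℕ i ℕ.<? m
        ... | yes i<m = subst (1 ℕ.≤_) (sym (select-< i<m)) 1≤n
        ... | no i≮m  = subst (1 ℕ.≤_) (sym (select-≥ (ℕ.≮⇒≥ i≮m))) ℕ.≤-refl

      -- The columns form a triangular matrix with nonzero diagonal.
      best-injective : ∀ {i j} → best i ≡ best j → i ≡ j
      best-injective {i} {j} eq with ℕ.<-cmp (toℕ i) (toℕ j)
      ... | tri≈ _ i≡j _ = toℕ-injective i≡j
      ... | tri< i<j _ _ = contradiction (trans (shear-injective {bestRow i} {bestRow j} (pad-injective eq) i) (bestRow-vanishes i j i<j)) (bestRow-diagonal≢0 i)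
      ... | tri> _ _ j<i = contradiction (trans (sym (shear-injective {bestRow i} {bestRow j} (pad-injective eq) j)) (bestRow-vanishes j i j<i)) (bestRow-diagonal≢0 j)

      optimum : ℕ
      optimum = scale 0 k ℕ.* n ℕ.^ m

      detₖ-best : detₖ k (sumOuter (Vec.tabulate best)) ≡ fromℕ optimum * fromℕ optimum
      detₖ-best = trans (detₖ-tabulate (λ p i → shear (bestRow i) p)) (cong₂ _*_ det≡ det≡)
        where
        det≡ : det (λ p i → shear (bestRow i) p) ≡ fromℕ optimum
        det≡ = begin
          det (λ p i → shear (bestRow i) p)
            ≡⟨ det-shear (λ p i → bestRow i p) ⟩
          detℕ (λ p i → bestRow i p)
            ≡⟨ det-lowerTriangular (λ p i → fromℕ (bestRow i p)) (λ i j lt → cong fromℕ (bestRow-vanishes i j lt)) ⟩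
          product (λ i → fromℕ (bestRow i i))
            ≡⟨ product-cong (λ i → cong fromℕ (bestRow-diagonal i)) ⟩
          product {k} (λ i → fromℕ (M ℕ.^ toℕ i ℕ.* gain n (toℕ i)))
            ≡⟨ product-∏ℕ (λ j → M ℕ.^ j ℕ.* gain n j) 0 k ⟩
          fromℕ (∏ℕ (λ j → M ℕ.^ j ℕ.* gain n j) 0 k)
            ≡⟨ cong fromℕ (trans (∏ℕ-* (M ℕ.^_) (gain n) 0 k) (cong (scale 0 k ℕ.*_) (∏ℕ-select m n 0 s))) ⟩
          fromℕ optimum ∎
          where open ≡-Reasoning

      best∈parties : (∀ j → j ℕ.< m → v j ∈ codewords) → toList (Vec.tabulate best) ⊆ concat parties
      best∈parties v∈ {x} x∈ with i , refl ← ∈-tabulate⁻ (subst (x ∈_) (toList-tabulate best) x∈) =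
        ∈-concat⁺′ (member i) (∈-tabulate⁺ i)
        where
        member : ∀ i → best i ∈ party v i
        member i with split m i
        ... | left l  = subst₂ _∈_
          (pad-cong (λ p → trans (shear-wordRow v (toℕ l) (v (toℕ l)) p)
            (cong (λ y → shear y p) (sym (lookup-++ˡ (λ l → wordRow v (toℕ l) (v (toℕ l))) unitRow l)))))
          (sym (party-left l)) (∈-map⁺ (pad ∘ wordVector v (toℕ l)) (v∈ (toℕ l) (toℕ<n l)))
        ... | right b = subst₂ _∈_
          (cong (pad ∘ shear) (sym (lookup-++ʳ {m = m} (λ l → wordRow v (toℕ l) (v (toℕ l))) unitRow b)))
          (sym (party-right b)) (here refl)

      optimum≤objective : (∀ j → j ℕ.< m → v j ∈ codewords) → fromℕ optimum * fromℕ optimum ≤ objective k (concat parties)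
      optimum≤objective v∈ = subst (_≤ objective k (concat parties)) detₖ-best
        (detₖ≤objective k (Vec.tabulate best) (subst Unique (sym (toList-tabulate best)) (tabulate⁺ best-injective)) (best∈parties v∈))

      -- What the determinant bound needs of one point. It is gathered point by point because a
      -- selection may take several points from one party and none from another.
      record Column (x : Point d) : Set where
        field
          type     : ℕ
          row      : Fin k → ℕ
          vanishes : ∀ i → toℕ i ℕ.< type → row i ≡ 0
          entry    : ∀ i → row i ℕ.≤ M ℕ.^ type ℕ.* n
          diagonal : ∀ i → type ≡ toℕ i → row i ℕ.≤ M ℕ.^ type ℕ.* gain (a ℕ.∸ 1) type
          sheared  : ∀ p → lookup x (p ↑ˡ e) ≡ shear row p
          padded   : ∀ j → lookup x (k ↑ʳ j) ≡ 0#

      coreBound : ℕ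
      coreBound = scale 0 k ℕ.* a ℕ.^ m

      detₖ≤coreBound : (S : Vec (Point d) k) → (∀ i → Column (lookup S i)) →
                       detₖ k (sumOuter S) ≤ fromℕ coreBound * fromℕ coreBound
      detₖ≤coreBound S column = subst (_≤ fromℕ coreBound * fromℕ coreBound)
        (sym (trans (detₖ-pad S (λ p i → shear (λ r → Y r i) p) (λ i → Column.sheared (column i)) (λ i → Column.padded (column i)))
          (cong₂ _*_ (det-shear Y) (det-shear Y))))
        (∣x∣≤B⇒x²≤B² (∣∣≤-mono bound (∣∣≤-cancel {B = suc ((a ℕ.∸ 1) ℕ.^ m) ℕ.* scale 0 k} 1≤M (subst (∣ fromℕ M * detℕ Y ∣≤_) arithmetic
          (∣M*det∣≤leading {l = 0} typed (λ _ → z≤n))))))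
        where
        Y : Fin k → Fin k → ℕ
        Y r i = Column.row (column i) r
        typed : Typed 0 Y (λ i → Column.type (column i))
        typed = record
          { vanishes = λ r i → Column.vanishes (column i) r
          ; entry    = λ r i → Column.entry (column i) r
          ; diagonal = λ r i → Column.diagonal (column i) r
          }
        bound : suc ((a ℕ.∸ 1) ℕ.^ m) ℕ.* scale 0 k ℕ.≤ coreBound
        bound = subst (ℕ._≤ coreBound) (ℕ.*-comm (scale 0 k) _) (ℕ.*-monoʳ-≤ (scale 0 k) (1+[a-1]^m≤a^m 1≤a 1≤m))
        arithmetic : (M ℕ.* ∏ℕ (gain (a ℕ.∸ 1)) 0 k ℕ.+ M) ℕ.* scale 0 k ≡ M ℕ.* (suc ((a ℕ.∸ 1) ℕ.^ m) ℕ.* scale 0 k)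
        arithmetic = trans (cong (λ z → (M ℕ.* z ℕ.+ M) ℕ.* scale 0 k) (∏ℕ-select m (a ℕ.∸ 1) 0 s)) (lemma M ((a ℕ.∸ 1) ℕ.^ m) (scale 0 k))
          where
          lemma : ∀ M g w → (M ℕ.* g ℕ.+ M) ℕ.* w ≡ M ℕ.* (suc g ℕ.* w)
          lemma = solve-∀

      column : ∀ {α c} (core : IsComposableCoreSet k α t c) → (∀ j → j ℕ.< m → Dropped core v j (v j)) →
               ∀ {x} → x ∈ concat (map c parties) → Column x
      column {c = c} core dropped {x} x∈
        with _ , x∈V , V∈ ← ∈-concat⁻′ (map c parties) x∈
        with W , W∈ , refl ← ∈-map⁻ c V∈
        with i , refl ← ∈-tabulate⁻ W∈
        with split m i
      ... | right b = result (subst (x ∈_) (party-right b) (IsComposableCoreSet.subset core _ x∈V))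
        where
        result : x ∈ pad (unitVector v b) ∷ [] → Column x
        result (here refl) = record
          { type     = m ℕ.+ toℕ b
          ; row      = unitRow b
          ; vanishes = unitRow-vanishes b
          ; entry    = λ i → ℕ.≤-trans (unitRow-entry b i) (ℕ.*-monoʳ-≤ (M ℕ.^ (m ℕ.+ toℕ b)) 1≤n)
          ; diagonal = λ i _ → ℕ.≤-trans (unitRow-entry b i)
              (ℕ.≤-reflexive (cong (M ℕ.^ (m ℕ.+ toℕ b) ℕ.*_) (sym (select-≥ (ℕ.m≤m+n m (toℕ b))))))
          ; sheared  = lookup-pad (unitVector v b)
          ; padded   = lookup-pad-zero (unitVector v b)
          }
      ... | left l = result (∈-map⁻ (pad ∘ wordVector v j) (subst (x ∈_) (party-left l) (IsComposableCoreSet.subset core _ x∈V)))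
        where
        j = toℕ l
        j<m : j ℕ.< m
        j<m = toℕ<n l
        result : (∃[ u ] u ∈ codewords × x ≡ pad (wordVector v j u)) → Column x
        result (u , u∈ , refl) = record
          { type     = j
          ; row      = wordRow v j u
          ; vanishes = wordRow-vanishes j<m u
          ; entry    = wordRow-entry j<m u
          ; diagonal = λ i j≡i → ℕ.≤-trans (ℕ.≤-reflexive (wordRow-diagonal j<m u i j≡i))
              (ℕ.*-monoʳ-≤ (M ℕ.^ j) (ℕ.≤-trans (ℕ.∸-monoˡ-≤ 1 near) (ℕ.≤-reflexive (sym (select-< j<m)))))
          ; sheared  = λ p → trans (lookup-pad (wordVector v j u) p) (shear-wordRow v j u p)
          ; padded   = lookup-pad-zero (wordVector v j u)
          }
          where
          -- The point of `u` lies in the core-set and that of `v j` does not, so the two codewords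
          -- differ.
          near : agreement (v j) u ℕ.< a
          near with distance (proj₁ (dropped j j<m)) u∈
          ... | inj₂ p    = p
          ... | inj₁ refl = contradiction (subst (x ∈_) (cong c (party-left l)) x∈V) (proj₂ (dropped j j<m))

    α-bound : ∀ {α c} → IsComposableCoreSet k α t c →
              fromℕ (n ℕ.^ m) * fromℕ (n ℕ.^ m) ≤ α * (fromℕ (a ℕ.^ m) * fromℕ (a ℕ.^ m))
    α-bound {α} {c} core with v , dropped ← adversarial-choice core =
      *-cancelʳ-≤ (*-pos 0<w 0<w) (begin
        N * N * (w * w)
          ≡⟨ square N w ⟩
        (w * N) * (w * N)
          ≡⟨ cong₂ _*_ (fromℕ-* (scale 0 k) (n ℕ.^ m)) (fromℕ-* (scale 0 k) (n ℕ.^ m)) ⟨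
        fromℕ (optimum v) * fromℕ (optimum v)
          ≤⟨ optimum≤objective v (λ j j<m → proj₁ (dropped j j<m)) ⟩
        objective k (concat (parties v))
          ≡⟨ x/y*y≡x _ α-positive ⟨
        objective k (concat (parties v)) / α * α
          ≡⟨ cong (_* α) (trans (cong (_* objective k (concat (parties v))) (*-identityˡ (α ⁻¹))) (*-comm (α ⁻¹) _)) ⟨
        1# / α * objective k (concat (parties v)) * α
          ≤⟨ *-monoˡ-≤ (proj₁ α-positive) (approximate (parties v)) ⟩
        objective k (concat (map c (parties v))) * α
          ≤⟨ *-monoˡ-≤ (proj₁ α-positive) (objective≤ k (*-nonNeg (0≤fromℕ (coreBound v)) (0≤fromℕ (coreBound v))) (λ S _ S⊆ →
               detₖ≤coreBound v S (λ i → column v core dropped (S⊆ (lookup∈ S i))))) ⟩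
        fromℕ (coreBound v) * fromℕ (coreBound v) * α
          ≡⟨ cong (_* α) (cong₂ _*_ (fromℕ-* (scale 0 k) (a ℕ.^ m)) (fromℕ-* (scale 0 k) (a ℕ.^ m))) ⟩
        (w * A) * (w * A) * α
          ≡⟨ cong (_* α) (square A w) ⟨
        A * A * (w * w) * α
          ≡⟨ trans (*-comm _ α) (sym (*-assoc α _ _)) ⟩
        α * (A * A) * (w * w) ∎)
      where
      open IsComposableCoreSet core
      open ≤-Reasoning
      N = fromℕ (n ℕ.^ m)
      A = fromℕ (a ℕ.^ m)
      w = fromℕ (scale 0 k)
      0<w : 0# < w
      0<w = 0<fromℕ (positive 0 k)
        where
        positive : ∀ l r → 1 ℕ.≤ scale l r
        positive l zero    = ℕ.≤-refl
        positive l (suc r) = ℕ.*-mono-≤ (1≤M^ l) (positive (suc l) r)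
      square : ∀ x w → x * x * (w * w) ≡ (w * x) * (w * x)
      square x w = trans (trans (*-assoc x x (w * w)) (cong (x *_) (*-swap x w w)))
        (trans (sym (*-assoc x w (x * w))) (cong₂ _*_ (*-comm x w) (*-comm x w)))

  -- Real powers and the asymptotic loss

  root-least : ∀ {n x y} → 0# ≤ y → x ≤ y ^ suc n → root (suc n) x ≤ y
  root-least {n} 0≤y x≤y^ = sup-least 0≤y (λ z (0≤z , z^≤x) → ^-cancel-≤ n 0≤y (≤-trans z^≤x x≤y^))

  -- Let W = w + 1. From p/q ≤ y ≤ u/W follows pW ≤ uq, so (x^p)^W ≤ (x^u)^q ≤ (T^q)^W, and W-th
  -- roots are taken. For a negative exponent the power is at most 1 ≤ T.
  ^ℚ-≤ : ∀ {x y T} u w → 1# ≤ x → 1# ≤ T → x ^ u ≤ T ^ suc w → fromℕ (suc w) * y ≤ fromℕ u →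
         ∀ q → fromℚ q ≤ y → x ^ℚ q ≤ T
  ^ℚ-≤ {x} {y} {T} u w 1≤x 1≤T x^u≤T^w wy≤u (mkℚᵘ ℤ.-[1+ p ] q) _ =
    root-least {q} (≤-trans 0≤1 1≤T) (≤-trans (⁻¹≤1 (1≤x^n 1≤x (suc p))) (1≤x^n 1≤T (suc q)))
  ^ℚ-≤ {x} {y} {T} u w 1≤x 1≤T x^u≤T^w wy≤u (mkℚᵘ (ℤ.+ p) q) p/q≤y =
    root-least {q} (≤-trans 0≤1 1≤T) (^-cancel-≤ w (^-nonNeg (≤-trans 0≤1 1≤T) (suc q)) (begin
      (x ^ p) ^ suc w          ≡⟨ ^-assocʳ x p (suc w) ⟩
      x ^ (p ℕ.* suc w)        ≤⟨ ^-exponent-mono 1≤x (ℕ.≤-trans (ℕ.≤-reflexive (ℕ.*-comm p (suc w))) wp≤uq) ⟩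
      x ^ (u ℕ.* suc q)        ≡⟨ ^-assocʳ x u (suc q) ⟨
      (x ^ u) ^ suc q          ≤⟨ ^-mono-≤ (^-nonNeg (≤-trans 0≤1 1≤x) u) x^u≤T^w (suc q) ⟩
      (T ^ suc w) ^ suc q      ≡⟨ ^-assocʳ T (suc w) (suc q) ⟩
      T ^ (suc w ℕ.* suc q)    ≡⟨ cong (T ^_) (ℕ.*-comm (suc w) (suc q)) ⟩
      T ^ (suc q ℕ.* suc w)    ≡⟨ ^-assocʳ T (suc q) (suc w) ⟨
      (T ^ suc q) ^ suc w      ∎))
    where
    open ≤-Reasoning
    Q = fromℕ (suc q)
    0<Q : 0# < Q
    0<Q = 0<fromℕ {suc q} (s≤s z≤n)
    wp≤uq : suc w ℕ.* p ℕ.≤ u ℕ.* suc q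
    wp≤uq = fromℕ-cancel-≤ (begin
      fromℕ (suc w ℕ.* p)                          ≡⟨ fromℕ-* (suc w) p ⟩
      fromℕ (suc w) * fromℕ p                      ≡⟨ cong (fromℕ (suc w) *_) (x/y*y≡x (fromℕ p) 0<Q) ⟨
      fromℕ (suc w) * (fromℕ p / Q * Q)            ≤⟨ *-monoʳ-≤ (0≤fromℕ (suc w)) (*-monoˡ-≤ (proj₁ 0<Q) p/q≤y) ⟩
      fromℕ (suc w) * (y * Q)                      ≡⟨ *-assoc (fromℕ (suc w)) y Q ⟨
      fromℕ (suc w) * y * Q                        ≤⟨ *-monoˡ-≤ (proj₁ 0<Q) wy≤u ⟩
      fromℕ u * Q                                  ≡⟨ fromℕ-* u (suc q) ⟨
      fromℕ (u ℕ.* suc q)                          ∎)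

  ^ʳ-≤ : ∀ {x y T} u w → 1 ℕ.≤ w → 1# ≤ x → 1# ≤ T → x ^ u ≤ T ^ w → fromℕ w * y ≤ fromℕ u → x ^ʳ y ≤ T
  ^ʳ-≤ {x} {y} {T} u (suc w) _ 1≤x 1≤T x^u≤T^w wy≤u with 1# ≤? x
  ... | no 1≰x = contradiction 1≤x 1≰x
  ... | yes _  = sup-least (≤-trans 0≤1 1≤T) (λ { _ (q , q≤y , refl) → ^ℚ-≤ u w 1≤x 1≤T x^u≤T^w wy≤u q q≤y })

  -- Here the power is the reciprocal of a supremum over rational powers that include the 0-th, so
  -- of a number at least 1. If the supremum is unbounded, it and its reciprocal both take the junk
  -- value 0.
  ^ʳ-≤1 : ∀ {x y} → ¬ (1# ≤ x) → 0# ≤ y → x ^ʳ y ≤ 1#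
  ^ʳ-≤1 {x} {y} 1≰x 0≤y with 1# ≤? x
  ... | yes 1≤x = contradiction 1≤x 1≰x
  ... | no _ = bound (sup-upper′ (mkℚᵘ (ℤ.+ 0) 0 , subst (_≤ y) (sym (zeroˡ _)) 0≤y , refl))
    where
    1≤root : 1# ≤ root 1 1#
    1≤root = sup-upper {B = 1#} (λ z (_ , z^1≤1) → subst (_≤ 1#) (*-identityʳ z) z^1≤1) (0≤1 , ≤-reflexive (*-identityʳ 1#))
    bound : ∀ {s} → root 1 1# ≤ s ⊎ s ≡ 0# → s ⁻¹ ≤ 1#
    bound (inj₁ root≤s) = ⁻¹≤1 (≤-trans 1≤root root≤s)
    bound (inj₂ refl)   = subst (_≤ 1#) (sym 0⁻¹≡0) 0≤1

  ≤⇒∃+ : ∀ {m n} → m ℕ.≤ n → ∃[ e ] m ℕ.+ e ≡ n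
  ≤⇒∃+ {m} {n} m≤n = n ℕ.∸ m , ℕ.m+[n∸m]≡n m≤n

  -- With n = a · 2^h the ratio (n / a)^(2m) is exactly 2^(2hm), without rounding.
  2^[2hm]≤α : ∀ {n a t k d α c} m h → n ≡ a ℕ.* 2 ℕ.^ h → m ℕ.+ n ℕ.* (2 ℕ.* n) ≡ k → k ℕ.≤ d →
              1 ℕ.≤ m → 1 ℕ.≤ a → suc t ℕ.* 2 ℕ.≤ 2 ℕ.^ a →
              IsComposableCoreSet {d} k α t c → fromℕ (2 ℕ.^ (2 ℕ.* h ℕ.* m)) ≤ α
  2^[2hm]≤α {n} {a} {t} {α = α} m h refl refl k≤d 1≤m 1≤a t≤ core
    with e , refl ← ≤⇒∃+ k≤d = *-cancelʳ-≤ (*-pos 0<A 0<A) (begin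
      fromℕ (2 ℕ.^ (2 ℕ.* h ℕ.* m)) * (A * A)
        ≡⟨ cong (_* (A * A)) (trans (cong (λ x → fromℕ (2 ℕ.^ x)) hm+hm) (trans (cong fromℕ (ℕ.^-distribˡ-+-* 2 (h ℕ.* m) (h ℕ.* m))) (fromℕ-* (2 ℕ.^ (h ℕ.* m)) _))) ⟩
      P * P * (A * A)
        ≡⟨ trans (*-assoc P P (A * A)) (trans (cong (P *_) (*-swap P A A)) (sym (*-assoc P A (P * A)))) ⟩
      P * A * (P * A)
        ≡⟨ cong₂ _*_ N≡ N≡ ⟨
      fromℕ (n ℕ.^ m) * fromℕ (n ℕ.^ m)
        ≤⟨ Adversary.α-bound m e 1≤n 1≤m 1≤a a≤n (greedyCode n a (suc t) 1≤n a≤n t≤) core ⟩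
      α * (A * A) ∎)
    where
    open ≤-Reasoning
    A = fromℕ (a ℕ.^ m)
    P = fromℕ (2 ℕ.^ (h ℕ.* m))
    0<A : 0# < A
    0<A = 0<fromℕ (ℕ.m^n>0 a {{ℕ.>-nonZero 1≤a}} m)
    a≤n : a ℕ.≤ n
    a≤n = ℕ.m≤m*n a (2 ℕ.^ h) {{ℕ.m^n≢0 2 h}}
    1≤n : 1 ℕ.≤ n
    1≤n = ℕ.≤-trans 1≤a a≤n
    hm+hm : 2 ℕ.* h ℕ.* m ≡ h ℕ.* m ℕ.+ h ℕ.* m
    hm+hm = trans (ℕ.*-assoc 2 h m) (cong (h ℕ.* m ℕ.+_) (ℕ.+-identityʳ _))
    N≡ : fromℕ (n ℕ.^ m) ≡ P * A
    N≡ = begin-equality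
      fromℕ ((a ℕ.* 2 ℕ.^ h) ℕ.^ m)           ≡⟨ fromℕ-^ (a ℕ.* 2 ℕ.^ h) m ⟩
      fromℕ (a ℕ.* 2 ℕ.^ h) ^ m               ≡⟨ cong (_^ m) (fromℕ-* a (2 ℕ.^ h)) ⟩
      (fromℕ a * fromℕ (2 ℕ.^ h)) ^ m         ≡⟨ ^-distrib-* (fromℕ a) (fromℕ (2 ℕ.^ h)) m ⟩
      fromℕ a ^ m * fromℕ (2 ℕ.^ h) ^ m       ≡⟨ *-comm _ _ ⟩
      fromℕ (2 ℕ.^ h) ^ m * fromℕ a ^ m       ≡⟨ cong₂ _*_ (fromℕ-^ (2 ℕ.^ h) m) (fromℕ-^ a m) ⟨
      fromℕ ((2 ℕ.^ h) ℕ.^ m) * A             ≡⟨ cong (λ x → fromℕ x * A) (ℕ.^-*-assoc 2 h m) ⟩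
      P * A                                   ∎

  1≤factor : ∀ {k d α t c} → k ℕ.≤ d → IsComposableCoreSet {d} k α t c → 1# ≤ α
  1≤factor {k} k≤d core with e , refl ← ≤⇒∃+ k≤d
    with V , 0<f ← orthonormal-objective k e = positive-objective⇒1≤factor core V 0<f

  trivial-cases : ∀ {α} h m → 1# ≤ α → (1 ℕ.≤ h → 1 ℕ.≤ m → fromℕ (2 ℕ.^ (2 ℕ.* h ℕ.* m)) ≤ α) →
                  fromℕ (2 ℕ.^ (2 ℕ.* h ℕ.* m)) ≤ α
  trivial-cases {α} zero    m       1≤α _ = subst (_≤ α) (sym fromℕ-1) 1≤α
  trivial-cases {α} (suc h) zero    1≤α _ = subst (λ x → fromℕ (2 ℕ.^ x) ≤ α) (sym (ℕ.*-zeroʳ (2 ℕ.* suc h))) (subst (_≤ α) (sym fromℕ-1) 1≤α)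
  trivial-cases {α} (suc h) (suc m) _ bound = bound (s≤s z≤n) (s≤s z≤n)

  -- From k ≤ 2^(log k) and 2^`exponent` ≤ α. It states α ≥ k^(`exponent` / `log k`) without a
  -- fractional power.
  k^exponent≤α^log : ∀ b {k d α t c} → 1 ℕ.≤ k → k ℕ.≤ d → t ℕ.≤ k ℕ.^ b → IsComposableCoreSet {d} k α t c →
                     fromℕ k ^ Parameters.exponent b k ≤ α ^ log k
  k^exponent≤α^log b {k} {d} {α} {t} 1≤k k≤d t≤k^b core = begin
    fromℕ k ^ exponent              ≤⟨ ^-mono-≤ (0≤fromℕ k) (fromℕ-mono (≤2^log k)) exponent ⟩
    fromℕ (2 ℕ.^ log k) ^ exponent  ≡⟨ fromℕ-^ (2 ℕ.^ log k) exponent ⟨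
    fromℕ ((2 ℕ.^ log k) ℕ.^ exponent)
      ≡⟨ cong fromℕ (trans (ℕ.^-*-assoc 2 (log k) exponent) (trans (cong (2 ℕ.^_) (ℕ.*-comm (log k) exponent)) (sym (ℕ.^-*-assoc 2 exponent (log k))))) ⟩
    fromℕ ((2 ℕ.^ exponent) ℕ.^ log k)  ≡⟨ fromℕ-^ (2 ℕ.^ exponent) (log k) ⟩
    fromℕ (2 ℕ.^ exponent) ^ log k  ≤⟨ ^-mono-≤ (0≤fromℕ (2 ℕ.^ exponent)) 2^exponent≤α (log k) ⟩
    α ^ log k                       ∎
    where
    open ≤-Reasoning
    open Parameters b k
    2^exponent≤α : fromℕ (2 ℕ.^ exponent) ≤ α
    2^exponent≤α = trivial-cases halving count (1≤factor k≤d core) λ 1≤h 1≤m →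
      2^[2hm]≤α count halving refl (count+dimensions 1≤k 1≤h) k≤d 1≤m 1≤closeness (size≤2^closeness t≤k^b) core

  -- The loss is defined so that k(1 - `loss k`) is exactly u k / w k for k ≥ 1; the bound k^(u k) ≤
  -- α^(w k) then fits the real power without approximation.
  module Loss (u w : ℕ → ℕ) (1≤w : ∀ k → 1 ℕ.≤ w k) (u≤wk : ∀ k → u k ℕ.≤ w k ℕ.* k)
    (u-large : ∀ r → 1 ℕ.≤ r → ∃[ K ] (∀ k → K ℕ.≤ k → 1 ℕ.≤ k → r ℕ.* (w k ℕ.* k) ℕ.≤ r ℕ.* u k ℕ.+ w k ℕ.* k)) where

    ratio : ℕ → ℝ
    ratio k = fromℕ (u k) / (fromℕ (w k) * fromℕ k)

    loss : ℕ → ℝ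
    loss k = 1# - ratio k

    0<wk : ∀ {k} → 1 ℕ.≤ k → 0# < fromℕ (w k) * fromℕ k
    0<wk 1≤k = *-pos (0<fromℕ (1≤w _)) (0<fromℕ 1≤k)

    ratio≤1 : ∀ {k} → 1 ℕ.≤ k → ratio k ≤ 1#
    ratio≤1 {k} 1≤k = *-cancelʳ-≤ (0<wk 1≤k) (subst₂ _≤_
      (sym (x/y*y≡x _ (0<wk 1≤k))) (trans (fromℕ-* (w k) k) (sym (*-identityˡ _))) (fromℕ-mono (u≤wk k)))

    1-loss≡ratio : ∀ k → 1# - loss k ≡ ratio k
    1-loss≡ratio k = trans (cong (λ z → 1# + z) (trans (sym (-‿+-comm 1# (- ratio k))) (cong (λ z → - 1# + z) (-‿involutive (ratio k)))))
      (trans (sym (+-assoc 1# (- 1#) (ratio k))) (trans (cong (_+ ratio k) (-‿inverseʳ 1#)) (+-identityˡ _)))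

    loss-small : ∀ r → 1 ℕ.≤ r → ∃[ K ] (∀ k → K ℕ.≤ k → 1 ℕ.≤ k → fromℕ r * loss k ≤ 1#)
    loss-small r 1≤r with K , large ← u-large r 1≤r = K , λ k K≤k 1≤k →
      let D = fromℕ (w k) * fromℕ k
          0<D = 0<wk 1≤k in
      *-cancelʳ-≤ 0<D (+-cancelʳ-≤ (fromℕ r * (ratio k * D)) (subst₂ _≤_
        (begin
          fromℕ (r ℕ.* (w k ℕ.* k))
            ≡⟨ trans (fromℕ-* r _) (cong (fromℕ r *_) (fromℕ-* (w k) k)) ⟩
          fromℕ r * D
            ≡⟨ cong (fromℕ r *_) (trans (sym (*-identityˡ D)) (cong (_* D) (sym (x-y+y≡x 1# (ratio k))))) ⟩
          fromℕ r * ((loss k + ratio k) * D)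
            ≡⟨ trans (cong (fromℕ r *_) (distribʳ D (loss k) (ratio k))) (distribˡ (fromℕ r) _ _) ⟩
          fromℕ r * (loss k * D) + fromℕ r * (ratio k * D)
            ≡⟨ cong (_+ fromℕ r * (ratio k * D)) (*-assoc (fromℕ r) (loss k) D) ⟨
          fromℕ r * loss k * D + fromℕ r * (ratio k * D) ∎)
        (begin
          fromℕ (r ℕ.* u k ℕ.+ w k ℕ.* k)
            ≡⟨ trans (fromℕ-+ (r ℕ.* u k) _) (cong₂ _+_ (fromℕ-* r _) (fromℕ-* (w k) k)) ⟩
          fromℕ r * fromℕ (u k) + D
            ≡⟨ cong₂ _+_ (cong (fromℕ r *_) (x/y*y≡x _ 0<D)) (*-identityˡ D) ⟨
          fromℕ r * (ratio k * D) + 1# * D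
            ≡⟨ +-comm _ _ ⟩
          1# * D + fromℕ r * (ratio k * D) ∎)
        (fromℕ-mono (large k K≤k 1≤k))))
      where open ≡-Reasoning

    loss-tendsToZero : TendsToZero loss
    loss-tendsToZero ε 0<ε with r , ε⁻¹≤r ← archimedean (ε ⁻¹)
      -- r ε ≥ 1 gives (r + 1) ε > 1, so taking `suc r` makes the upper bound on the loss strict.
      with K , small ← loss-small (suc r) (s≤s z≤n)
      = suc K , λ k K<k → let 1≤k = ℕ.≤-trans (s≤s z≤n) K<k in
        ≰⇒> (λ loss≤-ε → above-negative 1≤k loss≤-ε) ,
        ≰⇒> (λ ε≤loss → too-large (≤-trans (*-monoʳ-≤ (0≤fromℕ (suc r)) ε≤loss) (small k (ℕ.<⇒≤ K<k) 1≤k)))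
      where
      above-negative : ∀ {k} → 1 ℕ.≤ k → ¬ (loss k ≤ - ε)
      above-negative {k} 1≤k loss≤-ε = proj₂ 0<ε (≤-antisym (proj₁ 0<ε) (subst₂ _≤_ (-‿involutive ε) -0#≈0#
        (-‿anti-≤ (≤-trans (x≤y⇒0≤y-x (ratio≤1 1≤k)) loss≤-ε))))
      1≤rε : 1# ≤ fromℕ r * ε
      1≤rε = subst (_≤ fromℕ r * ε) (trans (*-comm (ε ⁻¹) ε) (*-inverseʳ (0<⇒≢0 0<ε))) (*-monoˡ-≤ (proj₁ 0<ε) ε⁻¹≤r)
      too-large : ¬ (fromℕ (suc r) * ε ≤ 1#)
      too-large p = proj₂ 0<ε (≤-antisym (proj₁ 0<ε) (+-cancelʳ-≤ (fromℕ r * ε) (begin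
        ε + fromℕ r * ε         ≡⟨ cong (_+ fromℕ r * ε) (*-identityˡ ε) ⟨
        1# * ε + fromℕ r * ε    ≡⟨ distribʳ ε 1# (fromℕ r) ⟨
        fromℕ (suc r) * ε       ≤⟨ p ⟩
        1#                      ≤⟨ 1≤rε ⟩
        fromℕ r * ε             ≡⟨ +-identityˡ _ ⟨
        0# + fromℕ r * ε        ∎)))
        where open ≤-Reasoning

    -- As β ≥ 1, the base k/β is at most k, so the bound for k passes to it. A base below 1 has a
    -- power of at most 1 ≤ α.
    ^ʳ-loss≤ : ∀ {α β k} → 1# ≤ β → 1# ≤ α → 1 ℕ.≤ k → fromℕ k ^ u k ≤ α ^ w k →
               (fromℕ k / β) ^ʳ (fromℕ k * (1# - loss k)) ≤ α
    ^ʳ-loss≤ {α} {β} {k} 1≤β 1≤α 1≤k k^u≤α^w = cases (1# ≤? fromℕ k / β)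
      where
      open ≤-Reasoning
      0<β : 0# < β
      0<β = <-≤-trans 0<1 1≤β
      y = fromℕ k * (1# - loss k)
      wy≡u : fromℕ (w k) * y ≡ fromℕ (u k)
      wy≡u = trans (cong (λ z → fromℕ (w k) * (fromℕ k * z)) (1-loss≡ratio k))
        (trans (sym (*-assoc (fromℕ (w k)) (fromℕ k) (ratio k))) (trans (*-comm _ (ratio k)) (x/y*y≡x (fromℕ (u k)) (0<wk 1≤k))))
      0≤y : 0# ≤ y
      0≤y = *-cancelʳ-≤ (0<fromℕ (1≤w k)) (subst₂ _≤_ (sym (zeroˡ _)) (trans (sym wy≡u) (*-comm _ y)) (0≤fromℕ (u k)))
      k/β≤k : fromℕ k / β ≤ fromℕ k
      k/β≤k = *-cancelʳ-≤ 0<β (begin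
        fromℕ k / β * β   ≡⟨ x/y*y≡x (fromℕ k) 0<β ⟩
        fromℕ k           ≡⟨ *-identityʳ (fromℕ k) ⟨
        fromℕ k * 1#      ≤⟨ *-monoʳ-≤ (0≤fromℕ k) 1≤β ⟩
        fromℕ k * β       ∎)
      cases : Dec (1# ≤ fromℕ k / β) → (fromℕ k / β) ^ʳ y ≤ α
      cases (no 1≰k/β)  = ≤-trans (^ʳ-≤1 1≰k/β 0≤y) 1≤α
      cases (yes 1≤k/β) = ^ʳ-≤ (u k) (w k) (1≤w k) 1≤k/β 1≤α
        (≤-trans (^-mono-≤ (≤-trans 0≤1 1≤k/β) k/β≤k (u k)) k^u≤α^w) (≤-reflexive wy≡u)

  ≤-^ʳ⇒≤-^ : ∀ {β b t k} → 1 ℕ.≤ k → β ≤ fromℕ b → fromℕ t ≤ fromℕ k ^ʳ β → t ℕ.≤ k ℕ.^ b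
  ≤-^ʳ⇒≤-^ {β} {b} {t} {k} 1≤k β≤b t≤k^β = fromℕ-cancel-≤ (≤-trans t≤k^β (^ʳ-≤ b 1 ℕ.≤-refl 1≤fromℕ-k
    (subst (1# ≤_) (sym (fromℕ-^ k b)) (1≤x^n 1≤fromℕ-k b))
    (≤-reflexive (trans (sym (fromℕ-^ k b)) (sym (*-identityʳ _))))
    (subst (_≤ fromℕ b) (sym (trans (cong (_* β) fromℕ-1) (*-identityˡ β))) β≤b)))
    where
    1≤fromℕ-k : 1# ≤ fromℕ k
    1≤fromℕ-k = subst (_≤ fromℕ k) fromℕ-1 (fromℕ-mono 1≤k)

  module Bound {β : ℝ} (1≤β : 1# ≤ β) where

    b : ℕ
    b = proj₁ (archimedean β)

    open Loss (Parameters.exponent b) log 1≤log (Parameters.exponent≤ b) (exponent-asymptotics b) public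

    lower-bound : ∀ k d → 1 ℕ.≤ k → k ℕ.≤ d → ∀ (c : FinSet d → FinSet d) α t →
      fromℕ t ≤ fromℕ k ^ʳ β → IsComposableCoreSet k α t c →
      (fromℕ k / β) ^ʳ (fromℕ k * (1# - loss k)) ≤ α
    lower-bound k d 1≤k k≤d c α t t≤k^β core = ^ʳ-loss≤ 1≤β (1≤factor k≤d core) 1≤k
      (k^exponent≤α^log b 1≤k k≤d (≤-^ʳ⇒≤-^ {b = b} 1≤k (proj₂ (archimedean β)) t≤k^β) core)

theorem1p4 : (R : Reals) →
    let open Reals R
        open DeterminantMaximization R in
    ∀ (β : ℝ) → 1# ≤ β →
    ∃[ δ ] TendsToZero δ ×
      (∀ (k d : ℕ) → 1 ℕ.≤ k → k ℕ.≤ d →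
       ∀ (c : FinSet d → FinSet d) (α : ℝ) (t : ℕ) →
       fromℕ t ≤ fromℕ k ^ʳ β →
       IsComposableCoreSet k α t c →
       (fromℕ k / β) ^ʳ (fromℕ k * (1# - δ k)) ≤ α)
theorem1p4 R β 1≤β = loss , loss-tendsToZero , lower-bound
  where open CoreSets.Bound R 1≤β
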